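{- For every integer $d \geq 2$ there exists a finite simplicial complex which is topologically $d$-representable but not $d$-collapsible.
   Context: Simplicial complexes are finite abstract simplicial complexes; the empty set counts as a face of dimension $-1$. Good covers: a $d$-cell is an open subset of $\mathbb{R}^d$ homeomorphic to an open $d$-ball. A good cover in $\mathbb{R}^d$ is a collection $\mathcal{G}$ of $d$-cells in $\mathbb{R}^d$ such that for every subcollection $\mathcal{G}' \subseteq \mathcal{G}$ the intersection of the sets in $\mathcal{G}'$ is either empty or a $d$-cell. Nerve: the nerve of a collection $\mathcal{F}$ of sets in $\mathbb{R}^d$ is the simplicial complex whose vertices are the sets in $\mathcal{F}$ and whose faces are the collections of vertices with nonempty intersection. Topologically $d$-representable: a finite simplicial complex is topologically $d$-representable if it is isomorphic to the nerve of a (finite) good cover in $\mathbb{R}^d$. $d$-collapsible: let $\mathbf{K}$ be a simplicial complex and let $\sigma$ be a face of $\mathbf{K}$ of dimension at most $d-1$ such that there is only one maximal (with respect to inclusion) face of $\mathbf{K}$ containing $\sigma$. Then the complex $\mathbf{K}' := \mathbf{K} \setminus \{\eta \in \mathbf{K} : \sigma \subseteq \eta\}$ is said to arise from $\mathbf{K}$ by an elementary $d$-collapse. The complex $\mathbf{K}$ is $d$-collapsible if it can be reduced to the empty complex by a (finite) sequence of elementary $d$-collapses. -}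

module Defs where

open import Data.Fin.Base using (Fin)
open import Data.Fin.Subset as Sub using (Subset)
open import Data.Nat.Base as ℕ using (ℕ)
import Data.Nat.Properties as ℕₚ
open import Data.Product using (∃; ∃!; _×_; _,_; proj₁; proj₂)
open import Data.Rational.Base as ℚ using (ℚ; 0ℚ; 1ℚ; ½; ∣_∣; Positive)
import Data.Rational.Properties as ℚₚ
open import Data.Rational.Solver using (module +-*-Solver)
open import Data.Sum.Base using (_⊎_)
import Data.Vec.Base as Vec
open import Data.Vec.Functional using (Vector; foldr)
open import Function.Bundles using (_↔_; _⇔_; Inverse)
open import Level using (0ℓ)
open import Relation.Binary.PropositionalEquality
  using (_≡_; refl; sym; trans; cong; subst)
open import Relation.Nullary.Negation.Core using (¬_)
open import Relation.Unary using (Pred; _∈_; _⊆_; _≐_; Empty; Satisfiable)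

-- Real numbers: Cauchy sequences of rationals, compared with _≈_ below
-- rather than with _≡_.

IsCauchy : (ℕ → ℚ) → Set
IsCauchy s = ∀ ε → 0ℚ ℚ.< ε →
  ∃ λ N → ∀ m n → N ℕ.≤ m → N ℕ.≤ n → ∣ s m ℚ.- s n ∣ ℚ.< ε

record ℝ : Set where
  constructor mkℝ
  field
    seq    : ℕ → ℚ
    cauchy : IsCauchy seq

open ℝ public

private
  open +-*-Solver using (solve; _:+_; _:*_; _:-_; :-_; _:=_)

  abstract
    half-pos : ∀ {ε} → 0ℚ ℚ.< ε → 0ℚ ℚ.< ½ ℚ.* ε
    half-pos {ε} 0<ε = subst (ℚ._< ½ ℚ.* ε) (ℚₚ.*-zeroʳ ½) (ℚₚ.*-monoʳ-<-pos ½ 0<ε)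

    halves : ∀ ε → ½ ℚ.* ε ℚ.+ ½ ℚ.* ε ≡ ε
    halves ε = trans (sym (ℚₚ.*-distribʳ-+ ε ½ ½)) (ℚₚ.*-identityˡ ε)

    cauchy-+ : ∀ {s t} → IsCauchy s → IsCauchy t → IsCauchy (λ n → s n ℚ.+ t n)
    cauchy-+ {s} {t} cs ct ε 0<ε
      with M , hs ← cs (½ ℚ.* ε) (half-pos 0<ε)
         | N , ht ← ct (½ ℚ.* ε) (half-pos 0<ε)
      = M ℕ.⊔ N , λ m n p q → begin-strict
        ∣ (s m ℚ.+ t m) ℚ.- (s n ℚ.+ t n) ∣
          ≡⟨ cong ∣_∣ (solve 4 (λ a b c d → (a :+ b) :- (c :+ d) := (a :- c) :+ (b :- d))
               refl (s m) (t m) (s n) (t n)) ⟩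
        ∣ (s m ℚ.- s n) ℚ.+ (t m ℚ.- t n) ∣
          ≤⟨ ℚₚ.∣p+q∣≤∣p∣+∣q∣ (s m ℚ.- s n) (t m ℚ.- t n) ⟩
        ∣ s m ℚ.- s n ∣ ℚ.+ ∣ t m ℚ.- t n ∣
          <⟨ ℚₚ.+-mono-< (hs m n (ℕₚ.m⊔n≤o⇒m≤o M N p) (ℕₚ.m⊔n≤o⇒m≤o M N q))
                         (ht m n (ℕₚ.m⊔n≤o⇒n≤o M N p) (ℕₚ.m⊔n≤o⇒n≤o M N q)) ⟩
        ½ ℚ.* ε ℚ.+ ½ ℚ.* ε
          ≡⟨ halves ε ⟩
        ε ∎
      where open ℚₚ.≤-Reasoning

    cauchy-neg : ∀ {s} → IsCauchy s → IsCauchy (λ n → ℚ.- s n)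
    cauchy-neg {s} cs ε 0<ε with N , hs ← cs ε 0<ε
      = N , λ m n p q → subst (ℚ._< ε) (eq m n) (hs m n p q)
      where
      eq : ∀ m n → ∣ s m ℚ.- s n ∣ ≡ ∣ ℚ.- s m ℚ.- ℚ.- s n ∣
      eq m n = trans (sym (ℚₚ.∣-p∣≡∣p∣ (s m ℚ.- s n)))
        (cong ∣_∣ (solve 2 (λ a b → :- (a :- b) := (:- a) :- (:- b)) refl (s m) (s n)))

    eventually-bounded : ∀ {s} → IsCauchy s →
      ∃ λ B → Positive B × ∃ λ N → ∀ n → N ℕ.≤ n → ∣ s n ∣ ℚ.≤ B
    eventually-bounded {s} cs with N , hs ← cs 1ℚ (ℚₚ.positive⁻¹ 1ℚ)
      = 1ℚ ℚ.+ ∣ s N ∣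
      , ℚₚ.pos+nonNeg⇒pos 1ℚ ∣ s N ∣ {{ℚₚ.∣-∣-nonNeg (s N)}}
      , N , λ n p → begin
        ∣ s n ∣
          ≡⟨ cong ∣_∣ (solve 2 (λ a b → a := (a :- b) :+ b) refl (s n) (s N)) ⟩
        ∣ (s n ℚ.- s N) ℚ.+ s N ∣
          ≤⟨ ℚₚ.∣p+q∣≤∣p∣+∣q∣ (s n ℚ.- s N) (s N) ⟩
        ∣ s n ℚ.- s N ∣ ℚ.+ ∣ s N ∣
          ≤⟨ ℚₚ.+-monoˡ-≤ ∣ s N ∣ (ℚₚ.<⇒≤ (hs n N p ℕₚ.≤-refl)) ⟩
        1ℚ ℚ.+ ∣ s N ∣ ∎
      where open ℚₚ.≤-Reasoning

    -- A δ with ∣ y ∣ ≤ B and ∣ x ∣ < δ forcing ∣ y * x ∣ < η.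
    scale : ∀ B → Positive B → ∀ η → 0ℚ ℚ.< η →
      ∃ λ δ → 0ℚ ℚ.< δ × (∀ x y → ∣ y ∣ ℚ.≤ B → ∣ x ∣ ℚ.< δ → ∣ y ℚ.* x ∣ ℚ.< η)
    scale B B>0 η 0<η = δ , 0<δ , λ x y y≤B x<δ → begin-strict
        ∣ y ℚ.* x ∣
          ≡⟨ ℚₚ.∣p*q∣≡∣p∣*∣q∣ y x ⟩
        ∣ y ∣ ℚ.* ∣ x ∣
          ≤⟨ ℚₚ.*-monoʳ-≤-nonNeg ∣ x ∣ {{ℚₚ.∣-∣-nonNeg x}} y≤B ⟩
        B ℚ.* ∣ x ∣
          <⟨ ℚₚ.*-monoʳ-<-pos B x<δ ⟩
        B ℚ.* δ
          ≡⟨ sym (ℚₚ.*-assoc B (ℚ.1/ B) η) ⟩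
        (B ℚ.* ℚ.1/ B) ℚ.* η
          ≡⟨ cong (ℚ._* η) (ℚₚ.*-inverseʳ B) ⟩
        1ℚ ℚ.* η
          ≡⟨ ℚₚ.*-identityˡ η ⟩
        η ∎
      where
      open ℚₚ.≤-Reasoning
      instance
        B-pos : Positive B
        B-pos = B>0
        B≢0 : ℚ.NonZero B
        B≢0 = ℚₚ.pos⇒nonZero B
        1/B-pos : Positive (ℚ.1/ B)
        1/B-pos = ℚₚ.1/pos⇒pos B
      δ : ℚ
      δ = ℚ.1/ B ℚ.* η
      0<δ : 0ℚ ℚ.< δ
      0<δ = subst (ℚ._< δ) (ℚₚ.*-zeroʳ (ℚ.1/ B)) (ℚₚ.*-monoʳ-<-pos (ℚ.1/ B) 0<η)

    product-difference : ∀ a b c d →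
      a ℚ.* b ℚ.- c ℚ.* d ≡ a ℚ.* (b ℚ.- d) ℚ.+ d ℚ.* (a ℚ.- c)
    product-difference = solve 4 (λ a b c d →
      a :* b :- c :* d := a :* (b :- d) :+ d :* (a :- c)) refl

    cauchy-* : ∀ {s t} → IsCauchy s → IsCauchy t → IsCauchy (λ n → s n ℚ.* t n)
    cauchy-* {s} {t} cs ct ε 0<ε = go₁ (eventually-bounded cs) (eventually-bounded ct)
      where
      open ℚₚ.≤-Reasoning
      η : ℚ
      η = ½ ℚ.* ε

      Bounded : (ℕ → ℚ) → ℚ → ℕ → Set
      Bounded u B K = ∀ n → K ℕ.≤ n → ∣ u n ∣ ℚ.≤ B

      Scale : ℚ → ℚ → Set
      Scale B δ = ∀ x y → ∣ y ∣ ℚ.≤ B → ∣ x ∣ ℚ.< δ → ∣ y ℚ.* x ∣ ℚ.< η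

      Close : (ℕ → ℚ) → ℚ → ℕ → Set
      Close u δ N = ∀ m n → N ℕ.≤ m → N ℕ.≤ n → ∣ u m ℚ.- u n ∣ ℚ.< δ

      Goal : Set
      Goal = ∃ (Close (λ n → s n ℚ.* t n) ε)

      go₃ : ∀ {A B α β K L M N} → Bounded s A K → Bounded t B L →
            Scale A α → Scale B β → Close s β M → Close t α N → Goal
      go₃ {K = K} {L} {M} {N} bs bt fα fβ hs ht =
        (K ℕ.⊔ L) ℕ.⊔ (M ℕ.⊔ N) , λ m n p q →
        let p₁ = ℕₚ.m⊔n≤o⇒m≤o (K ℕ.⊔ L) (M ℕ.⊔ N) p
            p₂ = ℕₚ.m⊔n≤o⇒n≤o (K ℕ.⊔ L) (M ℕ.⊔ N) p
            q₁ = ℕₚ.m⊔n≤o⇒m≤o (K ℕ.⊔ L) (M ℕ.⊔ N) q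
            q₂ = ℕₚ.m⊔n≤o⇒n≤o (K ℕ.⊔ L) (M ℕ.⊔ N) q
        in begin-strict
        ∣ s m ℚ.* t m ℚ.- s n ℚ.* t n ∣
          ≡⟨ cong ∣_∣ (product-difference (s m) (t m) (s n) (t n)) ⟩
        ∣ s m ℚ.* (t m ℚ.- t n) ℚ.+ t n ℚ.* (s m ℚ.- s n) ∣
          ≤⟨ ℚₚ.∣p+q∣≤∣p∣+∣q∣ (s m ℚ.* (t m ℚ.- t n)) (t n ℚ.* (s m ℚ.- s n)) ⟩
        ∣ s m ℚ.* (t m ℚ.- t n) ∣ ℚ.+ ∣ t n ℚ.* (s m ℚ.- s n) ∣
          <⟨ ℚₚ.+-mono-<
               (fα (t m ℚ.- t n) (s m) (bs m (ℕₚ.m⊔n≤o⇒m≤o K L p₁))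
                 (ht m n (ℕₚ.m⊔n≤o⇒n≤o M N p₂) (ℕₚ.m⊔n≤o⇒n≤o M N q₂)))
               (fβ (s m ℚ.- s n) (t n) (bt n (ℕₚ.m⊔n≤o⇒n≤o K L q₁))
                 (hs m n (ℕₚ.m⊔n≤o⇒m≤o M N p₂) (ℕₚ.m⊔n≤o⇒m≤o M N q₂))) ⟩
        η ℚ.+ η
          ≡⟨ halves ε ⟩
        ε ∎

      go₂ : ∀ {A B K L} → Bounded s A K → Bounded t B L →
            (∃ λ α → 0ℚ ℚ.< α × Scale A α) → (∃ λ β → 0ℚ ℚ.< β × Scale B β) → Goal
      go₂ {A} {B} bs bt (α , 0<α , fα) (β , 0<β , fβ) =
        go₃ {A} {B} {α} {β} bs bt fα fβ (proj₂ (cs β 0<β)) (proj₂ (ct α 0<α))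

      go₁ : (∃ λ A → Positive A × ∃ (Bounded s A)) →
            (∃ λ B → Positive B × ∃ (Bounded t B)) → Goal
      go₁ (A , A>0 , K , bs) (B , B>0 , L , bt) =
        go₂ {A} {B} {K} {L} bs bt
          (scale A A>0 η (half-pos 0<ε)) (scale B B>0 η (half-pos 0<ε))

infix  4 _≈_ _<_
infix  8 -_
infixl 6 _+_ _-_
infixl 7 _*_

_≈_ : ℝ → ℝ → Set
x ≈ y = ∀ ε → 0ℚ ℚ.< ε →
  ∃ λ N → ∀ n → N ℕ.≤ n → ∣ seq x n ℚ.- seq y n ∣ ℚ.< ε

-- The gap ε is what makes this an order on reals: termwise strict
-- inequality alone is also satisfied by some sequences with equal limits.
_<_ : ℝ → ℝ → Set
x < y = ∃ λ ε → 0ℚ ℚ.< ε × ∃ λ N → ∀ n → N ℕ.≤ n → seq x n ℚ.+ ε ℚ.≤ seq y n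

-_ : ℝ → ℝ
- x = mkℝ (λ n → ℚ.- seq x n) (cauchy-neg {seq x} (cauchy x))

_+_ _*_ _-_ : ℝ → ℝ → ℝ
x + y = mkℝ (λ n → seq x n ℚ.+ seq y n) (cauchy-+ {seq x} {seq y} (cauchy x) (cauchy y))
x * y = mkℝ (λ n → seq x n ℚ.* seq y n) (cauchy-* {seq x} {seq y} (cauchy x) (cauchy y))
x - y = x + (- y)

0ℝ : ℝ
0ℝ = mkℝ (λ _ → 0ℚ) (λ ε 0<ε → 0 , λ _ _ _ _ → 0<ε)

ℝ^ : ℕ → Set
ℝ^ d = Vector ℝ d

Region : ℕ → Set₁
Region d = Pred (ℝ^ d) 0ℓ

dist² : ∀ {d} → ℝ^ d → ℝ^ d → ℝ
dist² x y = foldr _+_ 0ℝ (λ i → (x i - y i) * (x i - y i))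

-- Used only with 0ℝ < r.
Ball : ∀ {d} → ℝ^ d → ℝ → Region d
Ball c r x = dist² c x < r * r

-- An open region respects _≈_ coordinatewise, since points with equal
-- coordinates lie in the same balls.
Open : ∀ {d} → Region d → Set
Open U = ∀ x → x ∈ U → ∃ λ δ → 0ℝ < δ × Ball x δ ⊆ U

-- ∃ U is the subspace U. A continuous map between subspaces depends on
-- neither the representing sequences nor the membership proof of its argument.
Continuous : ∀ {d} {U V : Region d} → (∃ U → ∃ V) → Set
Continuous {U = U} f = ∀ (p : ∃ U) ε → 0ℝ < ε → ∃ λ δ → 0ℝ < δ ×
  (∀ (q : ∃ U) → proj₁ q ∈ Ball (proj₁ p) δ → proj₁ (f q) ∈ Ball (proj₁ (f p)) ε)

record Homeomorphism {d} (U V : Region d) : Set where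
  field
    to              : ∃ U → ∃ V
    from            : ∃ V → ∃ U
    to-continuous   : Continuous {U = U} {V} to
    from-continuous : Continuous {U = V} {U} from
    from∘to         : ∀ p i → proj₁ (from (to p)) i ≈ proj₁ p i
    to∘from         : ∀ q i → proj₁ (to (from q)) i ≈ proj₁ q i

IsCell : ∀ {d} → Region d → Set
IsCell U = Open U × ∃ λ c → ∃ λ r → 0ℝ < r × Homeomorphism U (Ball c r)

-- For the empty subcollection this is the whole space.
Intersection : ∀ {d n} → (Fin n → Region d) → Subset n → Region d
Intersection G S x = ∀ i → i Sub.∈ S → x ∈ G i

-- A cover is a set of regions, not a family with repetitions: `distinct`
-- makes subcollections the same thing as sets of indices.
record IsGoodCover {d n} (G : Fin n → Region d) : Set where
  field
    distinct      : ∀ i j → G i ≐ G j → i ≡ j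
    cells         : ∀ i → IsCell (G i)
    intersections : ∀ S → Empty (Intersection G S) ⊎ IsCell (Intersection G S)

FaceFamily : ℕ → Set₁
FaceFamily n = Pred (Subset n) 0ℓ

nerve : ∀ {d n} → (Fin n → Region d) → FaceFamily n
nerve G S = Satisfiable (Intersection G S)

record SimplicialComplex : Set₁ where
  field
    #vertices  : ℕ
    face       : FaceFamily #vertices
    empty-face : Sub.⊥ ∈ face
    vertex     : ∀ v → Sub.⁅ v ⁆ ∈ face
    subface    : ∀ {σ τ} → σ Sub.⊆ τ → τ ∈ face → σ ∈ face

open SimplicialComplex public

image : ∀ {m n} → Fin m ↔ Fin n → Subset m → Subset n
image φ σ = Vec.tabulate (λ j → Vec.lookup σ (Inverse.from φ j))

Isomorphic : ∀ {m n} → FaceFamily m → FaceFamily n → Set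
Isomorphic {m} {n} K L = ∃ λ (φ : Fin m ↔ Fin n) → ∀ σ → σ ∈ K ⇔ image φ σ ∈ L

TopologicallyRepresentable : ℕ → SimplicialComplex → Set₁
TopologicallyRepresentable d K = ∃ λ n → ∃ λ (G : Fin n → Region d) →
  IsGoodCover G × Isomorphic (face K) (nerve G)

-- Collapsing can remove vertices, so it is described on
-- families of faces over a fixed ground set.

Maximal : ∀ {n} → FaceFamily n → FaceFamily n
Maximal K τ = τ ∈ K × (∀ {η} → η ∈ K → τ Sub.⊆ η → η ≡ τ)

_∖_ : ∀ {n} → FaceFamily n → Subset n → FaceFamily n
(K ∖ σ) η = η ∈ K × ¬ (σ Sub.⊆ η)

-- A face has dimension at most d - 1 when it has at most d vertices.
record ElementaryCollapse {n} (d : ℕ) (K : FaceFamily n) (σ : Subset n) : Set where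
  field
    is-face        : σ ∈ K
    dimension      : Sub.∣ σ ∣ ℕ.≤ d
    unique-maximal : ∃! _≡_ λ τ → Maximal K τ × σ Sub.⊆ τ

-- Both the complex {∅} and the family with no faces at all (reached by a
-- collapse with σ = ∅) count as the empty complex.
data CollapsesToEmpty {n} (d : ℕ) (K : FaceFamily n) : Set where
  empty    : (∀ {σ} → σ ∈ K → σ ≡ Sub.⊥) → CollapsesToEmpty d K
  collapse : ∀ σ → ElementaryCollapse d K σ → CollapsesToEmpty d (K ∖ σ) →
             CollapsesToEmpty d K

Collapsible : ℕ → SimplicialComplex → Set
Collapsible d K = CollapsesToEmpty d (face K)

-- Counterexample in the plane: work in coordinates α + β + γ = 0 and take three "bows" around a
-- disc, each with both ends tucked under its neighbours, three "caps" below the bows and three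
-- "kites" around the centre. Their nerve is a contractible 2-complex of dunce hat type: every edge
-- lies in two or more triangles, hence no face of size at most 2 lies in a unique maximal face and
-- not a single elementary 2-collapse is possible. Every intersection of these polygons is empty or a
-- union of convex pieces with a common point, so it is star-shaped and its gauge stretches it onto
-- the plane.
--
-- Replacing each region U by ℝ × U and adding the half-spaces x₀ > 0 and x₀ < 0 suspends the nerve,
-- which keeps the property that every face of size at most d lies in two facets of size d + 1.
--
-- Since square roots are not available, the ball is identified with Euclidean space by the rational
-- projective map to a paraboloid, not radially.
module Submission where

open import Defs renaming
  ( _+_ to _+ᴿ_; _*_ to _*ᴿ_; _-_ to _-ᴿ_; -_ to -ᴿ_; _<_ to _<ᴿ_; _≈_ to _≈ᴿ_; 0ℝ to 0ᴿ )
open import Data.Bool.Base using (Bool; true; false; T; _∧_; _∨_; not; if_then_else_)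
open import Data.Bool.ListAction using (any; all)
import Data.Bool.Properties as Boolₚ
open import Data.Bool.Properties using (T-∧; T-∨)
open import Data.Empty using (⊥; ⊥-elim)
open import Data.Fin.Base using (Fin; zero; suc)
import Data.Fin.Properties as Finₚ
open import Data.Fin.Subset as Sub using (Subset; inside; outside)
import Data.Fin.Subset.Properties as Subₚ
open import Data.Integer.Base as ℤ using (ℤ; 0ℤ; -1ℤ)
import Data.Integer.Properties as ℤₚ
open import Data.List.Base as List using (List; []; _∷_; _++_; cartesianProductWith)
open import Data.List.Membership.Propositional using (find) renaming (_∈_ to _∈ₗ_)
open import Data.List.Membership.Propositional.Properties using (∈-allFin)
open import Data.List.Relation.Unary.All as All using (All; []; _∷_)
import Data.List.Relation.Unary.All.Properties as Allₚ
open import Data.List.Relation.Unary.Any using (Any; here; there)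
import Data.List.Relation.Unary.Any.Properties as Anyₚ
open import Data.Nat.Base as ℕ using (ℕ; zero; suc)
import Data.Nat.Properties as ℕₚ
open import Data.Product using (∃; _×_; _,_; proj₁; proj₂)
open import Data.Rational.Base
open import Data.Rational.Properties
open import Data.Rational.Unnormalised.Base as ℚᵘ using (mkℚᵘ; *≡*; *≤*; *<*)
import Data.Rational.Unnormalised.Properties as ℚᵘₚ
open import Data.Sum.Base as Sum using (_⊎_; inj₁; inj₂; [_,_]′)
open import Data.Unit.Base using (⊤; tt)
open import Data.Vec.Base as Vec using (Vec; []; _∷_; here; there)
open import Data.Vec.Functional using (foldr)
import Data.Vec.Properties as Vecₚ
open import Function.Base using (_∘_; id)
open import Function.Bundles using (Equivalence; _⇔_; mk⇔)
open import Function.Construct.Identity using (↔-id)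
open import Level using (0ℓ)
open import Relation.Binary.Definitions using (tri<; tri≈; tri>)
open import Relation.Binary.PropositionalEquality
  using (_≡_; _≢_; refl; sym; trans; cong; cong₂; subst; subst₂; module ≡-Reasoning)
open import Relation.Nullary.Decidable.Core
  using (Dec; yes; no; isYes; toWitness; dec⇒maybe; ¬?; _×-dec_)
open import Relation.Nullary.Negation.Core using (¬_; contradiction)
open import Relation.Unary using (_∈_; _⊆_; _∩_; _≐_; Satisfiable; Empty)
open import Tactic.RingSolver using (solve-∀)
open import Tactic.RingSolver.Core.AlmostCommutativeRing
  using (AlmostCommutativeRing; fromCommutativeRing)

-- Rational arithmetic

-- Nerves of finite families of convex sets in d-space are d-collapsible by a theorem of Wegner, so
-- some regions have to be non-convex; here the bows with their two wings are. By the nerve theorem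
-- the nerve of a planar good cover has no homology in degree 2. If every edge of this 2-complex lay
-- in exactly two triangles, the sum of all triangles would be a 2-cycle modulo 2; so some edges
-- must lie in at least three. The nerve below has 19 triangles. The three edges between bows lie in
-- three triangles each, the other 24 edges in two.
--
-- The order of Cauchy reals is undecidable, so no map may branch on a comparison. Every map is one
-- formula in sums, products, reciprocals, maxima and minima of the terms, and the inverse laws
-- become rational identities that hold from some index on. The combinatorics is a finite
-- computation with integers, and that the regions are pairwise different is deduced from the
-- branching of the nerve.

ℚ-ring : AlmostCommutativeRing 0ℓ 0ℓ
ℚ-ring = fromCommutativeRing +-*-commutativeRing λ x → dec⇒maybe (0ℚ ≟ x)

≤-by-gap : ∀ {a b c} → 0ℚ ≤ c → a + c ≡ b → a ≤ b
≤-by-gap {a} {b} {c} 0≤c eq = subst₂ _≤_ (+-identityʳ a) eq (+-monoʳ-≤ a 0≤c)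

<-by-gap : ∀ {a b c} → 0ℚ < c → a + c ≡ b → a < b
<-by-gap {a} {b} {c} 0<c eq = subst₂ _<_ (+-identityʳ a) eq (+-monoʳ-< a 0<c)

0≤-gap : ∀ {a b} → a ≤ b → 0ℚ ≤ b - a
0≤-gap {a} {b} a≤b = subst (_≤ b - a) (+-inverseʳ a) (+-monoˡ-≤ (- a) a≤b)

0≤-+ : ∀ {a b} → 0ℚ ≤ a → 0ℚ ≤ b → 0ℚ ≤ a + b
0≤-+ 0≤a 0≤b = +-mono-≤ 0≤a 0≤b

0<-+ : ∀ {a b} → 0ℚ < a → 0ℚ ≤ b → 0ℚ < a + b
0<-+ 0<a 0≤b = +-mono-<-≤ 0<a 0≤b

0≤-* : ∀ {a b} → 0ℚ ≤ a → 0ℚ ≤ b → 0ℚ ≤ a * b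
0≤-* {a} {b} 0≤a 0≤b =
  nonNegative⁻¹ (a * b) {{nonNeg*nonNeg⇒nonNeg a {{nonNegative 0≤a}} b {{nonNegative 0≤b}}}}

0<-* : ∀ {a b} → 0ℚ < a → 0ℚ < b → 0ℚ < a * b
0<-* {a} {b} 0<a 0<b =
  positive⁻¹ (a * b) {{pos*pos⇒pos a {{positive 0<a}} b {{positive 0<b}}}}

0<1 : 0ℚ < 1ℚ
0<1 = positive⁻¹ 1ℚ

0<½* : ∀ {ε} → 0ℚ < ε → 0ℚ < ½ * ε
0<½* = 0<-* (positive⁻¹ ½)

halves : ∀ ε → ½ * ε + ½ * ε ≡ ε
halves = solve-∀ ℚ-ring

½*-< : ∀ {ε} → 0ℚ < ε → ½ * ε < ε
½*-< {ε} 0<ε = <-by-gap (0<½* 0<ε) (halves ε)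

0≤-square : ∀ a → 0ℚ ≤ a * a
0≤-square a with ≤-total 0ℚ a
... | inj₁ 0≤a = 0≤-* 0≤a 0≤a
... | inj₂ a≤0 = subst (0ℚ ≤_) (lemma a) (0≤-* (neg-antimono-≤ a≤0) (neg-antimono-≤ a≤0))
  where
  lemma : ∀ a → (- a) * (- a) ≡ a * a
  lemma = solve-∀ ℚ-ring

-- The value at 0 is junk.
inv : ℚ → ℚ
inv q with q ≟ 0ℚ
... | yes _   = 0ℚ
... | no q≢0 = (1/ q) {{≢-nonZero q≢0}}

inv-inverse : ∀ {q} → 0ℚ < q → inv q * q ≡ 1ℚ
inv-inverse {q} 0<q with q ≟ 0ℚ
... | yes refl = ⊥-elim (<-irrefl refl 0<q)
... | no q≢0  = *-inverseˡ q {{≢-nonZero q≢0}}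

0<-inv : ∀ {q} → 0ℚ < q → 0ℚ < inv q
0<-inv {q} 0<q = *-cancelʳ-<-nonNeg q {{nonNegative (<⇒≤ 0<q)}}
  (subst₂ _<_ (sym (*-zeroˡ q)) (sym (inv-inverse 0<q)) 0<1)

inv-unique : ∀ {q r} → 0ℚ < q → r * q ≡ 1ℚ → r ≡ inv q
inv-unique {q} {r} 0<q eq = begin
  r                 ≡⟨ *-identityʳ r ⟨
  r * 1ℚ            ≡⟨ cong (r *_) (inv-inverse 0<q) ⟨
  r * (inv q * q)   ≡⟨ lemma r q (inv q) ⟩
  (r * q) * inv q   ≡⟨ cong (_* inv q) eq ⟩
  1ℚ * inv q        ≡⟨ *-identityˡ (inv q) ⟩
  inv q             ∎
  where
  open ≡-Reasoning
  lemma : ∀ r q i → r * (i * q) ≡ (r * q) * i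
  lemma = solve-∀ ℚ-ring

p≤∣p∣ : ∀ p → p ≤ ∣ p ∣
p≤∣p∣ p with ≤-total 0ℚ p
... | inj₁ 0≤p = ≤-reflexive (sym (0≤p⇒∣p∣≡p 0≤p))
... | inj₂ p≤0 = ≤-trans p≤0 (0≤∣p∣ p)

∣p∣≤q : ∀ {p q} → p ≤ q → - p ≤ q → ∣ p ∣ ≤ q
∣p∣≤q {p} {q} p≤q -p≤q with ∣p∣≡p∨∣p∣≡-p p
... | inj₁ eq = subst (_≤ q) (sym eq) p≤q
... | inj₂ eq = subst (_≤ q) (sym eq) -p≤q

-- A weak inequality, so that estimates combine without case distinctions at zero; halving ε
-- recovers the strict inequality of `IsCauchy` and `_≈ᴿ_`. The record lets ε, a and b be inferred
-- from a proof.
record Near (ε a b : ℚ) : Set where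
  constructor near
  field distance : ∣ a - b ∣ ≤ ε

open Near public

near⇒≤ : ∀ {ε a b} → Near ε a b → a ≤ b + ε
near⇒≤ {ε} {a} {b} (near h) = ≤-by-gap (0≤-gap (≤-trans (p≤∣p∣ (a - b)) h)) (lemma a b ε)
  where
  lemma : ∀ a b ε → a + (ε - (a - b)) ≡ b + ε
  lemma = solve-∀ ℚ-ring

near-sym : ∀ {ε a b} → Near ε a b → Near ε b a
near-sym {ε} {a} {b} (near h) =
  near (subst (_≤ ε) (trans (sym (∣-p∣≡∣p∣ (a - b))) (cong ∣_∣ (lemma a b))) h)
  where
  lemma : ∀ a b → - (a - b) ≡ b - a
  lemma = solve-∀ ℚ-ring

≤⇒near : ∀ {ε a b} → a ≤ b + ε → b ≤ a + ε → Near ε a b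
≤⇒near {ε} {a} {b} h₁ h₂ = near
  (∣p∣≤q (≤-by-gap (0≤-gap h₁) (lemma₁ a b ε)) (≤-by-gap (0≤-gap h₂) (lemma₂ a b ε)))
  where
  lemma₁ : ∀ a b ε → (a - b) + ((b + ε) - a) ≡ ε
  lemma₁ = solve-∀ ℚ-ring
  lemma₂ : ∀ a b ε → - (a - b) + ((a + ε) - b) ≡ ε
  lemma₂ = solve-∀ ℚ-ring

near-refl : ∀ {ε} a → 0ℚ ≤ ε → Near ε a a
near-refl {ε} a 0≤ε = near (subst (_≤ ε) (cong ∣_∣ (sym (+-inverseʳ a))) 0≤ε)

near-mono : ∀ {ε η a b} → ε ≤ η → Near ε a b → Near η a b
near-mono ε≤η (near h) = near (≤-trans h ε≤η)

near-+ : ∀ {ε η a b c d} → Near ε a b → Near η c d → Near (ε + η) (a + c) (b + d)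
near-+ {ε} {η} {a} {b} {c} {d} (near h) (near k) = near (begin
  ∣ (a + c) - (b + d) ∣       ≡⟨ cong ∣_∣ (lemma a b c d) ⟩
  ∣ (a - b) + (c - d) ∣       ≤⟨ ∣p+q∣≤∣p∣+∣q∣ (a - b) (c - d) ⟩
  ∣ a - b ∣ + ∣ c - d ∣       ≤⟨ +-mono-≤ h k ⟩
  ε + η                       ∎)
  where
  open ≤-Reasoning
  lemma : ∀ a b c d → (a + c) - (b + d) ≡ (a - b) + (c - d)
  lemma = solve-∀ ℚ-ring

near-neg : ∀ {ε a b} → Near ε a b → Near ε (- a) (- b)
near-neg {ε} {a} {b} h = near (subst (_≤ ε) (cong ∣_∣ (lemma a b)) (distance (near-sym h)))
  where
  lemma : ∀ a b → b - a ≡ - a - - b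
  lemma = solve-∀ ℚ-ring

near-trans : ∀ {ε η a b c} → Near ε a b → Near η b c → Near (ε + η) a c
near-trans {ε} {η} {a} {b} {c} (near h) (near k) = near (begin
  ∣ a - c ∣                   ≡⟨ cong ∣_∣ (lemma a b c) ⟩
  ∣ (a - b) + (b - c) ∣       ≤⟨ ∣p+q∣≤∣p∣+∣q∣ (a - b) (b - c) ⟩
  ∣ a - b ∣ + ∣ b - c ∣       ≤⟨ +-mono-≤ h k ⟩
  ε + η                       ∎)
  where
  open ≤-Reasoning
  lemma : ∀ a b c → a - c ≡ (a - b) + (b - c)
  lemma = solve-∀ ℚ-ring

near-⊔ : ∀ {ε a b c d} → Near ε a b → Near ε c d → Near ε (a ⊔ c) (b ⊔ d)
near-⊔ {ε} {a} {b} {c} {d} h k = ≤⇒near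
  (⊔-lub (≤-trans (near⇒≤ h) (+-monoˡ-≤ ε (p≤p⊔q b d)))
         (≤-trans (near⇒≤ k) (+-monoˡ-≤ ε (p≤q⊔p b d))))
  (⊔-lub (≤-trans (near⇒≤ (near-sym h)) (+-monoˡ-≤ ε (p≤p⊔q a c)))
         (≤-trans (near⇒≤ (near-sym k)) (+-monoˡ-≤ ε (p≤q⊔p a c))))

near-⊓ : ∀ {ε a b c d} → Near ε a b → Near ε c d → Near ε (a ⊓ c) (b ⊓ d)
near-⊓ {ε} {a} {b} {c} {d} h k = ≤⇒near
  (lower b d (≤-trans (p⊓q≤p a c) (near⇒≤ h)) (≤-trans (p⊓q≤q a c) (near⇒≤ k)))
  (lower a c (≤-trans (p⊓q≤p b d) (near⇒≤ (near-sym h)))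
             (≤-trans (p⊓q≤q b d) (near⇒≤ (near-sym k))))
  where
  lower : ∀ {x} y z → x ≤ y + ε → x ≤ z + ε → x ≤ (y ⊓ z) + ε
  lower {x} y z p q with ⊓-sel y z
  ... | inj₁ eq = subst (λ m → x ≤ m + ε) (sym eq) p
  ... | inj₂ eq = subst (λ m → x ≤ m + ε) (sym eq) q

near-* : ∀ {ε B a b c d} → ∣ a ∣ ≤ B → ∣ d ∣ ≤ B → Near ε a b → Near ε c d →
         Near (B * ε + B * ε) (a * c) (b * d)
near-* {ε} {B} {a} {b} {c} {d} a≤B d≤B (near h) (near k) = near (begin
  ∣ a * c - b * d ∣                         ≡⟨ cong ∣_∣ (lemma a b c d) ⟩
  ∣ a * (c - d) + d * (a - b) ∣             ≤⟨ ∣p+q∣≤∣p∣+∣q∣ (a * (c - d)) (d * (a - b)) ⟩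
  ∣ a * (c - d) ∣ + ∣ d * (a - b) ∣         ≡⟨ cong₂ _+_ (∣p*q∣≡∣p∣*∣q∣ a (c - d)) (∣p*q∣≡∣p∣*∣q∣ d (a - b)) ⟩
  ∣ a ∣ * ∣ c - d ∣ + ∣ d ∣ * ∣ a - b ∣     ≤⟨ +-mono-≤ (bound a≤B k) (bound d≤B h) ⟩
  B * ε + B * ε                             ∎)
  where
  open ≤-Reasoning
  lemma : ∀ a b c d → a * c - b * d ≡ a * (c - d) + d * (a - b)
  lemma = solve-∀ ℚ-ring
  bound : ∀ {x y} → ∣ x ∣ ≤ B → ∣ y ∣ ≤ ε → ∣ x ∣ * ∣ y ∣ ≤ B * ε
  bound {x} {y} x≤B y≤ε = ≤-trans
    (*-monoʳ-≤-nonNeg ∣ y ∣ {{∣-∣-nonNeg y}} x≤B)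
    (*-monoˡ-≤-nonNeg B {{nonNegative (≤-trans (0≤∣p∣ x) x≤B)}} y≤ε)

-- The difference of the reciprocals is (b - a) / (a b), and a b is at least ε²; the factor `ε * ε`
-- in the hypothesis cancels against it.
near-inv : ∀ {ε η a b} → 0ℚ < ε → ε ≤ a → ε ≤ b → 0ℚ ≤ η →
           Near (η * (ε * ε)) a b → Near η (inv a) (inv b)
near-inv {ε} {η} {a} {b} 0<ε ε≤a ε≤b 0≤η h =
  ≤⇒near (half ε≤a ε≤b (near-sym h)) (half ε≤b ε≤a h)
  where
  half : ∀ {x y} → ε ≤ x → ε ≤ y → Near (η * (ε * ε)) y x → inv x ≤ inv y + η
  half {x} {y} ε≤x ε≤y k = ≤-by-gap
    (0≤-* (0≤-* (<⇒≤ (0<-inv 0<x)) (<⇒≤ (0<-inv 0<y)))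
      (0≤-+ (0≤-gap (near⇒≤ k)) (0≤-* 0≤η (0≤-+ (0≤-* 0≤ε (0≤-gap ε≤y)) (0≤-* (<⇒≤ 0<y) (0≤-gap ε≤x))))))
    eq
    where
    open ≡-Reasoning
    0≤ε = <⇒≤ 0<ε
    0<x = <-≤-trans 0<ε ε≤x
    0<y = <-≤-trans 0<ε ε≤y
    X = inv x
    Y = inv y
    -- The gap is X Y (x - y + η x y), written as a sum of visibly nonnegative terms.
    lemma₁ : ∀ x y X Y η ε →
      X + (X * Y) * (((x + η * (ε * ε)) - y) + η * (ε * (y - ε) + y * (x - ε)))
      ≡ X + (X * x) * Y - X * (Y * y) + η * ((X * x) * (Y * y))
    lemma₁ = solve-∀ ℚ-ring
    lemma₂ : ∀ X Y η → X + 1ℚ * Y - X * 1ℚ + η * (1ℚ * 1ℚ) ≡ Y + η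
    lemma₂ = solve-∀ ℚ-ring
    eq : X + (X * Y) * (((x + η * (ε * ε)) - y) + η * (ε * (y - ε) + y * (x - ε))) ≡ Y + η
    eq = begin
      _ ≡⟨ lemma₁ x y X Y η ε ⟩
      X + (X * x) * Y - X * (Y * y) + η * ((X * x) * (Y * y))
        ≡⟨ cong₂ (λ s t → X + s * Y - X * t + η * (s * t)) (inv-inverse 0<x) (inv-inverse 0<y) ⟩
      X + 1ℚ * Y - X * 1ℚ + η * (1ℚ * 1ℚ)
        ≡⟨ lemma₂ X Y η ⟩
      Y + η ∎

-- Real numbers and continuity

Ev : (ℕ → Set) → Set
Ev P = ∃ λ N → ∀ n → N ℕ.≤ n → P n

ev-pure : ∀ {P} → (∀ n → P n) → Ev P
ev-pure h = 0 , λ n _ → h n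

ev-map : ∀ {P Q} → (∀ {n} → P n → Q n) → Ev P → Ev Q
ev-map f (N , h) = N , λ n p → f (h n p)

ev-zip : ∀ {P Q R} → (∀ {n} → P n → Q n → R n) → Ev P → Ev Q → Ev R
ev-zip f (M , h) (N , k) = M ℕ.⊔ N , λ n p →
  f (h n (ℕₚ.m⊔n≤o⇒m≤o M N p)) (k n (ℕₚ.m⊔n≤o⇒n≤o M N p))

ev-all : ∀ d {P : Fin d → ℕ → Set} → (∀ i → Ev (P i)) → Ev (λ n → ∀ i → P i n)
ev-all zero    h = ev-pure λ n ()
ev-all (suc d) h = ev-zip (λ { a b zero → a ; a b (suc i) → b i }) (h zero) (ev-all d (h ∘ suc))

ev-witness : ∀ {P} → Ev P → ∃ P
ev-witness (N , h) = N , h N ℕₚ.≤-refl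

record Close (ε : ℚ) (x y : ℝ) : Set where
  constructor close
  field eventually : Ev (λ n → Near ε (seq x n) (seq y n))

open Close public

close-mono : ∀ {ε η x y} → ε ≤ η → Close ε x y → Close η x y
close-mono ε≤η (close h) = close (ev-map (near-mono ε≤η) h)

close⇒≈ : ∀ x y → (∀ ε → 0ℚ < ε → Close ε x y) → x ≈ᴿ y
close⇒≈ x y h ε 0<ε = ev-map (λ k → ≤-<-trans (distance k) (½*-< 0<ε)) (eventually (h (½ * ε) (0<½* 0<ε)))

≈⇒close : ∀ x y {ε} → 0ℚ < ε → x ≈ᴿ y → Close ε x y
≈⇒close x y 0<ε h = close (ev-map (near ∘ <⇒≤) (h _ 0<ε))

ev-≡⇒≈ : ∀ x y → Ev (λ n → seq x n ≡ seq y n) → x ≈ᴿ y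
ev-≡⇒≈ x y h = close⇒≈ x y λ ε 0<ε →
  close (ev-map (λ {n} eq → subst (Near ε (seq x n)) eq (near-refl (seq x n) (<⇒≤ 0<ε))) h)

≈-trans : ∀ x y z → x ≈ᴿ y → y ≈ᴿ z → x ≈ᴿ z
≈-trans x y z h k = close⇒≈ x z λ ε 0<ε → close (ev-zip
  (λ {n} a b → subst (λ η → Near η (seq x n) (seq z n)) (halves ε) (near-trans a b))
  (eventually (≈⇒close x y (0<½* 0<ε) h)) (eventually (≈⇒close y z (0<½* 0<ε) k)))

NearCauchy : (ℕ → ℚ) → Set
NearCauchy s = ∀ ε → 0ℚ < ε → ∃ λ N → ∀ m n → N ℕ.≤ m → N ℕ.≤ n → Near ε (s m) (s n)

cauchy⇒near : ∀ x → NearCauchy (seq x)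
cauchy⇒near x ε 0<ε with N , h ← cauchy x ε 0<ε = N , λ m n p q → near (<⇒≤ (h m n p q))

abstract
  near⇒cauchy : ∀ {s} → NearCauchy s → IsCauchy s
  near⇒cauchy h ε 0<ε with N , k ← h (½ * ε) (0<½* 0<ε) =
    N , λ m n p q → ≤-<-trans (distance (k m n p q)) (½*-< 0<ε)

bounded : ∀ x → ∃ λ B → 0ℚ ≤ B × Ev (λ n → ∣ seq x n ∣ ≤ B)
bounded x with N , h ← cauchy⇒near x 1ℚ 0<1 =
  ∣ seq x N ∣ + 1ℚ , 0≤-+ (0≤∣p∣ (seq x N)) (<⇒≤ 0<1) , N , λ n p →
  ∣p∣≤q (≤-trans (near⇒≤ (h n N p ℕₚ.≤-refl)) (+-monoˡ-≤ 1ℚ (p≤∣p∣ (seq x N))))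
        (≤-trans (near⇒≤ (near-neg (h n N p ℕₚ.≤-refl)))
          (+-monoˡ-≤ 1ℚ (subst (- seq x N ≤_) (∣-p∣≡∣p∣ (seq x N)) (p≤∣p∣ (- seq x N)))))

const : ℚ → ℝ
const q = mkℝ (λ _ → q) (near⇒cauchy λ ε 0<ε → 0 , λ _ _ _ _ → near-refl q (<⇒≤ 0<ε))

1ᴿ : ℝ
1ᴿ = const 1ℚ

infixl 6 _⊔ᴿ_
infixl 7 _⊓ᴿ_

abstract
  cauchy-lift₂ : ∀ (_∙_ : ℚ → ℚ → ℚ) →
    (∀ {ε a b c d} → Near ε a b → Near ε c d → Near ε (a ∙ c) (b ∙ d)) →
    ∀ x y → IsCauchy (λ n → seq x n ∙ seq y n)
  cauchy-lift₂ _∙_ lip x y = near⇒cauchy λ ε 0<ε → combine (cauchy⇒near x ε 0<ε) (cauchy⇒near y ε 0<ε)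
    where
    combine : ∀ {ε} →
      (∃ λ N → ∀ m n → N ℕ.≤ m → N ℕ.≤ n → Near ε (seq x m) (seq x n)) →
      (∃ λ N → ∀ m n → N ℕ.≤ m → N ℕ.≤ n → Near ε (seq y m) (seq y n)) →
      ∃ λ N → ∀ m n → N ℕ.≤ m → N ℕ.≤ n → Near ε (seq x m ∙ seq y m) (seq x n ∙ seq y n)
    combine (M , h) (N , k) = M ℕ.⊔ N , λ m n p q → lip
      (h m n (ℕₚ.m⊔n≤o⇒m≤o M N p) (ℕₚ.m⊔n≤o⇒m≤o M N q))
      (k m n (ℕₚ.m⊔n≤o⇒n≤o M N p) (ℕₚ.m⊔n≤o⇒n≤o M N q))

_⊔ᴿ_ _⊓ᴿ_ : ℝ → ℝ → ℝ
x ⊔ᴿ y = mkℝ (λ n → seq x n ⊔ seq y n) (cauchy-lift₂ _⊔_ near-⊔ x y)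
x ⊓ᴿ y = mkℝ (λ n → seq x n ⊓ seq y n) (cauchy-lift₂ _⊓_ near-⊓ x y)

record Positiveᴿ (x : ℝ) : Set where
  constructor positiveᴿ
  field
    margin   : ℚ
    0<margin : 0ℚ < margin
    above    : Ev (λ n → margin ≤ seq x n)

open Positiveᴿ public

<ᴿ⇒positive : ∀ x y → x <ᴿ y → Positiveᴿ (y -ᴿ x)
<ᴿ⇒positive x y (ε , 0<ε , h) = positiveᴿ ε 0<ε
  (ev-map (λ {n} k → ≤-by-gap (0≤-gap k) (lemma (seq x n) (seq y n) ε)) h)
  where
  lemma : ∀ x y ε → ε + (y - (x + ε)) ≡ y - x
  lemma = solve-∀ ℚ-ring

positive⇒<ᴿ : ∀ x y → Positiveᴿ (y -ᴿ x) → x <ᴿ y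
positive⇒<ᴿ x y (positiveᴿ ε 0<ε h) = ε , 0<ε ,
  ev-map (λ {n} k → ≤-by-gap (0≤-gap k) (lemma (seq x n) (seq y n) ε)) h
  where
  lemma : ∀ x y ε → (x + ε) + ((y - x) - ε) ≡ y
  lemma = solve-∀ ℚ-ring

positive-ev : ∀ {x y} → Ev (λ n → seq x n ≡ seq y n) → Positiveᴿ x → Positiveᴿ y
positive-ev eqs (positiveᴿ ε 0<ε h) =
  positiveᴿ ε 0<ε (ev-zip (λ {n} eq → subst (ε ≤_) eq) eqs h)

0<ᴿ⇒positive : ∀ x → 0ᴿ <ᴿ x → Positiveᴿ x
0<ᴿ⇒positive x (ε , 0<ε , h) =
  positiveᴿ ε 0<ε (ev-map (λ {n} → subst (_≤ seq x n) (+-identityˡ ε)) h)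

positive⇒0<ᴿ : ∀ x → Positiveᴿ x → 0ᴿ <ᴿ x
positive⇒0<ᴿ x (positiveᴿ ε 0<ε h) =
  ε , 0<ε , ev-map (λ {n} → subst (_≤ seq x n) (sym (+-identityˡ ε))) h

abstract
  cauchy-inv : ∀ x → Positiveᴿ x → IsCauchy (λ n → inv (seq x n))
  cauchy-inv x (positiveᴿ ε 0<ε h) = near⇒cauchy λ η 0<η →
    combine 0<η h (cauchy⇒near x (η * (ε * ε)) (0<-* 0<η (0<-* 0<ε 0<ε)))
    where
    combine : ∀ {η} → 0ℚ < η → Ev (λ n → ε ≤ seq x n) →
      (∃ λ N → ∀ m n → N ℕ.≤ m → N ℕ.≤ n → Near (η * (ε * ε)) (seq x m) (seq x n)) →
      ∃ λ N → ∀ m n → N ℕ.≤ m → N ℕ.≤ n → Near η (inv (seq x m)) (inv (seq x n))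
    combine 0<η (M , h) (N , k) = M ℕ.⊔ N , λ m n p q → near-inv 0<ε
      (h m (ℕₚ.m⊔n≤o⇒m≤o M N p)) (h n (ℕₚ.m⊔n≤o⇒m≤o M N q)) (<⇒≤ 0<η)
      (k m n (ℕₚ.m⊔n≤o⇒n≤o M N p) (ℕₚ.m⊔n≤o⇒n≤o M N q))

-- A positive real may have vanishing terms at the beginning. Since `inv` is total these get a junk
-- value, which affects finitely many terms and hence no limit.
recip : ∀ x → Positiveᴿ x → ℝ
recip x x>0 = mkℝ (λ n → inv (seq x n)) (cauchy-inv x x>0)

positive-recip : ∀ {x} (x>0 : Positiveᴿ x) → Positiveᴿ (recip x x>0)
positive-recip {x} x>0 = below x>0 (bounded x)
  where
  antitone : ∀ {a b} → 0ℚ < a → a ≤ b → inv b ≤ inv a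
  antitone {a} {b} 0<a a≤b = ≤-by-gap
    (0≤-* (0≤-* (<⇒≤ (0<-inv 0<a)) (<⇒≤ (0<-inv 0<b))) (0≤-gap a≤b))
    (trans (lemma₁ a b (inv a) (inv b))
      (trans (cong₂ (λ s t → inv b + inv a * s - t * inv b) (inv-inverse 0<b) (inv-inverse 0<a))
        (lemma₂ (inv a) (inv b))))
    where
    0<b = <-≤-trans 0<a a≤b
    lemma₁ : ∀ a b A B → B + (A * B) * (b - a) ≡ B + A * (B * b) - (A * a) * B
    lemma₁ = solve-∀ ℚ-ring
    lemma₂ : ∀ A B → B + A * 1ℚ - 1ℚ * B ≡ A
    lemma₂ = solve-∀ ℚ-ring
  below : (x>0 : Positiveᴿ x) → (∃ λ B → 0ℚ ≤ B × Ev (λ n → ∣ seq x n ∣ ≤ B)) → Positiveᴿ (recip x x>0)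
  below (positiveᴿ ε 0<ε h) (B , 0≤B , k) =
    -- An upper bound of x gives a lower bound of 1 / x. Adding ε makes the bound positive, as B
    -- itself is only non-negative.
    positiveᴿ (inv (ε + B)) (0<-inv (0<-+ 0<ε 0≤B)) (ev-zip (λ {n} ε≤x x≤B → antitone (<-≤-trans 0<ε ε≤x)
      (≤-trans (≤-trans (p≤∣p∣ (seq x n)) x≤B) (≤-by-gap (<⇒≤ 0<ε) (+-comm B ε)))) h k)

0<-⊓ : ∀ {a b} → 0ℚ < a → 0ℚ < b → 0ℚ < a ⊓ b
0<-⊓ {a} {b} 0<a 0<b with ⊓-sel a b
... | inj₁ eq = subst (0ℚ <_) (sym eq) 0<a
... | inj₂ eq = subst (0ℚ <_) (sym eq) 0<b

-- Continuity and its closure properties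

CloseAll : ∀ {d} → ℚ → ℝ^ d → ℝ^ d → Set
CloseAll δ x y = ∀ i → Close δ (x i) (y i)

closeAll-mono : ∀ {d ε η} {x y : ℝ^ d} → ε ≤ η → CloseAll ε x y → CloseAll η x y
closeAll-mono ε≤η h i = close-mono ε≤η (h i)

-- Continuity on a type A of points whose coordinates are given by π.
record Cts {A : Set} {d} (π : A → ℝ^ d) (f : A → ℝ) : Set where
  constructor cts
  field modulus : ∀ p ε → 0ℚ < ε → ∃ λ δ → 0ℚ < δ ×
                  (∀ q → CloseAll δ (π p) (π q) → Close ε (f p) (f q))

open Cts public

common : ∀ d {P : Fin d → ℚ → Set} → (∀ {i ε η} → ε ≤ η → P i η → P i ε) →
         (∀ i → ∃ λ δ → 0ℚ < δ × P i δ) → ∃ λ δ → 0ℚ < δ × (∀ i → P i δ)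
common zero    mono h = 1ℚ , 0<1 , λ ()
common (suc d) mono h
  with α , 0<α , p ← h zero
     | β , 0<β , q ← common d (λ {i} → mono {suc i}) (h ∘ suc)
  = α ⊓ β , 0<-⊓ 0<α 0<β , λ { zero    → mono (p⊓q≤p α β) p
                             ; (suc i) → mono (p⊓q≤q α β) (q i) }

module _ {A : Set} {d} {π : A → ℝ^ d} where

  cts-const : ∀ {c} → Cts π (λ _ → c)
  cts-const {c} = cts λ p ε 0<ε → 1ℚ , 0<1 , λ q _ →
    close (ev-pure λ n → near-refl (seq c n) (<⇒≤ 0<ε))

  cts-coordinate : ∀ i → Cts π (λ p → π p i)
  cts-coordinate i = cts λ p ε 0<ε → ε , 0<ε , λ q h → h i

  private
    both : ∀ {f g} → Cts π f → Cts π g → ∀ p {ε} → 0ℚ < ε → ∃ λ δ → 0ℚ < δ ×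
           (∀ q → CloseAll δ (π p) (π q) → Close ε (f p) (f q) × Close ε (g p) (g q))
    both (cts f) (cts g) p {ε} 0<ε with α , 0<α , h ← f p ε 0<ε | β , 0<β , k ← g p ε 0<ε =
      α ⊓ β , 0<-⊓ 0<α 0<β , λ q c →
      h q (closeAll-mono (p⊓q≤p α β) c) , k q (closeAll-mono (p⊓q≤q α β) c)

    cts-lift₂ : ∀ {_∙_ : ℚ → ℚ → ℚ} {_∙ᴿ_ : ℝ → ℝ → ℝ} →
      (∀ x y n → seq (x ∙ᴿ y) n ≡ seq x n ∙ seq y n) →
      (∀ {ε a b c d} → Near ε a b → Near ε c d → Near ε (a ∙ c) (b ∙ d)) →
      ∀ {f g} → Cts π f → Cts π g → Cts π (λ p → f p ∙ᴿ g p)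
    cts-lift₂ {_∙_} {_∙ᴿ_} eq lip {f} {g} F G = cts λ p ε 0<ε → weaken p ε (both F G p 0<ε)
      where
      weaken : ∀ p ε → (∃ λ δ → 0ℚ < δ ×
        (∀ q → CloseAll δ (π p) (π q) → Close ε (f p) (f q) × Close ε (g p) (g q))) →
        ∃ λ δ → 0ℚ < δ × (∀ q → CloseAll δ (π p) (π q) → Close ε (f p ∙ᴿ g p) (f q ∙ᴿ g q))
      weaken p ε (δ , 0<δ , h) = δ , 0<δ , λ q c → close (ev-zip
        (λ {n} s t → subst₂ (Near ε) (sym (eq (f p) (g p) n)) (sym (eq (f q) (g q) n)) (lip s t))
        (eventually (proj₁ (h q c))) (eventually (proj₂ (h q c))))

  cts-⊔ : ∀ {f g} → Cts π f → Cts π g → Cts π (λ p → f p ⊔ᴿ g p)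
  cts-⊔ = cts-lift₂ {_⊔_} {_⊔ᴿ_} (λ _ _ _ → refl) near-⊔

  cts-⊓ : ∀ {f g} → Cts π f → Cts π g → Cts π (λ p → f p ⊓ᴿ g p)
  cts-⊓ = cts-lift₂ {_⊓_} {_⊓ᴿ_} (λ _ _ _ → refl) near-⊓

  cts-neg : ∀ {f} → Cts π f → Cts π (λ p → -ᴿ f p)
  cts-neg {f} (cts F) = cts λ p ε 0<ε → weaken p (F p ε 0<ε)
    where
    weaken : ∀ p {ε} → (∃ λ δ → 0ℚ < δ × (∀ q → CloseAll δ (π p) (π q) → Close ε (f p) (f q))) →
      ∃ λ δ → 0ℚ < δ × (∀ q → CloseAll δ (π p) (π q) → Close ε (-ᴿ f p) (-ᴿ f q))
    weaken p (δ , 0<δ , h) = δ , 0<δ , λ q c → close (ev-map near-neg (eventually (h q c)))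

  cts-+ : ∀ {f g} → Cts π f → Cts π g → Cts π (λ p → f p +ᴿ g p)
  cts-+ {f} {g} F G = cts λ p ε 0<ε → weaken p ε (both F G p (0<½* 0<ε))
    where
    weaken : ∀ p ε → (∃ λ δ → 0ℚ < δ × (∀ q → CloseAll δ (π p) (π q) →
        Close (½ * ε) (f p) (f q) × Close (½ * ε) (g p) (g q))) →
      ∃ λ δ → 0ℚ < δ × (∀ q → CloseAll δ (π p) (π q) → Close ε (f p +ᴿ g p) (f q +ᴿ g q))
    weaken p ε (δ , 0<δ , h) = δ , 0<δ , λ q c → close (ev-zip
      (λ {n} s t → subst (λ η → Near η (seq (f p) n + seq (g p) n) (seq (f q) n + seq (g q) n))
        (halves ε) (near-+ s t))
      (eventually (proj₁ (h q c))) (eventually (proj₂ (h q c))))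

  cts-sub : ∀ {f g} → Cts π f → Cts π g → Cts π (λ p → f p -ᴿ g p)
  cts-sub {f} {g} F G = cts-+ {f} {λ p → -ᴿ g p} F (cts-neg G)

  cts-* : ∀ {f g} → Cts π f → Cts π g → Cts π (λ p → f p *ᴿ g p)
  cts-* {f} {g} F G = cts λ p ε 0<ε → at p 0<ε (bounded (f p)) (bounded (g p))
    where
    at : ∀ p {ε} → 0ℚ < ε → (∃ λ B → 0ℚ ≤ B × Ev (λ n → ∣ seq (f p) n ∣ ≤ B)) →
         (∃ λ B → 0ℚ ≤ B × Ev (λ n → ∣ seq (g p) n ∣ ≤ B)) →
         ∃ λ δ → 0ℚ < δ × (∀ q → CloseAll δ (π p) (π q) → Close ε (f p *ᴿ g p) (f q *ᴿ g q))
    at p {ε} 0<ε (A , 0≤A , bf) (B , 0≤B , bg) = weaken (both F G p 0<η)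
      where
      -- C bounds f p by A, and g q by B + 1, where the 1 pays for the distance η ≤ 1 between g p
      -- and g q. Each of the two error terms of a product is then at most C η ≤ ε / 2.
      C = 1ℚ + (A + B)
      0<C : 0ℚ < C
      0<C = 0<-+ 0<1 (0≤-+ 0≤A 0≤B)
      η₀ = inv C * (½ * ε)
      η  = 1ℚ ⊓ η₀
      0<η : 0ℚ < η
      0<η = 0<-⊓ 0<1 (0<-* (0<-inv 0<C) (0<½* 0<ε))
      A≤C : A ≤ C
      A≤C = ≤-by-gap (0≤-+ (<⇒≤ 0<1) 0≤B) (lemma A B)
        where
        lemma : ∀ A B → A + (1ℚ + B) ≡ 1ℚ + (A + B)
        lemma = solve-∀ ℚ-ring
      B+1≤C : B + 1ℚ ≤ C
      B+1≤C = ≤-by-gap 0≤A (lemma A B)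
        where
        lemma : ∀ A B → (B + 1ℚ) + A ≡ 1ℚ + (A + B)
        lemma = solve-∀ ℚ-ring
      Cη≤ε : C * η + C * η ≤ ε
      Cη≤ε = ≤-trans (+-mono-≤ Cη≤ Cη≤) (≤-reflexive (trans (lemma C (inv C) ε)
        (trans (cong (_* ε) (inv-inverse 0<C)) (*-identityˡ ε))))
        where
        Cη≤ : C * η ≤ C * η₀
        Cη≤ = *-monoˡ-≤-nonNeg C {{nonNegative (<⇒≤ 0<C)}} (p⊓q≤q 1ℚ η₀)
        lemma : ∀ C I ε → C * (I * (½ * ε)) + C * (I * (½ * ε)) ≡ (I * C) * ε
        lemma = solve-∀ ℚ-ring
      grow : ∀ {a b} → ∣ a ∣ ≤ B → Near η a b → ∣ b ∣ ≤ C
      grow {a} {b} a≤B h = ≤-trans (∣p∣≤q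
        (≤-trans (near⇒≤ (near-sym h)) (+-mono-≤ (≤-trans (p≤∣p∣ a) a≤B) (p⊓q≤p 1ℚ η₀)))
        (≤-trans (near⇒≤ (near-neg (near-sym h)))
          (+-mono-≤ (≤-trans (subst (- a ≤_) (∣-p∣≡∣p∣ a) (p≤∣p∣ (- a))) a≤B) (p⊓q≤p 1ℚ η₀)))) B+1≤C
      weaken : (∃ λ δ → 0ℚ < δ × (∀ q → CloseAll δ (π p) (π q) →
          Close η (f p) (f q) × Close η (g p) (g q))) →
        ∃ λ δ → 0ℚ < δ × (∀ q → CloseAll δ (π p) (π q) → Close ε (f p *ᴿ g p) (f q *ᴿ g q))
      weaken (δ , 0<δ , h) = δ , 0<δ , λ q c → close (ev-zip
        (λ (s , a) (t , b) → near-mono Cη≤ε (near-* (≤-trans a A≤C) (grow b t) s t))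
        (ev-zip _,_ (eventually (proj₁ (h q c))) bf)
        (ev-zip _,_ (eventually (proj₂ (h q c))) bg))

  cts-recip : ∀ {f} (f>0 : ∀ p → Positiveᴿ (f p)) → Cts π f → Cts π (λ p → recip (f p) (f>0 p))
  cts-recip {f} f>0 (cts F) = cts λ p η 0<η → at p η 0<η (f>0 p)
    where
    at : ∀ p η → 0ℚ < η → Positiveᴿ (f p) → ∃ λ δ → 0ℚ < δ × (∀ q → CloseAll δ (π p) (π q) →
         Close η (recip (f p) (f>0 p)) (recip (f q) (f>0 q)))
    at p η 0<η (positiveᴿ ε 0<ε bf) = weaken (F p κ 0<κ)
      where
      -- Distance at most ε / 2 keeps f q above ε / 2, and κ₀ is the modulus of `near-inv` for that
      -- margin.
      κ₀ = η * ((½ * ε) * (½ * ε))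
      κ  = (½ * ε) ⊓ κ₀
      0<κ : 0ℚ < κ
      0<κ = 0<-⊓ (0<½* 0<ε) (0<-* 0<η (0<-* (0<½* 0<ε) (0<½* 0<ε)))
      shrink : ∀ {a b} → ε ≤ a → Near κ a b → ½ * ε ≤ b
      shrink {a} {b} ε≤a h = ≤-by-gap
        (0≤-+ (0≤-+ (0≤-gap (near⇒≤ h)) (0≤-gap ε≤a)) (0≤-gap (p⊓q≤p (½ * ε) κ₀)))
        (lemma a b ε κ)
        where
        lemma : ∀ a b ε κ → ½ * ε + ((((b + κ) - a) + (a - ε)) + (½ * ε - κ)) ≡ b
        lemma = solve-∀ ℚ-ring
      weaken : (∃ λ δ → 0ℚ < δ × (∀ q → CloseAll δ (π p) (π q) → Close κ (f p) (f q))) →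
        ∃ λ δ → 0ℚ < δ × (∀ q → CloseAll δ (π p) (π q) →
          Close η (recip (f p) (f>0 p)) (recip (f q) (f>0 q)))
      weaken (δ , 0<δ , h) = δ , 0<δ , λ q c → close (ev-zip
        (λ k ε≤a → near-inv (0<½* 0<ε) (≤-trans (<⇒≤ (½*-< 0<ε)) ε≤a) (shrink ε≤a k) (<⇒≤ 0<η)
          (near-mono (p⊓q≤q (½ * ε) κ₀) k))
        (eventually (h q c)) bf)

  cts-∘ : ∀ {B : Set} {e} {ρ : B → ℝ^ e} {g : B → ℝ} (F : A → B) →
          (∀ i → Cts π (λ p → ρ (F p) i)) → Cts ρ g → Cts π (g ∘ F)
  cts-∘ {e = e} {ρ} {g} F F-cts (cts G) = cts λ p ε 0<ε → pull p (G (F p) ε 0<ε)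
    where
    pull : ∀ p {ε} → (∃ λ δ → 0ℚ < δ × (∀ q → CloseAll δ (ρ (F p)) (ρ q) → Close ε (g (F p)) (g q))) →
      ∃ λ δ → 0ℚ < δ × (∀ q → CloseAll δ (π p) (π q) → Close ε (g (F p)) (g (F q)))
    pull p (δ , 0<δ , h)
      with κ , 0<κ , k ← common e
             {λ i κ → ∀ q → CloseAll κ (π p) (π q) → Close δ (ρ (F p) i) (ρ (F q) i)}
             (λ ε≤η c q → c q ∘ closeAll-mono ε≤η) (λ i → modulus (F-cts i) p δ 0<δ)
      = κ , 0<κ , λ q c → h (F q) (λ i → k i q c)

  -- Points with equal coordinates are closer than every δ, so their values are closer than every ε.
  -- This lets inverse laws, which hold only up to `_≈ᴿ_`, pass through a further map when
  -- isomorphisms are composed.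
  cts-ext : ∀ {f} → Cts π f → ∀ p q → (∀ i → π p i ≈ᴿ π q i) → f p ≈ᴿ f q
  cts-ext {f} (cts F) p q h = close⇒≈ (f p) (f q) λ ε 0<ε → pull (F p ε 0<ε)
    where
    pull : ∀ {ε} → (∃ λ δ → 0ℚ < δ × (∀ q → CloseAll δ (π p) (π q) → Close ε (f p) (f q))) →
      Close ε (f p) (f q)
    pull (δ , 0<δ , k) = k q (λ i → ≈⇒close (π p i) (π q i) 0<δ (h i))

-- Charts

∑ : ∀ {d} → (Fin d → ℚ) → ℚ
∑ = foldr _+_ 0ℚ

sumᴿ : ∀ {d} → ℝ^ d → ℝ
sumᴿ = foldr _+ᴿ_ 0ᴿ

seq-sumᴿ : ∀ d (x : ℝ^ d) n → seq (sumᴿ x) n ≡ ∑ (λ i → seq (x i) n)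
seq-sumᴿ zero    x n = refl
seq-sumᴿ (suc d) x n = cong (seq (x zero) n +_) (seq-sumᴿ d (x ∘ suc) n)

∑-cong : ∀ d {f g : Fin d → ℚ} → (∀ i → f i ≡ g i) → ∑ f ≡ ∑ g
∑-cong zero    h = refl
∑-cong (suc d) h = cong₂ _+_ (h zero) (∑-cong d (h ∘ suc))

0≤-∑ : ∀ d {f : Fin d → ℚ} → (∀ i → 0ℚ ≤ f i) → 0ℚ ≤ ∑ f
0≤-∑ zero    h = ≤-refl
0≤-∑ (suc d) h = 0≤-+ (h zero) (0≤-∑ d (h ∘ suc))

∑-term : ∀ d {f : Fin d → ℚ} → (∀ i → 0ℚ ≤ f i) → ∀ i → f i ≤ ∑ f
∑-term (suc d) {f} h zero    = ≤-by-gap (0≤-∑ d (h ∘ suc)) refl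
∑-term (suc d) {f} h (suc i) =
  ≤-trans (∑-term d (h ∘ suc) i) (≤-by-gap (h zero) (+-comm (∑ (f ∘ suc)) (f zero)))

∑-scale : ∀ d c (f : Fin d → ℚ) → ∑ (λ i → c * f i) ≡ c * ∑ f
∑-scale zero    c f = sym (*-zeroʳ c)
∑-scale (suc d) c f =
  trans (cong (c * f zero +_) (∑-scale d c (f ∘ suc))) (sym (*-distribˡ-+ c (f zero) (∑ (f ∘ suc))))

size : ℕ → ℚ
size zero    = 0ℚ
size (suc d) = 1ℚ + size d

0≤-size : ∀ d → 0ℚ ≤ size d
0≤-size zero    = ≤-refl
0≤-size (suc d) = 0≤-+ (<⇒≤ 0<1) (0≤-size d)

∑-bound : ∀ d {f : Fin d → ℚ} {B} → (∀ i → f i ≤ B) → ∑ f ≤ size d * B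
∑-bound zero    {f} {B} h = ≤-reflexive (sym (*-zeroˡ B))
∑-bound (suc d) {f} {B} h = ≤-trans (+-mono-≤ (h zero) (∑-bound d (h ∘ suc))) (≤-reflexive (lemma B (size d)))
  where
  lemma : ∀ B s → B + s * B ≡ (1ℚ + s) * B
  lemma = solve-∀ ℚ-ring

abs-square : ∀ a → ∣ a ∣ * ∣ a ∣ ≡ a * a
abs-square a = trans (sym (∣p*q∣≡∣p∣*∣q∣ a a)) (0≤p⇒∣p∣≡p (0≤-square a))

abs-of-square : ∀ {a δ} → 0ℚ ≤ δ → a * a ≤ δ * δ → ∣ a ∣ ≤ δ
abs-of-square {a} {δ} 0≤δ h with ≤-total ∣ a ∣ δ
... | inj₁ ∣a∣≤δ = ∣a∣≤δ
... | inj₂ δ≤∣a∣ with <-cmp δ ∣ a ∣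
...   | tri≈ _ eq _ = ≤-reflexive (sym eq)
...   | tri> _ _ gt = <⇒≤ gt
...   | tri< lt _ _ = ⊥-elim (<-irrefl refl (<-≤-trans
        (≤-<-trans (*-monoˡ-≤-nonNeg δ {{nonNegative 0≤δ}} δ≤∣a∣)
                   (*-monoˡ-<-pos ∣ a ∣ {{positive (≤-<-trans 0≤δ lt)}} lt))
        (≤-trans (≤-reflexive (abs-square a)) h)))

square-of-abs : ∀ {a δ} → ∣ a ∣ ≤ δ → a * a ≤ δ * δ
square-of-abs {a} {δ} h = ≤-trans (≤-reflexive (sym (abs-square a))) (≤-trans
  (*-monoˡ-≤-nonNeg ∣ a ∣ {{∣-∣-nonNeg a}} h)
  (*-monoʳ-≤-nonNeg δ {{nonNegative (≤-trans (0≤∣p∣ a) h)}} h))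

seq-dist² : ∀ {d} (x y : ℝ^ d) n → seq (dist² x y) n ≡
            ∑ (λ i → (seq (x i) n - seq (y i) n) * (seq (x i) n - seq (y i) n))
seq-dist² {d} x y = seq-sumᴿ d (λ i → (x i -ᴿ y i) *ᴿ (x i -ᴿ y i))

ball⇒close : ∀ {d δ} (x y : ℝ^ d) → 0ℚ < δ → y ∈ Ball x (const δ) → CloseAll δ x y
ball⇒close {d} {δ} x y 0<δ (ε , 0<ε , h) i = close (ev-map (λ {n} k → near (abs-of-square (<⇒≤ 0<δ)
  (≤-trans (∑-term d (λ j → 0≤-square (seq (x j) n - seq (y j) n)) i)
    (≤-trans (≤-by-gap (<⇒≤ 0<ε) (cong (_+ ε) (sym (seq-dist² x y n)))) k)))) h)

close⇒ball : ∀ {d} ε → Positiveᴿ ε → ∃ λ κ → 0ℚ < κ ×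
             (∀ (x y : ℝ^ d) → CloseAll κ x y → y ∈ Ball x ε)
close⇒ball {d} ε (positiveᴿ η 0<η h) = κ , 0<κ , λ x y c → κ * κ , 0<-* 0<κ 0<κ , ev-zip
  (λ {n} a b → begin
    seq (dist² x y) n + κ * κ                     ≡⟨ cong (_+ κ * κ) (seq-dist² x y n) ⟩
    ∑ (λ i → (seq (x i) n - seq (y i) n) * (seq (x i) n - seq (y i) n)) + κ * κ
                                                  ≤⟨ +-monoˡ-≤ (κ * κ) (∑-bound d (λ i → square-of-abs (distance (a i)))) ⟩
    D * (κ * κ) + κ * κ                           ≤⟨ ≤-by-gap (0≤-* (0≤-+ 0≤D (0≤-* 0≤D 0≤D)) (0≤-square κ)) (lemma D κ) ⟩
    ((1ℚ + D) * κ) * ((1ℚ + D) * κ)               ≡⟨ cong (λ t → t * t) κ-η ⟩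
    η * η                                         ≤⟨ *-mono b ⟩
    seq ε n * seq ε n                             ∎)
  (ev-all d (λ i → eventually (c i))) h
  where
  open ≤-Reasoning
  D = size d
  0≤D = 0≤-size d
  -- Dividing by 1 + D avoids a square root: D κ² + κ² ≤ ((1 + D) κ)² = η². The additional κ² is the
  -- gap that the strict inequality of the ball demands.
  κ = inv (1ℚ + D) * η
  0<1+D : 0ℚ < 1ℚ + D
  0<1+D = 0<-+ 0<1 0≤D
  0<κ : 0ℚ < κ
  0<κ = 0<-* (0<-inv 0<1+D) 0<η
  lemma : ∀ D κ → D * (κ * κ) + κ * κ + (D + D * D) * (κ * κ) ≡ ((1ℚ + D) * κ) * ((1ℚ + D) * κ)
  lemma = solve-∀ ℚ-ring
  assoc : ∀ D I η → D * (I * η) ≡ (I * D) * η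
  assoc = solve-∀ ℚ-ring
  κ-η : (1ℚ + D) * κ ≡ η
  κ-η = trans (assoc (1ℚ + D) (inv (1ℚ + D)) η)
    (trans (cong (_* η) (inv-inverse 0<1+D)) (*-identityˡ η))
  *-mono : ∀ {e} → η ≤ e → η * η ≤ e * e
  *-mono {e} η≤e = ≤-trans (*-monoˡ-≤-nonNeg η {{nonNegative (<⇒≤ 0<η)}} η≤e)
    (*-monoʳ-≤-nonNeg e {{nonNegative (≤-trans (<⇒≤ 0<η) η≤e)}} η≤e)

positive-const : ∀ {q} → 0ℚ < q → Positiveᴿ (const q)
positive-const {q} 0<q = positiveᴿ q 0<q (ev-pure λ _ → ≤-refl)

positive-* : ∀ {x y} → Positiveᴿ x → Positiveᴿ y → Positiveᴿ (x *ᴿ y)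
positive-* {x} (positiveᴿ ε 0<ε h) (positiveᴿ η 0<η k) = positiveᴿ (ε * η) (0<-* 0<ε 0<η) (ev-zip
  (λ {n} a b → ≤-trans (*-monoʳ-≤-nonNeg η {{nonNegative (<⇒≤ 0<η)}} a)
    (*-monoˡ-≤-nonNeg (seq x n) {{nonNegative (≤-trans (<⇒≤ 0<ε) a)}} b)) h k)

positive-mono : ∀ {x y} → (∀ n → seq x n ≤ seq y n) → Positiveᴿ x → Positiveᴿ y
positive-mono h (positiveᴿ ε 0<ε k) = positiveᴿ ε 0<ε (ev-map (λ {n} a → ≤-trans a (h n)) k)

positive-ev-< : ∀ {x} → Positiveᴿ x → Ev (λ n → 0ℚ < seq x n)
positive-ev-< (positiveᴿ ε 0<ε h) = ev-map (<-≤-trans 0<ε) h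

-- Open regions and isomorphisms of coordinatised types

record Nbhd {d} (U : Region d) (x : ℝ^ d) : Set where
  constructor nbhd
  field
    radius   : ℚ
    0<radius : 0ℚ < radius
    within   : ∀ y → CloseAll radius x y → y ∈ U

nbhd-map : ∀ {d} {U V : Region d} {x} → U ⊆ V → Nbhd U x → Nbhd V x
nbhd-map U⊆V (nbhd δ 0<δ h) = nbhd δ 0<δ λ y c → U⊆V (h y c)

nbhd-∩ : ∀ {d} {U V : Region d} {x} → Nbhd U x → Nbhd V x → Nbhd (U ∩ V) x
nbhd-∩ (nbhd α 0<α h) (nbhd β 0<β k) = nbhd (α ⊓ β) (0<-⊓ 0<α 0<β) λ y c →
  h y (closeAll-mono (p⊓q≤p α β) c) , k y (closeAll-mono (p⊓q≤q α β) c)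

nbhd-∘suc : ∀ {d} {U : Region d} {x} → Nbhd U (x ∘ suc) → Nbhd (λ y → U (y ∘ suc)) x
nbhd-∘suc (nbhd δ 0<δ h) = nbhd δ 0<δ λ y c → h (y ∘ suc) (c ∘ suc)

OpenRegion : ∀ {d} → Region d → Set
OpenRegion U = ∀ x → x ∈ U → Nbhd U x

openRegion⇒open : ∀ {d} {U : Region d} → OpenRegion U → Open U
openRegion⇒open {U = U} open′ x x∈U = ball (open′ x x∈U)
  where
  ball : Nbhd U x → ∃ λ δ → 0ᴿ <ᴿ δ × Ball x δ ⊆ U
  ball (nbhd δ 0<δ h) =
    const δ , positive⇒0<ᴿ (const δ) (positive-const 0<δ) , λ {y} b → h y (ball⇒close x y 0<δ b)

-- Homeomorphisms between arbitrary types of points with coordinates. Products such as `A × B` and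
-- the half-space take part in chains of isomorphisms without being encoded as regions.
record Iso {A B : Set} {d e} (π : A → ℝ^ d) (ρ : B → ℝ^ e) : Set where
  field
    to      : A → B
    from    : B → A
    to-cts  : ∀ i → Cts π (λ a → ρ (to a) i)
    from-cts : ∀ i → Cts ρ (λ b → π (from b) i)
    from∘to : ∀ a i → π (from (to a)) i ≈ᴿ π a i
    to∘from : ∀ b i → ρ (to (from b)) i ≈ᴿ ρ b i

iso-sym : ∀ {A B : Set} {d e} {π : A → ℝ^ d} {ρ : B → ℝ^ e} → Iso π ρ → Iso ρ π
iso-sym I = record
  { to = from ; from = to ; to-cts = from-cts ; from-cts = to-cts
  ; from∘to = to∘from ; to∘from = from∘to }
  where open Iso I

iso-trans : ∀ {A B C : Set} {d e f} {π : A → ℝ^ d} {ρ : B → ℝ^ e} {σ : C → ℝ^ f} →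
            Iso π ρ → Iso ρ σ → Iso π σ
iso-trans {π = π} {ρ} {σ} I J = record
  { to       = J.to ∘ I.to
  ; from     = I.from ∘ J.from
  ; to-cts   = λ i → cts-∘ I.to I.to-cts (J.to-cts i)
  ; from-cts = λ i → cts-∘ J.from J.from-cts (I.from-cts i)
  ; from∘to  = λ a i → ≈-trans (π (I.from (J.from (J.to (I.to a)))) i) (π (I.from (I.to a)) i) (π a i)
      (cts-ext (I.from-cts i) (J.from (J.to (I.to a))) (I.to a) (J.from∘to (I.to a))) (I.from∘to a i)
  ; to∘from  = λ c i → ≈-trans (σ (J.to (I.to (I.from (J.from c)))) i) (σ (J.to (J.from c)) i) (σ c i)
      (cts-ext (J.to-cts i) (I.to (I.from (J.from c))) (J.from c) (I.to∘from (J.from c))) (J.to∘from c i)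
  }
  where
  module I = Iso I
  module J = Iso J

cts⇒continuous : ∀ {d} {U V : Region d} (f : ∃ U → ∃ V) →
  (∀ i → Cts proj₁ (λ p → proj₁ (f p) i)) → Continuous {U = U} {V} f
cts⇒continuous {d} {U} f f-cts p ε 0<ε = pull (close⇒ball ε (0<ᴿ⇒positive ε 0<ε))
  where
  Close-at : ℚ → ℚ → Fin d → Set
  Close-at κ δ i = ∀ q → CloseAll δ (proj₁ p) (proj₁ q) → Close κ (proj₁ (f p) i) (proj₁ (f q) i)
  pull : (∃ λ κ → 0ℚ < κ × (∀ x y → CloseAll κ x y → y ∈ Ball x ε)) →
    ∃ λ δ → 0ᴿ <ᴿ δ × (∀ (q : ∃ U) → proj₁ q ∈ Ball (proj₁ p) δ → proj₁ (f q) ∈ Ball (proj₁ (f p)) ε)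
  pull (κ , 0<κ , h) = bound (common d {λ i δ → Close-at κ δ i}
      (λ ε≤η c q → c q ∘ closeAll-mono ε≤η) (λ i → modulus (f-cts i) p κ 0<κ))
    where
    bound : (∃ λ δ → 0ℚ < δ × (∀ i → Close-at κ δ i)) → _
    bound (δ , 0<δ , k) = const δ , positive⇒0<ᴿ (const δ) (positive-const 0<δ) , λ q b →
      h (proj₁ (f p)) (proj₁ (f q)) (λ i → k i q (ball⇒close (proj₁ p) (proj₁ q) 0<δ b))

iso⇒homeomorphism : ∀ {d} {U V : Region d} → Iso (proj₁ {B = U}) (proj₁ {B = V}) → Homeomorphism U V
iso⇒homeomorphism I = record
  { to = to ; from = from
  ; to-continuous = cts⇒continuous to to-cts ; from-continuous = cts⇒continuous from from-cts
  ; from∘to = from∘to ; to∘from = to∘from }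
  where open Iso I

-- The model is the whole space and not a ball because a product of Euclidean spaces is again
-- Euclidean, which the suspension relies on. The ball enters once, through its own chart.
Chart : ∀ {d} → Region d → Set
Chart {d} U = Iso (proj₁ {B = U}) (id {A = ℝ^ d})

cons : ∀ {A B : Set} {d} → (A → ℝ^ 1) → (B → ℝ^ d) → A × B → ℝ^ (suc d)
cons π ρ (a , b) zero    = π a zero
cons π ρ (a , b) (suc i) = ρ b i

iso-product : ∀ {A A′ B B′ : Set} {d}
  {π : A → ℝ^ 1} {π′ : A′ → ℝ^ 1} {ρ : B → ℝ^ d} {ρ′ : B′ → ℝ^ d} →
  Iso π π′ → Iso ρ ρ′ → Iso (cons π ρ) (cons π′ ρ′)
iso-product {A} {A′} {B} {B′} {d} {π} {π′} {ρ} {ρ′} I J = record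
  { to       = λ (a , b) → I.to a , J.to b
  ; from     = λ (a , b) → I.from a , J.from b
  ; to-cts   = λ { zero    → cts-∘ proj₁ (λ { zero → cts-coordinate zero }) (I.to-cts zero)
                 ; (suc i) → cts-∘ proj₂ (λ j → cts-coordinate (suc j)) (J.to-cts i) }
  ; from-cts = λ { zero    → cts-∘ proj₁ (λ { zero → cts-coordinate zero }) (I.from-cts zero)
                 ; (suc i) → cts-∘ proj₂ (λ j → cts-coordinate (suc j)) (J.from-cts i) }
  ; from∘to  = λ { (a , b) zero → I.from∘to a zero ; (a , b) (suc i) → J.from∘to b i }
  ; to∘from  = λ { (a , b) zero → I.to∘from a zero ; (a , b) (suc i) → J.to∘from b i }
  }
  where
  module I = Iso I
  module J = Iso J

infixr 7 _⊠_

_⊠_ : ∀ {d} → (ℝ → Set) → Region d → Region (suc d)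
(J ⊠ U) x = J (x zero) × U (x ∘ suc)

scalar : {J : ℝ → Set} → ∃ J → ℝ^ 1
scalar p _ = proj₁ p

≈-refl : ∀ x → x ≈ᴿ x
≈-refl x = ev-≡⇒≈ x x (ev-pure λ _ → refl)

iso-refl : ∀ {A : Set} {d} {π : A → ℝ^ d} → Iso π π
iso-refl {π = π} = record
  { to = id ; from = id ; to-cts = cts-coordinate ; from-cts = cts-coordinate
  ; from∘to = λ a i → ≈-refl (π a i) ; to∘from = λ a i → ≈-refl (π a i) }

-- The half-line

iso-⊠ : ∀ {d} {J : ℝ → Set} {U : Region d} →
        Iso (proj₁ {B = J ⊠ U}) (cons (scalar {J}) (proj₁ {B = U}))
iso-⊠ {J = J} {U} = record
  { to       = λ (x , j , u) → (x zero , j) , (x ∘ suc , u)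
  ; from     = λ ((a , j) , (x , u)) → cons (scalar {J}) (proj₁ {B = U}) ((a , j) , (x , u)) , j , u
  ; to-cts   = λ { zero → cts-coordinate zero ; (suc i) → cts-coordinate (suc i) }
  ; from-cts = cts-coordinate
  ; from∘to  = λ { (x , _) zero → ≈-refl (x zero) ; (x , _) (suc i) → ≈-refl (x (suc i)) }
  ; to∘from  = λ { ((a , _) , _) zero → ≈-refl a ; (_ , (x , _)) (suc i) → ≈-refl (x i) }
  }

iso-ℝ⊠ : ∀ {d} → Iso (cons (id {A = ℝ^ 1}) (id {A = ℝ^ d})) (id {A = ℝ^ (suc d)})
iso-ℝ⊠ = record
  { to       = cons id id
  ; from     = λ x → (λ _ → x zero) , x ∘ suc
  ; to-cts   = cts-coordinate
  ; from-cts = λ { zero → cts-coordinate zero ; (suc i) → cts-coordinate (suc i) }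
  ; from∘to  = λ { (a , x) zero → ≈-refl (a zero) ; (a , x) (suc i) → ≈-refl (x i) }
  ; to∘from  = λ { x zero → ≈-refl (x zero) ; x (suc i) → ≈-refl (x (suc i)) }
  }

Line Above Below : ℝ → Set
Line  _ = ⊤
Above x = 0ᴿ <ᴿ x
Below x = x <ᴿ 0ᴿ

line-iso : Iso (scalar {Line}) (id {A = ℝ^ 1})
line-iso = record
  { to = scalar {Line} ; from = λ x → x zero , tt
  ; to-cts = cts-coordinate ; from-cts = λ _ → cts-coordinate zero
  ; from∘to = λ { (x , _) _ → ≈-refl x } ; to∘from = λ { x zero → ≈-refl (x zero) } }

below-above : Iso (scalar {Below}) (scalar {Above})
below-above = record
  { to       = λ (x , x<0) → -ᴿ x , positive⇒0<ᴿ (-ᴿ x) (positive-ev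
                 (ev-pure λ n → +-identityˡ (- seq x n)) (<ᴿ⇒positive x 0ᴿ x<0))
  ; from     = λ (x , 0<x) → -ᴿ x , positive⇒<ᴿ (-ᴿ x) 0ᴿ (positive-ev
                 (ev-pure λ n → sym (trans (+-identityˡ (- - seq x n)) (neg-involutive (seq x n))))
                 (0<ᴿ⇒positive x 0<x))
  ; to-cts   = λ i → cts-neg (cts-coordinate i)
  ; from-cts = λ i → cts-neg (cts-coordinate i)
  ; from∘to  = λ (x , _) _ → ev-≡⇒≈ (-ᴿ (-ᴿ x)) x (ev-pure λ n → neg-involutive (seq x n))
  ; to∘from  = λ (x , _) _ → ev-≡⇒≈ (-ᴿ (-ᴿ x)) x (ev-pure λ n → neg-involutive (seq x n))
  }
  where
  neg-involutive : ∀ p → - - p ≡ p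
  neg-involutive = solve-∀ ℚ-ring

inv-1 : inv 1ℚ ≡ 1ℚ
inv-1 = sym (inv-unique 0<1 (*-identityˡ 1ℚ))

inv-inv : ∀ {q} → 0ℚ < q → inv (inv q) ≡ q
inv-inv {q} 0<q = sym (inv-unique (0<-inv 0<q) (trans (*-comm q (inv q)) (inv-inverse 0<q)))

inv≤1 : ∀ {q} → 1ℚ ≤ q → inv q ≤ 1ℚ
inv≤1 {q} 1≤q = ≤-by-gap (0≤-* (<⇒≤ (0<-inv 0<q)) (0≤-gap 1≤q))
  (trans (lemma (inv q) q) (inv-inverse 0<q))
  where
  0<q = <-≤-trans 0<1 1≤q
  lemma : ∀ I q → I + I * (q - 1ℚ) ≡ I * q
  lemma = solve-∀ ℚ-ring

1≤inv : ∀ {q} → 0ℚ < q → q ≤ 1ℚ → 1ℚ ≤ inv q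
1≤inv {q} 0<q q≤1 = ≤-by-gap (0≤-* (<⇒≤ (0<-inv 0<q)) (0≤-gap q≤1))
  (trans (lemma (inv q) q) (trans (cong (λ t → 1ℚ + inv q - t) (inv-inverse 0<q)) (cancel (inv q))))
  where
  lemma : ∀ I q → 1ℚ + I * (1ℚ - q) ≡ 1ℚ + I - I * q
  lemma = solve-∀ ℚ-ring
  cancel : ∀ I → 1ℚ + I - 1ℚ ≡ I
  cancel = solve-∀ ℚ-ring

-- The half-line is mapped to the line by x ↦ x - 1 for x ≥ 1 and x ↦ 1 - 1/x for x ≤ 1.
stretch unstretch : ℚ → ℚ
stretch   x = (x ⊔ 1ℚ) - inv (x ⊓ 1ℚ)
unstretch y = (y ⊔ 0ℚ) + inv (1ℚ + (- y ⊔ 0ℚ))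

-- For rationals the two branches can be told apart by comparing with 1, so the inverse laws are
-- proved here and applied to the terms of real sequences.
unstretch-stretch : ∀ {x} → 0ℚ < x → unstretch (stretch x) ≡ x
unstretch-stretch {x} 0<x with ≤-total 1ℚ x
... | inj₁ 1≤x = begin
  unstretch (stretch x)
    ≡⟨ cong unstretch (cong₂ (λ s t → s - t) (p≥q⇒p⊔q≡p 1≤x) (trans (cong inv (p≥q⇒p⊓q≡q 1≤x)) inv-1)) ⟩
  unstretch (x - 1ℚ)
    ≡⟨ cong₂ (λ s t → s + inv (1ℚ + t)) (p≥q⇒p⊔q≡p (0≤-gap 1≤x)) (p≤q⇒p⊔q≡q (neg-antimono-≤ (0≤-gap 1≤x))) ⟩
  (x - 1ℚ) + inv 1ℚ
    ≡⟨ cong (λ t → (x - 1ℚ) + t) inv-1 ⟩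
  (x - 1ℚ) + 1ℚ
    ≡⟨ cancel x ⟩
  x ∎
  where
  open ≡-Reasoning
  cancel : ∀ x → (x - 1ℚ) + 1ℚ ≡ x
  cancel = solve-∀ ℚ-ring
... | inj₂ x≤1 = begin
  unstretch (stretch x)
    ≡⟨ cong unstretch (cong₂ (λ s t → s - inv t) (p≤q⇒p⊔q≡q x≤1) (p≤q⇒p⊓q≡p x≤1)) ⟩
  unstretch (1ℚ - inv x)
    ≡⟨ cong₂ (λ s t → s + inv (1ℚ + t)) (p≤q⇒p⊔q≡q y≤0) (p≥q⇒p⊔q≡p (neg-antimono-≤ y≤0)) ⟩
  0ℚ + inv (1ℚ + - (1ℚ - inv x))
    ≡⟨ trans (+-identityˡ _) (cong inv (cancel (inv x))) ⟩
  inv (inv x)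
    ≡⟨ inv-inv 0<x ⟩
  x ∎
  where
  open ≡-Reasoning
  y≤0 : 1ℚ - inv x ≤ 0ℚ
  y≤0 = ≤-by-gap (0≤-gap (1≤inv 0<x x≤1)) (lemma (inv x))
    where
    lemma : ∀ I → (1ℚ - I) + (I - 1ℚ) ≡ 0ℚ
    lemma = solve-∀ ℚ-ring
  cancel : ∀ I → 1ℚ + - (1ℚ - I) ≡ I
  cancel = solve-∀ ℚ-ring

stretch-unstretch : ∀ y → stretch (unstretch y) ≡ y
stretch-unstretch y with ≤-total 0ℚ y
... | inj₁ 0≤y = begin
  stretch (unstretch y)
    ≡⟨ cong stretch (cong₂ (λ s t → s + inv (1ℚ + t)) (p≥q⇒p⊔q≡p 0≤y) (p≤q⇒p⊔q≡q (neg-antimono-≤ 0≤y))) ⟩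
  stretch (y + inv 1ℚ)
    ≡⟨ cong (λ t → stretch (y + t)) inv-1 ⟩
  stretch (y + 1ℚ)
    ≡⟨ cong₂ (λ s t → s - inv t) (p≥q⇒p⊔q≡p 1≤y+1) (p≥q⇒p⊓q≡q 1≤y+1) ⟩
  (y + 1ℚ) - inv 1ℚ
    ≡⟨ trans (cong (λ t → (y + 1ℚ) - t) inv-1) (cancel y) ⟩
  y ∎
  where
  open ≡-Reasoning
  1≤y+1 : 1ℚ ≤ y + 1ℚ
  1≤y+1 = ≤-by-gap 0≤y (+-comm 1ℚ y)
  cancel : ∀ y → (y + 1ℚ) - 1ℚ ≡ y
  cancel = solve-∀ ℚ-ring
... | inj₂ y≤0 = begin
  stretch (unstretch y)
    ≡⟨ cong stretch (cong₂ (λ s t → s + inv (1ℚ + t)) (p≤q⇒p⊔q≡q y≤0) (p≥q⇒p⊔q≡p (neg-antimono-≤ y≤0))) ⟩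
  stretch (0ℚ + inv (1ℚ + - y))
    ≡⟨ cong stretch (+-identityˡ (inv (1ℚ + - y))) ⟩
  stretch (inv (1ℚ + - y))
    ≡⟨ cong₂ (λ s t → s - inv t) (p≤q⇒p⊔q≡q small) (p≤q⇒p⊓q≡p small) ⟩
  1ℚ - inv (inv (1ℚ + - y))
    ≡⟨ cong (λ t → 1ℚ - t) (inv-inv (<-≤-trans 0<1 1≤1-y)) ⟩
  1ℚ - (1ℚ + - y)
    ≡⟨ cancel y ⟩
  y ∎
  where
  open ≡-Reasoning
  1≤1-y : 1ℚ ≤ 1ℚ + - y
  1≤1-y = ≤-by-gap (neg-antimono-≤ y≤0) refl
  small : inv (1ℚ + - y) ≤ 1ℚ
  small = inv≤1 1≤1-y
  cancel : ∀ y → 1ℚ - (1ℚ + - y) ≡ y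
  cancel = solve-∀ ℚ-ring

stretch-defined : (p : ∃ Above) → Positiveᴿ (proj₁ p ⊓ᴿ 1ᴿ)
stretch-defined (x , 0<x) = min-positive (0<ᴿ⇒positive x 0<x)
  where
  min-positive : Positiveᴿ x → Positiveᴿ (x ⊓ᴿ 1ᴿ)
  min-positive (positiveᴿ ε 0<ε h) = positiveᴿ (ε ⊓ 1ℚ) (0<-⊓ 0<ε 0<1)
    (ev-map (λ {n} a → ⊓-mono-≤ {ε} {seq x n} {1ℚ} {1ℚ} a ≤-refl) h)

stretchᴿ : ∃ Above → ℝ
stretchᴿ p = (proj₁ p ⊔ᴿ 1ᴿ) -ᴿ recip (proj₁ p ⊓ᴿ 1ᴿ) (stretch-defined p)

unstretch-defined : ∀ y → Positiveᴿ (1ᴿ +ᴿ (-ᴿ y ⊔ᴿ 0ᴿ))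
unstretch-defined y =
  positive-mono {1ᴿ} (λ n → ≤-by-gap (p≤q⊔p (- seq y n) 0ℚ) refl) (positive-const 0<1)

unstretchᴿ : ℝ → ℝ
unstretchᴿ y = (y ⊔ᴿ 0ᴿ) +ᴿ recip (1ᴿ +ᴿ (-ᴿ y ⊔ᴿ 0ᴿ)) (unstretch-defined y)

unstretchᴿ>0 : ∀ y → Positiveᴿ (unstretchᴿ y)
unstretchᴿ>0 y = positive-mono
  (λ n → ≤-by-gap (p≤q⊔p (seq y n) 0ℚ) (+-comm (inv (1ℚ + (- seq y n ⊔ 0ℚ))) (seq y n ⊔ 0ℚ)))
  (positive-recip (unstretch-defined y))

above-iso : Iso (scalar {Above}) (id {A = ℝ^ 1})
above-iso = record
  { to       = λ p _ → stretchᴿ p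
  ; from     = λ y → unstretchᴿ (y zero) , positive⇒0<ᴿ (unstretchᴿ (y zero)) (unstretchᴿ>0 (y zero))
  ; to-cts   = λ _ → cts-sub (cts-⊔ (cts-coordinate zero) cts-const)
                           (cts-recip stretch-defined (cts-⊓ (cts-coordinate zero) cts-const))
  ; from-cts = λ _ → cts-+ (cts-⊔ (cts-coordinate zero) cts-const)
      (cts-recip (λ y → unstretch-defined (y zero))
        (cts-+ cts-const (cts-⊔ (cts-neg (cts-coordinate zero)) cts-const)))
  ; from∘to  = λ (x , 0<x) _ → ev-≡⇒≈ (unstretchᴿ (stretchᴿ (x , 0<x))) x
      (ev-map unstretch-stretch (positive-ev-< (0<ᴿ⇒positive x 0<x)))
  ; to∘from  = λ { y zero → ev-≡⇒≈ (stretchᴿ (unstretchᴿ (y zero) ,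
                      positive⇒0<ᴿ (unstretchᴿ (y zero)) (unstretchᴿ>0 (y zero)))) (y zero)
                      (ev-pure λ n → stretch-unstretch (seq (y zero) n)) }
  }

-- The ball

cts-sum : ∀ {A : Set} {e} {π : A → ℝ^ e} d {f : A → ℝ^ d} →
          (∀ i → Cts π (λ a → f a i)) → Cts π (λ a → sumᴿ (f a))
cts-sum zero    h = cts-const
cts-sum (suc d) h = cts-+ (h zero) (cts-sum d (h ∘ suc))

normSq : ∀ {d} → ℝ^ d → ℝ
normSq x = sumᴿ (λ i → x i *ᴿ x i)

squares : ∀ {d} → (Fin d → ℚ) → ℚ
squares f = ∑ (λ i → f i * f i)

seq-normSq : ∀ {d} (x : ℝ^ d) n → seq (normSq x) n ≡ squares (λ i → seq (x i) n)
seq-normSq {d} x = seq-sumᴿ d (λ i → x i *ᴿ x i)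

0≤-squares : ∀ {d} (f : Fin d → ℚ) → 0ℚ ≤ squares f
0≤-squares {d} f = 0≤-∑ d (λ i → 0≤-square (f i))

squares-scale : ∀ {d} (f : Fin d → ℚ) c → squares (λ i → f i * c) ≡ (c * c) * squares f
squares-scale {d} f c = trans (∑-cong d (λ i → lemma (f i) c)) (∑-scale d (c * c) (λ i → f i * f i))
  where
  lemma : ∀ a c → (a * c) * (a * c) ≡ (c * c) * (a * a)
  lemma = solve-∀ ℚ-ring

2ℚ : ℚ
2ℚ = 1ℚ + 1ℚ

origin : ∀ {d} → ℝ^ d
origin _ = 0ᴿ

module _ {k : ℕ} where

  UnitBall : Region (suc k)
  UnitBall = Ball origin 1ᴿ

  interior : (x : ℝ^ (suc k)) → x ∈ UnitBall → Positiveᴿ (1ᴿ -ᴿ normSq x)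
  interior x x∈B = positive-ev (ev-pure same) (<ᴿ⇒positive (dist² origin x) (1ᴿ *ᴿ 1ᴿ) x∈B)
    where
    lemma : ∀ a → (0ℚ - a) * (0ℚ - a) ≡ a * a
    lemma = solve-∀ ℚ-ring
    same : ∀ n → seq (1ᴿ *ᴿ 1ᴿ -ᴿ dist² origin x) n ≡ seq (1ᴿ -ᴿ normSq x) n
    same n = cong (λ s → 1ℚ - s) (trans (seq-dist² origin x n)
      (trans (∑-cong (suc k) (λ i → lemma (seq (x i) n))) (sym (seq-normSq x n))))

  interior⁻¹ : (x : ℝ^ (suc k)) → Positiveᴿ (1ᴿ -ᴿ normSq x) → x ∈ UnitBall
  interior⁻¹ x x>0 = positive⇒<ᴿ (dist² origin x) (1ᴿ *ᴿ 1ᴿ) (positive-ev (ev-pure same) x>0)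
    where
    lemma : ∀ a → a * a ≡ (0ℚ - a) * (0ℚ - a)
    lemma = solve-∀ ℚ-ring
    same : ∀ n → seq (1ᴿ -ᴿ normSq x) n ≡ seq (1ᴿ *ᴿ 1ᴿ -ᴿ dist² origin x) n
    same n = cong (λ s → 1ℚ - s) (trans (seq-normSq x n)
      (trans (∑-cong (suc k) (λ i → lemma (seq (x i) n))) (sym (seq-dist² origin x n))))

  below-pole : (p : ∃ UnitBall) → Positiveᴿ (1ᴿ -ᴿ proj₁ p zero)
  below-pole (x , x∈B) = bound (interior x x∈B)
    where
    -- Twice 1 - z equals (1 - z)² + S + (1 - z² - S), with S the sum of the squares of the other
    -- coordinates. The last summand is at least ε, so ε / 2 is a margin for 1 - z.
    lemma : ∀ z S ε → ½ * ε + ½ * ((1ℚ - z) * (1ℚ - z) + S + (1ℚ - (z * z + S) - ε)) ≡ 1ℚ - z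
    lemma = solve-∀ ℚ-ring
    bound : Positiveᴿ (1ᴿ -ᴿ normSq x) → Positiveᴿ (1ᴿ -ᴿ x zero)
    bound (positiveᴿ ε 0<ε h) = positiveᴿ (½ * ε) (0<½* 0<ε) (ev-map (λ {n} ε≤ → ≤-by-gap
      (0≤-* (<⇒≤ (positive⁻¹ ½)) (0≤-+ (0≤-+ (0≤-square (1ℚ - seq (x zero) n)) (0≤-squares (λ i → seq (x (suc i)) n)))
        (0≤-gap (≤-trans ε≤ (≤-reflexive (cong (λ s → 1ℚ - s) (seq-normSq x n)))))))
      (lemma (seq (x zero) n) (squares (λ i → seq (x (suc i)) n)) ε)) h)

  -- The projective map (z , x) ↦ ((1 + z) / (1 - z) , x / (1 - z)) takes the ball to the
  -- paraboloid s > ∣u∣², which becomes a half-space in the coordinate w = s - ∣u∣².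
  slope : ∃ UnitBall → ℝ
  slope p = recip (1ᴿ -ᴿ proj₁ p zero) (below-pole p)

  -- The coordinate w = s - ∣u∣² in terms of the ball: (1 + z) / (1 - z) - ∣x∣² / (1 - z)² over the
  -- common denominator. It is positive exactly because the point is inside the ball.
  depth : ∃ UnitBall → ℝ
  depth p = (1ᴿ -ᴿ normSq (proj₁ p)) *ᴿ (slope p *ᴿ slope p)

  depth>0 : ∀ p → Positiveᴿ (depth p)
  depth>0 p = positive-* (interior (proj₁ p) (proj₂ p))
    (positive-* (positive-recip (below-pole p)) (positive-recip (below-pole p)))

  HalfSpace : Set
  HalfSpace = ∃ Above × ℝ^ k

  height : HalfSpace → ℝ
  height ((w , _) , u) = w +ᴿ normSq u

  height+1>0 : ∀ h → Positiveᴿ (height h +ᴿ 1ᴿ)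
  height+1>0 ((w , 0<w) , u) = positive-mono {w} (λ n → ≤-by-gap
    (0≤-+ (subst (0ℚ ≤_) (sym (seq-normSq u n)) (0≤-squares (λ i → seq (u i) n))) (<⇒≤ 0<1))
    (sym (+-assoc (seq w n) (seq (normSq u) n) 1ℚ))) (0<ᴿ⇒positive w 0<w)

  factor : HalfSpace → ℝ
  factor h = recip (height h +ᴿ 1ᴿ) (height+1>0 h)

  -- Solving s = (1 + z) / (1 - z) gives z = (s - 1) / (s + 1) and 1 - z = 2 / (s + 1), the factor
  -- that turns u back into x.
  lift : HalfSpace → ℝ^ (suc k)
  lift h@((w , _) , u) zero    = (height h -ᴿ 1ᴿ) *ᴿ factor h
  lift h@((w , _) , u) (suc i) = u i *ᴿ (const 2ℚ *ᴿ factor h)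

  -- 4 w / (s + 1)² is the value of 1 - ∣x∣² at the image of (w , u).
  lift-defect : ∀ {w S s t} → s ≡ w + S → t * (s + 1ℚ) ≡ 1ℚ →
    w * ((2ℚ * t) * (2ℚ * t)) ≡ 1ℚ - (((s - 1ℚ) * t) * ((s - 1ℚ) * t) + ((2ℚ * t) * (2ℚ * t)) * S)
  lift-defect {w} {S} {_} {t} refl e = begin
    w * ((2ℚ * t) * (2ℚ * t))
      ≡⟨ lemma w S t ⟩
    (t * (s + 1ℚ)) * (t * (s + 1ℚ)) - (((s - 1ℚ) * t) * ((s - 1ℚ) * t) + ((2ℚ * t) * (2ℚ * t)) * S)
      ≡⟨ cong (λ q → q * q - (((s - 1ℚ) * t) * ((s - 1ℚ) * t) + ((2ℚ * t) * (2ℚ * t)) * S)) e ⟩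
    1ℚ * 1ℚ - (((s - 1ℚ) * t) * ((s - 1ℚ) * t) + ((2ℚ * t) * (2ℚ * t)) * S) ∎
    where
    open ≡-Reasoning
    s = w + S
    lemma : ∀ w S t → w * (((1ℚ + 1ℚ) * t) * ((1ℚ + 1ℚ) * t)) ≡
      (t * (w + S + 1ℚ)) * (t * (w + S + 1ℚ)) -
      (((w + S - 1ℚ) * t) * ((w + S - 1ℚ) * t) + (((1ℚ + 1ℚ) * t) * ((1ℚ + 1ℚ) * t)) * S)
    lemma = solve-∀ ℚ-ring

  project : ∃ UnitBall → HalfSpace
  project p = (depth p , positive⇒0<ᴿ (depth p) (depth>0 p)) , λ i → proj₁ p (suc i) *ᴿ slope p

  lift-height : ∀ h → Ev (λ n → inv (seq (height h) n + 1ℚ) * (seq (height h) n + 1ℚ) ≡ 1ℚ)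
  lift-height h = ev-map inv-inverse (positive-ev-< (height+1>0 h))

  lift-interior : ∀ h → Positiveᴿ (1ᴿ -ᴿ normSq (lift h))
  lift-interior h@((w , 0<w) , u) = positive-ev
    (ev-map (λ {n} e → trans (lift-defect {w = seq w n} (cong (seq w n +_) (seq-normSq u n)) e)
                             (sym (seq-lift′ n)))
            (lift-height h))
    (positive-* (0<ᴿ⇒positive w 0<w) (positive-* 2t>0 2t>0))
    where
    2t>0 : Positiveᴿ (const 2ℚ *ᴿ factor h)
    2t>0 = positive-* (positive-const (positive⁻¹ 2ℚ)) (positive-recip (height+1>0 h))
    seq-lift′ : ∀ n → let s = seq (height h) n ; t = inv (s + 1ℚ) in seq (1ᴿ -ᴿ normSq (lift h)) n ≡
      1ℚ - (((s - 1ℚ) * t) * ((s - 1ℚ) * t) + ((2ℚ * t) * (2ℚ * t)) * squares (λ i → seq (u i) n))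
    seq-lift′ n = cong (λ q → 1ℚ - q) (trans (seq-normSq (lift h) n)
      (cong (((s - 1ℚ) * t) * ((s - 1ℚ) * t) +_) (squares-scale (λ i → seq (u i) n) (2ℚ * t))))
      where
      s = seq (height h) n
      t = inv (s + 1ℚ)

  embed : HalfSpace → ∃ UnitBall
  embed h = lift h , interior⁻¹ (lift h) (lift-interior h)

  cts-slope : Cts proj₁ slope
  cts-slope = cts-recip below-pole (cts-sub cts-const (cts-coordinate zero))

  cts-normSq : ∀ {A : Set} {e d} {π : A → ℝ^ e} {f : A → ℝ^ d} →
    (∀ i → Cts π (λ a → f a i)) → Cts π (λ a → normSq (f a))
  cts-normSq {d = d} {f = f} h = cts-sum d {λ a i → f a i *ᴿ f a i} (λ i → cts-* (h i) (h i))

  cts-height : Cts (cons scalar id) height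
  cts-height = cts-+ (cts-coordinate zero) (cts-normSq (λ i → cts-coordinate (suc i)))

  cts-factor : Cts (cons scalar id) factor
  cts-factor = cts-recip height+1>0 (cts-+ cts-height cts-const)

  project-cts : ∀ i → Cts proj₁ (λ p → cons scalar id (project p) i)
  project-cts zero    = cts-* (cts-sub cts-const (cts-normSq cts-coordinate)) (cts-* cts-slope cts-slope)
  project-cts (suc i) = cts-* (cts-coordinate (suc i)) cts-slope

  embed-cts : ∀ i → Cts (cons scalar id) (λ h → lift h i)
  embed-cts zero    = cts-* (cts-sub cts-height cts-const) cts-factor
  embed-cts (suc i) = cts-* (cts-coordinate (suc i)) (cts-* cts-const cts-factor)

  -- In the value of s the terms with S cancel and leave (1 + z) / (1 - z), so s + 1 = 2 / (1 - z);
  -- both claims follow from this.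
  embed-project-ℚ : ∀ {z S r s} → r * (1ℚ - z) ≡ 1ℚ → s ≡ (1ℚ - (z * z + S)) * (r * r) + (r * r) * S →
                    0ℚ < s + 1ℚ → inv (s + 1ℚ) ≡ ½ * (1ℚ - z) × (s - 1ℚ) * inv (s + 1ℚ) ≡ z
  embed-project-ℚ {z} {S} {r} {s} e refl 0<s+1 = inverse , (begin
    (s - 1ℚ) * inv (s + 1ℚ)                              ≡⟨ cong ((s - 1ℚ) *_) inverse ⟩
    (s - 1ℚ) * (½ * (1ℚ - z))                            ≡⟨ lemma₃ s z ⟩
    (½ * (1ℚ - z)) * (s + 1ℚ) - (1ℚ - z)                 ≡⟨ cong (λ q → q - (1ℚ - z)) product ⟩
    1ℚ - (1ℚ - z)                                        ≡⟨ lemma₄ z ⟩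
    z                                                    ∎)
    where
    open ≡-Reasoning
    lemma₁ : ∀ z S r → (½ * (1ℚ - z)) * ((1ℚ - (z * z + S)) * (r * r) + (r * r) * S + 1ℚ) ≡
             ½ * ((1ℚ + z) * ((r * (1ℚ - z)) * (r * (1ℚ - z))) + (1ℚ - z))
    lemma₁ = solve-∀ ℚ-ring
    lemma₂ : ∀ z → ½ * ((1ℚ + z) * (1ℚ * 1ℚ) + (1ℚ - z)) ≡ 1ℚ
    lemma₂ = solve-∀ ℚ-ring
    lemma₃ : ∀ s z → (s - 1ℚ) * (½ * (1ℚ - z)) ≡ (½ * (1ℚ - z)) * (s + 1ℚ) - (1ℚ - z)
    lemma₃ = solve-∀ ℚ-ring
    lemma₄ : ∀ z → 1ℚ - (1ℚ - z) ≡ z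
    lemma₄ = solve-∀ ℚ-ring
    product : (½ * (1ℚ - z)) * (s + 1ℚ) ≡ 1ℚ
    product = trans (lemma₁ z S r)
      (trans (cong (λ q → ½ * ((1ℚ + z) * (q * q) + (1ℚ - z))) e) (lemma₂ z))
    inverse : inv (s + 1ℚ) ≡ ½ * (1ℚ - z)
    inverse = sym (inv-unique 0<s+1 product)

  embed-project : ∀ p i → lift (project p) i ≈ᴿ proj₁ p i
  embed-project p@(x , _) i = ev-≡⇒≈ (lift (project p) i) (x i) (ev-zip (λ {n} → coordinate i n)
    (ev-map inv-inverse (positive-ev-< (below-pole p))) (positive-ev-< (height+1>0 (project p))))
    where
    coordinate : ∀ i n → seq (slope p) n * (1ℚ - seq (x zero) n) ≡ 1ℚ →
                 0ℚ < seq (height (project p)) n + 1ℚ → seq (lift (project p) i) n ≡ seq (x i) n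
    coordinate i n e 0<s+1 = at i
      where
      z = seq (x zero) n
      r = seq (slope p) n
      s = seq (height (project p)) n
      S = squares (λ i → seq (x (suc i)) n)
      s-value : s ≡ (1ℚ - (z * z + S)) * (r * r) + (r * r) * S
      s-value = cong₂ (λ a b → (1ℚ - a) * (r * r) + b) (seq-normSq x n)
        (trans (seq-normSq (λ i → x (suc i) *ᴿ slope p) n) (squares-scale (λ i → seq (x (suc i)) n) r))
      solved : inv (s + 1ℚ) ≡ ½ * (1ℚ - z) × (s - 1ℚ) * inv (s + 1ℚ) ≡ z
      solved = embed-project-ℚ {z} {S} {r} {s} e s-value 0<s+1
      lemma : ∀ a r z → (a * r) * ((1ℚ + 1ℚ) * (½ * (1ℚ - z))) ≡ a * (r * (1ℚ - z))
      lemma = solve-∀ ℚ-ring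
      at : ∀ i → seq (lift (project p) i) n ≡ seq (x i) n
      at zero    = proj₂ solved
      at (suc i) = trans (cong (λ t → (seq (x (suc i)) n * r) * (2ℚ * t)) (proj₁ solved))
        (trans (lemma (seq (x (suc i)) n) r z)
          (trans (cong (seq (x (suc i)) n *_) e) (*-identityʳ (seq (x (suc i)) n))))

  project-embed : ∀ h i → cons (scalar {Above}) id (project (embed h)) i ≈ᴿ cons scalar id h i
  project-embed h@((w , 0<w) , u) i =
    ev-≡⇒≈ (cons scalar id (project (embed h)) i) (cons scalar id h i)
    (ev-map (λ {n} → coordinate i n) (positive-ev-< (height+1>0 h)))
    where
    coordinate : ∀ i n → 0ℚ < seq (height h) n + 1ℚ →
      seq (cons (scalar {Above}) id (project (embed h)) i) n ≡ seq (cons (scalar {Above}) id h i) n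
    coordinate i n 0<s+1 = at i
      where
      open ≡-Reasoning
      s = seq (height h) n
      t = inv (s + 1ℚ)
      S = squares (λ i → seq (u i) n)
      ts : t * (s + 1ℚ) ≡ 1ℚ
      ts = inv-inverse 0<s+1
      0<2t : 0ℚ < 2ℚ * t
      0<2t = 0<-* (positive⁻¹ 2ℚ) (0<-inv 0<s+1)
      lemma₁ : ∀ s t → 1ℚ - (s - 1ℚ) * t ≡ (1ℚ + 1ℚ) * t + (1ℚ - t * (s + 1ℚ))
      lemma₁ = solve-∀ ℚ-ring
      lemma₂ : ∀ a → a + (1ℚ - 1ℚ) ≡ a
      lemma₂ = solve-∀ ℚ-ring
      lemma₃ : ∀ w a r → (w * (a * a)) * (r * r) ≡ w * ((r * a) * (r * a))
      lemma₃ = solve-∀ ℚ-ring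
      lemma₄ : ∀ u a r → (u * a) * r ≡ u * (r * a)
      lemma₄ = solve-∀ ℚ-ring
      r = seq (slope (embed h)) n
      -- From t (s + 1) = 1 comes 1 - z = 2 t, so `project` divides by the very factor by which
      -- `lift` multiplied u.
      r-value : r ≡ inv (2ℚ * t)
      r-value = cong inv (trans (lemma₁ s t)
        (trans (cong (λ q → 2ℚ * t + (1ℚ - q)) ts) (lemma₂ (2ℚ * t))))
      r2t : r * (2ℚ * t) ≡ 1ℚ
      r2t = trans (cong (_* (2ℚ * t)) r-value) (inv-inverse 0<2t)
      at : ∀ i → seq (cons (scalar {Above}) id (project (embed h)) i) n ≡ seq (cons (scalar {Above}) id h i) n
      at zero = begin
        (1ℚ - seq (normSq (lift h)) n) * (r * r)
          ≡⟨ cong (λ q → (1ℚ - q) * (r * r)) (trans (seq-normSq (lift h) n)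
               (cong (((s - 1ℚ) * t) * ((s - 1ℚ) * t) +_) (squares-scale (λ i → seq (u i) n) (2ℚ * t)))) ⟩
        (1ℚ - (((s - 1ℚ) * t) * ((s - 1ℚ) * t) + ((2ℚ * t) * (2ℚ * t)) * S)) * (r * r)
          ≡⟨ cong (_* (r * r)) (lift-defect {w = seq w n} {t = t} (cong (seq w n +_) (seq-normSq u n)) ts) ⟨
        (seq w n * ((2ℚ * t) * (2ℚ * t))) * (r * r)
          ≡⟨ lemma₃ (seq w n) (2ℚ * t) r ⟩
        seq w n * ((r * (2ℚ * t)) * (r * (2ℚ * t)))
          ≡⟨ cong (λ q → seq w n * (q * q)) r2t ⟩
        seq w n * (1ℚ * 1ℚ)
          ≡⟨ *-identityʳ (seq w n) ⟩
        seq w n ∎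
      at (suc i) = trans (lemma₄ (seq (u i) n) (2ℚ * t) r)
        (trans (cong (seq (u i) n *_) r2t) (*-identityʳ (seq (u i) n)))

  ball-iso : Iso (proj₁ {B = UnitBall}) (cons (scalar {Above}) (id {A = ℝ^ k}))
  ball-iso = record
    { to = project ; from = embed ; to-cts = project-cts ; from-cts = embed-cts
    ; from∘to = embed-project ; to∘from = project-embed }

  ball-chart : Chart UnitBall
  ball-chart = iso-trans ball-iso (iso-trans (iso-product above-iso iso-refl) iso-ℝ⊠)

  chart⇒cell : {U : Region (suc k)} → OpenRegion U → Chart U → IsCell U
  chart⇒cell open′ chart = openRegion⇒open open′ ,
    origin , 1ᴿ , positive⇒0<ᴿ 1ᴿ (positive-const 0<1) ,
    iso⇒homeomorphism (iso-trans chart (iso-sym ball-chart))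

chart-⊠ : ∀ {d} {J : ℝ → Set} {U : Region d} → Iso (scalar {J}) (id {A = ℝ^ 1}) → Chart U → Chart (J ⊠ U)
chart-⊠ line chart = iso-trans iso-⊠ (iso-trans (iso-product line chart) iso-ℝ⊠)

iso-region : ∀ {d} {U V : Region d} → U ⊆ V → V ⊆ U → Iso (proj₁ {B = U}) (proj₁ {B = V})
iso-region U⊆V V⊆U = record
  { to       = λ (x , u) → x , U⊆V u
  ; from     = λ (x , v) → x , V⊆U v
  ; to-cts   = cts-coordinate
  ; from-cts = cts-coordinate
  ; from∘to  = λ (x , _) i → ≈-refl (x i)
  ; to∘from  = λ (x , _) i → ≈-refl (x i)
  }

-- Star-shaped polygons

-- Polygons have integer coefficients so that the tests on them evaluate quickly; ι carries the
-- results to the rationals. The second argument of `mkℚᵘ` is the denominator minus one.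
ι : ℤ → ℚ
ι z = fromℚᵘ (mkℚᵘ z 0)

ι-+ : ∀ a b → ι (a ℤ.+ b) ≡ ι a + ι b
ι-+ a b = toℚᵘ-injective (begin
  toℚᵘ (ι (a ℤ.+ b))                 ≈⟨ toℚᵘ-fromℚᵘ (mkℚᵘ (a ℤ.+ b) 0) ⟩
  mkℚᵘ (a ℤ.+ b) 0                   ≈⟨ *≡* (cong (ℤ._* ℤ.+ 1)
                                          (sym (cong₂ ℤ._+_ (ℤₚ.*-identityʳ a) (ℤₚ.*-identityʳ b)))) ⟩
  mkℚᵘ a 0 ℚᵘ.+ mkℚᵘ b 0             ≈⟨ ℚᵘₚ.+-cong (toℚᵘ-fromℚᵘ (mkℚᵘ a 0)) (toℚᵘ-fromℚᵘ (mkℚᵘ b 0)) ⟨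
  toℚᵘ (ι a) ℚᵘ.+ toℚᵘ (ι b)         ≈⟨ toℚᵘ-homo-+ (ι a) (ι b) ⟨
  toℚᵘ (ι a + ι b)                   ∎)
  where open ℚᵘₚ.≃-Reasoning

ι-* : ∀ a b → ι (a ℤ.* b) ≡ ι a * ι b
ι-* a b = toℚᵘ-injective (begin
  toℚᵘ (ι (a ℤ.* b))                 ≈⟨ toℚᵘ-fromℚᵘ (mkℚᵘ (a ℤ.* b) 0) ⟩
  mkℚᵘ a 0 ℚᵘ.* mkℚᵘ b 0             ≈⟨ ℚᵘₚ.*-cong (toℚᵘ-fromℚᵘ (mkℚᵘ a 0)) (toℚᵘ-fromℚᵘ (mkℚᵘ b 0)) ⟨
  toℚᵘ (ι a) ℚᵘ.* toℚᵘ (ι b)         ≈⟨ toℚᵘ-homo-* (ι a) (ι b) ⟨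
  toℚᵘ (ι a * ι b)                   ∎)
  where open ℚᵘₚ.≃-Reasoning

ι-neg : ∀ a → ι (ℤ.- a) ≡ - ι a
ι-neg a = toℚᵘ-injective (begin
  toℚᵘ (ι (ℤ.- a))                   ≈⟨ toℚᵘ-fromℚᵘ (mkℚᵘ (ℤ.- a) 0) ⟩
  ℚᵘ.- mkℚᵘ a 0                      ≈⟨ ℚᵘₚ.-‿cong (toℚᵘ-fromℚᵘ (mkℚᵘ a 0)) ⟨
  ℚᵘ.- toℚᵘ (ι a)                    ≈⟨ toℚᵘ-homo‿- (ι a) ⟨
  toℚᵘ (- ι a)                       ∎)
  where open ℚᵘₚ.≃-Reasoning

ι-mono-≤ : ∀ {a b} → a ℤ.≤ b → ι a ≤ ι b
ι-mono-≤ {a} {b} a≤b = toℚᵘ-cancel-≤ (begin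
  toℚᵘ (ι a)   ≃⟨ toℚᵘ-fromℚᵘ (mkℚᵘ a 0) ⟩
  mkℚᵘ a 0     ≤⟨ *≤* (ℤₚ.*-monoʳ-≤-nonNeg (ℤ.+ 1) a≤b) ⟩
  mkℚᵘ b 0     ≃⟨ toℚᵘ-fromℚᵘ (mkℚᵘ b 0) ⟨
  toℚᵘ (ι b)   ∎)
  where open ℚᵘₚ.≤-Reasoning

ι-mono-< : ∀ {a b} → a ℤ.< b → ι a < ι b
ι-mono-< {a} {b} a<b = toℚᵘ-cancel-< (begin-strict
  toℚᵘ (ι a)   ≃⟨ toℚᵘ-fromℚᵘ (mkℚᵘ a 0) ⟩
  mkℚᵘ a 0     <⟨ *<* (ℤₚ.*-monoʳ-<-pos (ℤ.+ 1) a<b) ⟩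
  mkℚᵘ b 0     ≃⟨ toℚᵘ-fromℚᵘ (mkℚᵘ b 0) ⟨
  toℚᵘ (ι b)   ∎)
  where open ℚᵘₚ.≤-Reasoning

-- The open half-plane a x + b y < c.
record HalfPlane : Set where
  constructor halfPlane
  field a b c : ℤ

open HalfPlane

slackℚ : HalfPlane → ℚ → ℚ → ℚ
slackℚ h x y = ι (c h) - (ι (a h) * x + ι (b h) * y)

slack : HalfPlane → ℝ^ 2 → ℝ
slack h x = const (ι (c h)) -ᴿ (const (ι (a h)) *ᴿ x zero +ᴿ const (ι (b h)) *ᴿ x (suc zero))

-- A piece is an intersection of half-planes and a shape is a union of pieces.
Piece Shape : Set
Piece = List HalfPlane
Shape = List Piece

inPiece : Piece → Region 2
inPiece P x = All (λ h → Positiveᴿ (slack h x)) P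

⟦_⟧ : Shape → Region 2
⟦ ps ⟧ x = Any (λ P → inPiece P x) ps

Point : Set
Point = ℤ × ℤ

slackℤ : HalfPlane → Point → ℤ
slackℤ h (x , y) = c h ℤ.- (a h ℤ.* x ℤ.+ b h ℤ.* y)

ι-slack : ∀ h p → ι (slackℤ h p) ≡ slackℚ h (ι (proj₁ p)) (ι (proj₂ p))
ι-slack h (x , y) = begin
  ι (c h ℤ.- (a h ℤ.* x ℤ.+ b h ℤ.* y))
    ≡⟨ ι-+ (c h) _ ⟩
  ι (c h) + ι (ℤ.- (a h ℤ.* x ℤ.+ b h ℤ.* y))
    ≡⟨ cong (λ t → ι (c h) + t) (ι-neg (a h ℤ.* x ℤ.+ b h ℤ.* y)) ⟩
  ι (c h) - ι (a h ℤ.* x ℤ.+ b h ℤ.* y)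
    ≡⟨ cong (λ t → ι (c h) - t) (trans (ι-+ (a h ℤ.* x) _) (cong₂ _+_ (ι-* (a h) x) (ι-* (b h) y))) ⟩
  ι (c h) - (ι (a h) * ι x + ι (b h) * ι y) ∎
  where open ≡-Reasoning

open-positive : ∀ {d} {f : ℝ^ d → ℝ} → Cts id f → OpenRegion (λ x → Positiveᴿ (f x))
open-positive {f = f} (cts F) x (positiveᴿ ε 0<ε h) = near-x (F x (½ * ε) (0<½* 0<ε))
  where
  lemma : ∀ a b ε → ½ * ε + (((b + ½ * ε) - a) + (a - ε)) ≡ b
  lemma = solve-∀ ℚ-ring
  near-x : (∃ λ δ → 0ℚ < δ × (∀ y → CloseAll δ x y → Close (½ * ε) (f x) (f y))) →
    Nbhd (λ x → Positiveᴿ (f x)) x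
  near-x (δ , 0<δ , k) = nbhd δ 0<δ λ y c → positiveᴿ (½ * ε) (0<½* 0<ε) (ev-zip
    (λ {n} a b → ≤-by-gap (0≤-+ (0≤-gap (near⇒≤ a)) (0≤-gap b)) (lemma (seq (f x) n) (seq (f y) n) ε))
    (eventually (k y c)) h)

cts-slack : ∀ h → Cts id (slack h)
cts-slack h = cts-sub cts-const (cts-+ (cts-* cts-const (cts-coordinate zero))
                                      (cts-* cts-const (cts-coordinate (suc zero))))

open-piece : ∀ P → OpenRegion (inPiece P)
open-piece []      x []       = nbhd 1ℚ 0<1 λ _ _ → []
open-piece (h ∷ P) x (p ∷ ps) = nbhd-map (λ (p , ps) → p ∷ ps)
  (nbhd-∩ (open-positive (cts-slack h) x p) (open-piece P x ps))

open-shape : ∀ ps → OpenRegion ⟦ ps ⟧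
open-shape (P ∷ ps) x (here p)  = nbhd-map here (open-piece P x p)
open-shape (P ∷ ps) x (there p) = nbhd-map there (open-shape ps x p)

0≤-⊔ : ∀ {a b} → 0ℚ ≤ b → 0ℚ ≤ a ⊔ b
0≤-⊔ {a} {b} 0≤b = ≤-trans 0≤b (p≤q⊔p a b)

0≤-⊓ : ∀ {a b} → 0ℚ ≤ a → 0ℚ ≤ b → 0ℚ ≤ a ⊓ b
0≤-⊓ {a} {b} 0≤a 0≤b = ⊓-glb 0≤a 0≤b

1-antimono : ∀ {a b} → a ≤ b → 1ℚ - b ≤ 1ℚ - a
1-antimono a≤b = +-monoʳ-≤ 1ℚ (neg-antimono-≤ a≤b)

below-⊔ : ∀ a b → Positiveᴿ (1ᴿ -ᴿ a) → Positiveᴿ (1ᴿ -ᴿ b) → Positiveᴿ (1ᴿ -ᴿ (a ⊔ᴿ b))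
below-⊔ a b (positiveᴿ ε 0<ε h) (positiveᴿ η 0<η k) =
  positiveᴿ (ε ⊓ η) (0<-⊓ 0<ε 0<η) (ev-zip (λ {n} → bound (seq a n) (seq b n)) h k)
  where
  bound : ∀ a b → ε ≤ 1ℚ - a → η ≤ 1ℚ - b → ε ⊓ η ≤ 1ℚ - (a ⊔ b)
  bound a b p q with ⊔-sel a b
  ... | inj₁ eq = subst (λ m → ε ⊓ η ≤ 1ℚ - m) (sym eq) (≤-trans (p⊓q≤p ε η) p)
  ... | inj₂ eq = subst (λ m → ε ⊓ η ≤ 1ℚ - m) (sym eq) (≤-trans (p⊓q≤q ε η) q)

-- The alternative is chosen by comparing sufficiently good rational approximations.
below-⊓ : ∀ a b → Positiveᴿ (1ᴿ -ᴿ (a ⊓ᴿ b)) → Positiveᴿ (1ᴿ -ᴿ a) ⊎ Positiveᴿ (1ᴿ -ᴿ b)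
below-⊓ a b (positiveᴿ ε 0<ε (L , h)) =
  choose (cauchy⇒near a (½ * ε) (0<½* 0<ε)) (cauchy⇒near b (½ * ε) (0<½* 0<ε))
  where
  Settled : ℝ → Set
  Settled x = ∃ λ N → ∀ m n → N ℕ.≤ m → N ℕ.≤ n → Near (½ * ε) (seq x m) (seq x n)
  lemma : ∀ a a₀ ε → ½ * ε + ((1ℚ - a₀ - ε) + ((a₀ + ½ * ε) - a)) ≡ 1ℚ - a
  lemma = solve-∀ ℚ-ring
  transfer : ∀ x N n₀ → N ℕ.≤ n₀ → (∀ m n → N ℕ.≤ m → N ℕ.≤ n → Near (½ * ε) (seq x m) (seq x n)) →
    ε ≤ 1ℚ - seq x n₀ → Positiveᴿ (1ᴿ -ᴿ x)
  transfer x N n₀ N≤n₀ k p = positiveᴿ (½ * ε) (0<½* 0<ε) (N , λ n N≤n → ≤-by-gap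
    (0≤-+ (0≤-gap p) (0≤-gap (near⇒≤ (k n n₀ N≤n N≤n₀)))) (lemma (seq x n) (seq x n₀) ε))
  choose : Settled a → Settled b → Positiveᴿ (1ᴿ -ᴿ a) ⊎ Positiveᴿ (1ᴿ -ᴿ b)
  choose (M , k) (N , l) = decide (⊓-sel (seq a n₀) (seq b n₀))
    where
    n₀ = L ℕ.⊔ (M ℕ.⊔ N)
    L≤ = ℕₚ.m≤m⊔n L (M ℕ.⊔ N)
    M≤ = ℕₚ.≤-trans (ℕₚ.m≤m⊔n M N) (ℕₚ.m≤n⊔m L (M ℕ.⊔ N))
    N≤ = ℕₚ.≤-trans (ℕₚ.m≤n⊔m M N) (ℕₚ.m≤n⊔m L (M ℕ.⊔ N))
    decide : seq a n₀ ⊓ seq b n₀ ≡ seq a n₀ ⊎ seq a n₀ ⊓ seq b n₀ ≡ seq b n₀ →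
             Positiveᴿ (1ᴿ -ᴿ a) ⊎ Positiveᴿ (1ᴿ -ᴿ b)
    decide (inj₁ eq) = inj₁ (transfer a M n₀ M≤ k (subst (λ m → ε ≤ 1ℚ - m) eq (h n₀ L≤)))
    decide (inj₂ eq) = inj₂ (transfer b N n₀ N≤ l (subst (λ m → ε ≤ 1ℚ - m) eq (h n₀ L≤)))

-- If all pieces contain the centre, then the shape is {N < 1} around the centre for its gauge N, which
-- is positively homogeneous, so u ↦ u / (1 - N u) stretches the shape radially onto the plane.
module Star (centre : Point) where

  Contains : Piece → Set
  Contains = All (λ h → 0ℤ ℤ.< slackℤ h centre)

  margin₀ : HalfPlane → ℚ
  margin₀ h = ι (slackℤ h centre)

  linearℚ : HalfPlane → ℚ → ℚ → ℚ
  linearℚ h x y = inv (margin₀ h) * (ι (a h) * x + ι (b h) * y)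

  linear : HalfPlane → ℝ^ 2 → ℝ
  linear h u = const (inv (margin₀ h)) *ᴿ
    (const (ι (a h)) *ᴿ u zero +ᴿ const (ι (b h)) *ᴿ u (suc zero))

  -- The Minkowski gauge of a convex piece around the centre: the largest of its functionals,
  -- normalised to be 1 on their boundary lines. The start value 0 keeps the gauge non-negative in
  -- directions in which the piece is unbounded. The gauge of a union is the minimum of the gauges.
  pieceℚ : Piece → ℚ → ℚ → ℚ
  pieceℚ []      x y = 0ℚ
  pieceℚ (h ∷ P) x y = linearℚ h x y ⊔ pieceℚ P x y

  pieceᴿ : Piece → ℝ^ 2 → ℝ
  pieceᴿ []      u = 0ᴿ
  pieceᴿ (h ∷ P) u = linear h u ⊔ᴿ pieceᴿ P u

  gaugeℚ : Piece → Shape → ℚ → ℚ → ℚ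
  gaugeℚ P []       x y = pieceℚ P x y
  gaugeℚ P (Q ∷ ps) x y = pieceℚ P x y ⊓ gaugeℚ Q ps x y

  gauge : Piece → Shape → ℝ^ 2 → ℝ
  gauge P []       u = pieceᴿ P u
  gauge P (Q ∷ ps) u = pieceᴿ P u ⊓ᴿ gauge Q ps u

  seq-piece : ∀ P u n → seq (pieceᴿ P u) n ≡ pieceℚ P (seq (u zero) n) (seq (u (suc zero)) n)
  seq-piece []      u n = refl
  seq-piece (h ∷ P) u n = cong (seq (linear h u) n ⊔_) (seq-piece P u n)

  seq-gauge : ∀ P ps u n → seq (gauge P ps u) n ≡ gaugeℚ P ps (seq (u zero) n) (seq (u (suc zero)) n)
  seq-gauge P []       u n = seq-piece P u n
  seq-gauge P (Q ∷ ps) u n = cong₂ _⊓_ (seq-piece P u n) (seq-gauge Q ps u n)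

  0≤-piece : ∀ P {x y} → 0ℚ ≤ pieceℚ P x y
  0≤-piece []              = ≤-refl
  0≤-piece (h ∷ P) {x} {y} = 0≤-⊔ {linearℚ h x y} (0≤-piece P)

  0≤-gauge : ∀ P ps {x y} → 0ℚ ≤ gaugeℚ P ps x y
  0≤-gauge P []       = 0≤-piece P
  0≤-gauge P (Q ∷ ps) = 0≤-⊓ (0≤-piece P) (0≤-gauge Q ps)

  piece-scale : ∀ P {t} → 0ℚ ≤ t → ∀ x y → pieceℚ P (x * t) (y * t) ≡ t * pieceℚ P x y
  piece-scale []      {t} 0≤t x y = sym (*-zeroʳ t)
  piece-scale (h ∷ P) {t} 0≤t x y = trans
    (cong₂ _⊔_ (lemma (inv (margin₀ h)) (ι (a h)) (ι (b h)) x y t) (piece-scale P 0≤t x y))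
    (sym (*-distribˡ-⊔-nonNeg t {{nonNegative 0≤t}} (linearℚ h x y) (pieceℚ P x y)))
    where
    lemma : ∀ r a b x y t → r * (a * (x * t) + b * (y * t)) ≡ t * (r * (a * x + b * y))
    lemma = solve-∀ ℚ-ring

  gauge-scale : ∀ P ps {t} → 0ℚ ≤ t → ∀ x y → gaugeℚ P ps (x * t) (y * t) ≡ t * gaugeℚ P ps x y
  gauge-scale P []       0≤t x y = piece-scale P 0≤t x y
  gauge-scale P (Q ∷ ps) {t} 0≤t x y = trans
    (cong₂ _⊓_ (piece-scale P 0≤t x y) (gauge-scale Q ps 0≤t x y))
    (sym (*-distribˡ-⊓-nonNeg t {{nonNegative 0≤t}} (pieceℚ P x y) (gaugeℚ Q ps x y)))

  module _ {A : Set} {d} {π : A → ℝ^ d} {f : A → ℝ^ 2} (f-cts : ∀ i → Cts π (λ p → f p i)) where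

    cts-piece : ∀ P → Cts π (λ p → pieceᴿ P (f p))
    cts-piece []      = cts-const
    cts-piece (h ∷ P) = cts-⊔ (cts-* cts-const
      (cts-+ (cts-* cts-const (f-cts zero)) (cts-* cts-const (f-cts (suc zero))))) (cts-piece P)

    cts-gauge : ∀ P ps → Cts π (λ p → gauge P ps (f p))
    cts-gauge P []       = cts-piece P
    cts-gauge P (Q ∷ ps) = cts-⊓ (cts-piece P) (cts-gauge Q ps)

  origin₀ : ℝ^ 2
  origin₀ zero    = const (ι (proj₁ centre))
  origin₀ (suc _) = const (ι (proj₂ centre))

  offset : ℝ^ 2 → ℝ^ 2
  offset x i = x i -ᴿ origin₀ i

  module _ (h : HalfPlane) (0<m : 0ℤ ℤ.< slackℤ h centre) where

    0<margin₀ : 0ℚ < margin₀ h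
    0<margin₀ = ι-mono-< 0<m

    private
      rewrite-slack : ∀ {m c a b x y p q} → m ≡ c - (a * p + b * q) →
        m - (a * (x - p) + b * (y - q)) ≡ c - (a * x + b * y)
      rewrite-slack {c = c} {a} {b} {x} {y} {p} {q} refl = lemma c a b x y p q
        where
        lemma : ∀ c a b x y p q → c - (a * p + b * q) - (a * (x - p) + b * (y - q)) ≡ c - (a * x + b * y)
        lemma = solve-∀ ℚ-ring

      X Y : ℝ^ 2 → ℕ → ℚ
      X x n = seq (x zero) n
      Y x n = seq (x (suc zero)) n

      seq-slack : ∀ x n → margin₀ h - (ι (a h) * (X x n - ι (proj₁ centre)) + ι (b h) * (Y x n - ι (proj₂ centre)))
                  ≡ seq (slack h x) n
      seq-slack x n = rewrite-slack {c = ι (c h)} {ι (a h)} {ι (b h)} {X x n} {Y x n} (ι-slack h centre)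

      inside-linear : ∀ x n → inv (margin₀ h) * seq (slack h x) n ≡ seq (1ᴿ -ᴿ linear h (offset x)) n
      inside-linear x n = begin
        r * seq (slack h x) n         ≡⟨ cong (r *_) (seq-slack x n) ⟨
        r * (margin₀ h - l)           ≡⟨ lemma r (margin₀ h) l ⟩
        r * margin₀ h - r * l         ≡⟨ cong (λ t → t - r * l) (inv-inverse 0<margin₀) ⟩
        1ℚ - r * l                    ∎
        where
        open ≡-Reasoning
        r = inv (margin₀ h)
        l = ι (a h) * (X x n - ι (proj₁ centre)) + ι (b h) * (Y x n - ι (proj₂ centre))
        lemma : ∀ r m l → r * (m - l) ≡ r * m - r * l
        lemma = solve-∀ ℚ-ring

    slack⇒linear : ∀ x → Positiveᴿ (slack h x) → Positiveᴿ (1ᴿ -ᴿ linear h (offset x))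
    slack⇒linear x p = positive-ev (ev-pure (inside-linear x))
      (positive-* (positive-const (0<-inv 0<margin₀)) p)

    linear⇒slack : ∀ x → Positiveᴿ (1ᴿ -ᴿ linear h (offset x)) → Positiveᴿ (slack h x)
    linear⇒slack x p = positive-ev (ev-pure λ n → begin
      m * seq (1ᴿ -ᴿ linear h (offset x)) n       ≡⟨ cong (m *_) (inside-linear x n) ⟨
      m * (inv m * seq (slack h x) n)             ≡⟨ lemma m (inv m) (seq (slack h x) n) ⟩
      (inv m * m) * seq (slack h x) n             ≡⟨ cong (_* seq (slack h x) n) (inv-inverse 0<margin₀) ⟩
      1ℚ * seq (slack h x) n                      ≡⟨ *-identityˡ (seq (slack h x) n) ⟩
      seq (slack h x) n                           ∎)
      (positive-* (positive-const 0<margin₀) p)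
      where
      open ≡-Reasoning
      m = margin₀ h
      lemma : ∀ m r s → m * (r * s) ≡ (r * m) * s
      lemma = solve-∀ ℚ-ring

  inPiece⇒below : ∀ P → Contains P → ∀ x → inPiece P x → Positiveᴿ (1ᴿ -ᴿ pieceᴿ P (offset x))
  inPiece⇒below []      []         x []       = positive-mono {1ᴿ} (λ _ → ≤-refl) (positive-const 0<1)
  inPiece⇒below (h ∷ P) (0<m ∷ cs) x (p ∷ ps) = below-⊔ (linear h (offset x)) (pieceᴿ P (offset x))
    (slack⇒linear h 0<m x p) (inPiece⇒below P cs x ps)

  below⇒inPiece : ∀ P → Contains P → ∀ x → Positiveᴿ (1ᴿ -ᴿ pieceᴿ P (offset x)) → inPiece P x
  below⇒inPiece []      []         x p = []
  below⇒inPiece (h ∷ P) (0<m ∷ cs) x p =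
    linear⇒slack h 0<m x (positive-mono (λ n → 1-antimono (p≤p⊔q (seq (linear h u) n) (seq (pieceᴿ P u) n))) p) ∷
    below⇒inPiece P cs x (positive-mono (λ n → 1-antimono (p≤q⊔p (seq (linear h u) n) (seq (pieceᴿ P u) n))) p)
    where u = offset x

  shape⇒below : ∀ P ps → All Contains (P ∷ ps) → ∀ x → x ∈ ⟦ P ∷ ps ⟧ → Positiveᴿ (1ᴿ -ᴿ gauge P ps (offset x))
  shape⇒below P []       (c ∷ [])  x (here p)  = inPiece⇒below P c x p
  shape⇒below P (Q ∷ ps) (c ∷ cs) x (here p)  = positive-mono
    (λ n → 1-antimono (p⊓q≤p (seq (pieceᴿ P (offset x)) n) (seq (gauge Q ps (offset x)) n)))
    (inPiece⇒below P c x p)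
  shape⇒below P (Q ∷ ps) (c ∷ cs) x (there p) = positive-mono
    (λ n → 1-antimono (p⊓q≤q (seq (pieceᴿ P (offset x)) n) (seq (gauge Q ps (offset x)) n)))
    (shape⇒below Q ps cs x p)

  below⇒shape : ∀ P ps → All Contains (P ∷ ps) → ∀ x → Positiveᴿ (1ᴿ -ᴿ gauge P ps (offset x)) → x ∈ ⟦ P ∷ ps ⟧
  below⇒shape P []       (c ∷ [])  x p = here (below⇒inPiece P c x p)
  below⇒shape P (Q ∷ ps) (c ∷ cs) x p with below-⊓ (pieceᴿ P (offset x)) (gauge Q ps (offset x)) p
  ... | inj₁ q = here (below⇒inPiece P c x q)
  ... | inj₂ q = there (below⇒shape Q ps cs x q)

  module _ (P : Piece) (ps : Shape) (contains : All Contains (P ∷ ps)) where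

    U : Region 2
    U = ⟦ P ∷ ps ⟧

    N : ℝ^ 2 → ℝ
    N = gauge P ps

    defect>0 : (p : ∃ U) → Positiveᴿ (1ᴿ -ᴿ N (offset (proj₁ p)))
    defect>0 (x , x∈U) = shape⇒below P ps contains x x∈U

    expansion : ∃ U → ℝ
    expansion p = recip (1ᴿ -ᴿ N (offset (proj₁ p))) (defect>0 p)

    expand : ∃ U → ℝ^ 2
    expand p i = offset (proj₁ p) i *ᴿ expansion p

    1+N>0 : ∀ y → Positiveᴿ (1ᴿ +ᴿ N y)
    1+N>0 y = positive-mono {1ᴿ} (λ n → ≤-by-gap
      (subst (0ℚ ≤_) (sym (seq-gauge P ps y n)) (0≤-gauge P ps)) refl) (positive-const 0<1)

    contraction : ℝ^ 2 → ℝ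
    contraction y = recip (1ᴿ +ᴿ N y) (1+N>0 y)

    contract : ℝ^ 2 → ℝ^ 2
    contract y i = origin₀ i +ᴿ y i *ᴿ contraction y

    seq-scaled : ∀ (u v : ℝ^ 2) n t → 0ℚ ≤ t → (∀ i → seq (u i) n ≡ seq (v i) n * t) →
      seq (N u) n ≡ t * seq (N v) n
    seq-scaled u v n t 0≤t eq = trans (seq-gauge P ps u n) (trans
      (cong₂ (gaugeℚ P ps) (eq zero) (eq (suc zero)))
      (trans (gauge-scale P ps 0≤t (seq (v zero) n) (seq (v (suc zero)) n))
        (cong (t *_) (sym (seq-gauge P ps v n)))))

    recentre : ∀ c y → (c + y) - c ≡ y
    recentre = solve-∀ ℚ-ring

    -- With s = 1 / (1 + N y), homogeneity gives N (s y) = s N y, and 1 - s N y = s. Positivity of s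
    -- puts the contracted point inside the shape, and the same equation makes `expand` divide by s
    -- again.
    contract-defect : ∀ y → Ev (λ n → seq (contraction y) n ≡ seq (1ᴿ -ᴿ N (offset (contract y))) n)
    contract-defect y = ev-map (λ {n} → at n) (positive-ev-< (1+N>0 y))
      where
      lemma : ∀ s N → s ≡ s * (1ℚ + N) - s * N
      lemma = solve-∀ ℚ-ring
      at : ∀ n → 0ℚ < 1ℚ + seq (N y) n → seq (contraction y) n ≡ 1ℚ - seq (N (offset (contract y))) n
      at n 0<1+N = trans (lemma s (seq (N y) n)) (cong₂ (λ a b → a - b) (inv-inverse 0<1+N)
        (sym (seq-scaled (offset (contract y)) y n s (<⇒≤ (0<-inv 0<1+N))
          (λ i → recentre (seq (origin₀ i) n) (seq (y i) n * s)))))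
        where s = seq (contraction y) n

    contract∈U : ∀ y → contract y ∈ U
    contract∈U y = below⇒shape P ps contains (contract y)
      (positive-ev (contract-defect y) (positive-recip (1+N>0 y)))

    contract-expand : ∀ p i → contract (expand p) i ≈ᴿ proj₁ p i
    contract-expand p@(x , _) i = ev-≡⇒≈ (contract (expand p) i) (x i)
      (ev-map (λ {n} → at n) (positive-ev-< (defect>0 p)))
      where
      lemma₁ : ∀ s N → 1ℚ + s * N ≡ s + (1ℚ - s * (1ℚ - N))
      lemma₁ = solve-∀ ℚ-ring
      lemma₂ : ∀ s → s + (1ℚ - 1ℚ) ≡ s
      lemma₂ = solve-∀ ℚ-ring
      lemma₃ : ∀ c x s D → c + ((x - c) * s) * D ≡ c + (x - c) * (s * D)
      lemma₃ = solve-∀ ℚ-ring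
      lemma₄ : ∀ c x → c + (x - c) * 1ℚ ≡ x
      lemma₄ = solve-∀ ℚ-ring
      at : ∀ n → 0ℚ < 1ℚ - seq (N (offset x)) n → seq (contract (expand p) i) n ≡ seq (x i) n
      at n 0<D = begin
        c₀ + ((xi - c₀) * s) * inv (1ℚ + seq (N (expand p)) n)
          ≡⟨ cong (λ t → c₀ + ((xi - c₀) * s) * inv t) (trans (cong (λ t → 1ℚ + t) scaled) 1+sN) ⟩
        c₀ + ((xi - c₀) * s) * inv s
          ≡⟨ cong (λ t → c₀ + ((xi - c₀) * s) * t) (inv-inv 0<D) ⟩
        c₀ + ((xi - c₀) * s) * D
          ≡⟨ lemma₃ c₀ xi s D ⟩
        c₀ + (xi - c₀) * (s * D)
          ≡⟨ cong (λ t → c₀ + (xi - c₀) * t) (inv-inverse 0<D) ⟩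
        c₀ + (xi - c₀) * 1ℚ
          ≡⟨ lemma₄ c₀ xi ⟩
        xi ∎
        where
        open ≡-Reasoning
        c₀ = seq (origin₀ i) n
        xi = seq (x i) n
        D = 1ℚ - seq (N (offset x)) n
        s = inv D
        scaled : seq (N (expand p)) n ≡ s * seq (N (offset x)) n
        scaled = seq-scaled (expand p) (offset x) n s (<⇒≤ (0<-inv 0<D)) (λ _ → refl)
        -- For s = 1 / (1 - N) one has 1 + s N = s, so contracting divides by the factor s of the
        -- expansion.
        1+sN : 1ℚ + s * seq (N (offset x)) n ≡ s
        1+sN = trans (lemma₁ s (seq (N (offset x)) n))
          (trans (cong (λ t → s + (1ℚ - t)) (inv-inverse 0<D)) (lemma₂ s))

    expand-contract : ∀ y i → expand (contract y , contract∈U y) i ≈ᴿ y i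
    expand-contract y i = ev-≡⇒≈ (expand (contract y , contract∈U y) i) (y i)
      (ev-zip (λ {n} → at n) (contract-defect y) (positive-ev-< (1+N>0 y)))
      where
      lemma : ∀ y s D → (y * s) * D ≡ y * (s * D)
      lemma = solve-∀ ℚ-ring
      at : ∀ n → seq (contraction y) n ≡ 1ℚ - seq (N (offset (contract y))) n → 0ℚ < 1ℚ + seq (N y) n →
           seq (expand (contract y , contract∈U y) i) n ≡ seq (y i) n
      at n defect 0<1+N = begin
        ((seq (origin₀ i) n + yi * s) - seq (origin₀ i) n) * inv (1ℚ - seq (N (offset (contract y))) n)
          ≡⟨ cong₂ (λ u D → u * inv D) (recentre (seq (origin₀ i) n) (yi * s)) (sym defect) ⟩
        (yi * s) * inv s
          ≡⟨ cong (λ t → (yi * s) * t) (inv-inv 0<1+N) ⟩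
        (yi * s) * (1ℚ + seq (N y) n)
          ≡⟨ lemma yi s (1ℚ + seq (N y) n) ⟩
        yi * (s * (1ℚ + seq (N y) n))
          ≡⟨ cong (yi *_) (inv-inverse 0<1+N) ⟩
        yi * 1ℚ
          ≡⟨ *-identityʳ yi ⟩
        yi ∎
        where
        open ≡-Reasoning
        yi = seq (y i) n
        s = seq (contraction y) n

    star-chart : Chart U
    star-chart = record
      { to       = expand
      ; from     = λ y → contract y , contract∈U y
      ; to-cts   = λ i → cts-* (offset-cts i) (cts-recip defect>0 (cts-sub cts-const (cts-gauge offset-cts P ps)))
      ; from-cts = λ i → cts-+ cts-const
          (cts-* (cts-coordinate i) (cts-recip 1+N>0 (cts-+ cts-const (cts-gauge cts-coordinate P ps))))
      ; from∘to  = contract-expand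
      ; to∘from  = expand-contract
      }
      where
      offset-cts : ∀ i → Cts (proj₁ {B = U}) (λ p → offset (proj₁ p) i)
      offset-cts i = cts-sub (cts-coordinate i) cts-const

-- Nerves without free faces, and their suspension

⊆∧∣∣≥⇒≡ : ∀ {n} {p q : Subset n} → p Sub.⊆ q → Sub.∣ q ∣ ℕ.≤ Sub.∣ p ∣ → q ≡ p
⊆∧∣∣≥⇒≡ {p = p} {q} p⊆q ∣q∣≤∣p∣ = Subₚ.⊆-antisym q⊆p p⊆q
  where
  q⊆p : q Sub.⊆ p
  q⊆p {x} x∈q with x Subₚ.∈? p
  ... | yes x∈p = x∈p
  ... | no x∉p = contradiction ∣q∣≤∣p∣ (ℕₚ.<⇒≱ (Subₚ.p⊂q⇒∣p∣<∣q∣ (p⊆q , x , x∈q , x∉p)))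

open ElementaryCollapse

-- Having the largest possible size d + 1 stands in for maximality; it is easily computed and passes
-- to suspensions.
record Facet {d n} (G : Fin n → Region d) (σ τ : Subset n) : Set where
  field
    isFace   : τ ∈ nerve G
    contains : σ Sub.⊆ τ
    full     : Sub.∣ τ ∣ ≡ suc d

open Facet

-- The last two fields make every face of size at most d lie in two facets,
-- so no elementary d-collapse is possible at all.
record Rigid {d n} (G : Fin n → Region d) : Set where
  field
    classify  : ∀ S → Empty (Intersection G S) ⊎ (OpenRegion (Intersection G S) × Chart (Intersection G S))
    inhabited : ∀ i → Satisfiable (G i)
    small     : ∀ {σ} → σ ∈ nerve G → Sub.∣ σ ∣ ℕ.≤ suc d
    branching : ∀ {σ} → σ ∈ nerve G → Sub.∣ σ ∣ ℕ.≤ d →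
                ∃ λ τ₁ → ∃ λ τ₂ → τ₁ ≢ τ₂ × Facet G σ τ₁ × Facet G σ τ₂

⊥-face : ∀ {d n} {G : Fin n → Region d} → Sub.⊥ ∈ nerve G
⊥-face = origin , λ i i∈⊥ → ⊥-elim (Subₚ.∉⊥ i∈⊥)

singleton-intersection : ∀ {d n} {G : Fin n → Region d} {i} → G i ⊆ Intersection G Sub.⁅ i ⁆
singleton-intersection {G = G} {i} {x} x∈Gi j j∈ = subst (λ j → x ∈ G j) (sym (Subₚ.x∈⁅y⁆⇒x≡y i j∈)) x∈Gi

singleton-face : ∀ {d n} {G : Fin n → Region d} {i} → Satisfiable (G i) → Sub.⁅ i ⁆ ∈ nerve G
singleton-face {G = G} (x , x∈Gi) = x , singleton-intersection {G = G} x∈Gi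

nerve-subface : ∀ {d n} {G : Fin n → Region d} {σ τ} → σ Sub.⊆ τ → τ ∈ nerve G → σ ∈ nerve G
nerve-subface σ⊆τ (x , h) = x , λ i i∈σ → h i (σ⊆τ i∈σ)

module _ {d n} {G : Fin n → Region d} (rigid : Rigid G) where

  open Rigid rigid

  facet-maximal : ∀ {σ τ} → Facet G σ τ → Maximal (nerve G) τ
  facet-maximal F = isFace F , λ η∈ τ⊆η → ⊆∧∣∣≥⇒≡ τ⊆η (ℕₚ.≤-trans (small η∈) (ℕₚ.≤-reflexive (sym (full F))))

  -- The case `empty` is refuted by branching as well: two different facets over the empty face
  -- cannot both be the empty set.
  not-collapsible : ¬ CollapsesToEmpty d (nerve G)
  not-collapsible (empty h)
    with τ₁ , τ₂ , τ₁≢τ₂ , F₁ , F₂ ← branching (⊥-face {G = G})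
           (ℕₚ.≤-trans (ℕₚ.≤-reflexive (Subₚ.∣⊥∣≡0 n)) ℕ.z≤n) =
    τ₁≢τ₂ (trans (h (isFace F₁)) (sym (h (isFace F₂))))
  not-collapsible (collapse σ E _)
    with τ₁ , τ₂ , τ₁≢τ₂ , F₁ , F₂ ← branching (is-face E) (dimension E) | _ , _ , unique ← unique-maximal E =
    τ₁≢τ₂ (trans (sym (unique (facet-maximal F₁ , contains F₁))) (unique (facet-maximal F₂ , contains F₂)))

module _ {k n} {G : Fin n → Region (suc k)} (rigid : Rigid G) where

  open Rigid rigid

  -- A common point of the regions of τ lies in `G i`, hence in `G j`, so adding j to τ leaves a
  -- face. At size d + 1 there is no room for a new vertex.
  facet-absorbs : ∀ {i j} → G i ⊆ G j → ∀ {σ τ} → Facet G σ τ → i Sub.∈ τ → j Sub.∈ τ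
  facet-absorbs {i} {j} Gi⊆Gj {τ = τ} F i∈τ with j Subₚ.∈? τ
  ... | yes j∈τ = j∈τ
  ... | no j∉τ = contradiction (small larger) (ℕₚ.<⇒≱ (subst (ℕ._< Sub.∣ τ Sub.∪ Sub.⁅ j ⁆ ∣) (full F)
      (Subₚ.p⊂q⇒∣p∣<∣q∣ (Subₚ.p⊆p∪q Sub.⁅ j ⁆ , j , Subₚ.q⊆p∪q τ Sub.⁅ j ⁆ (Subₚ.x∈⁅x⁆ j) , j∉τ))))
    where
    larger : (τ Sub.∪ Sub.⁅ j ⁆) ∈ nerve G
    larger with x , h ← isFace F = x , λ l l∈ →
      [ h l , (λ l∈j → singleton-intersection {G = G} (Gi⊆Gj (h i i∈τ)) l l∈j) ]′
      (Subₚ.x∈p∪q⁻ τ Sub.⁅ j ⁆ l∈)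

  -- For i ≠ j remove j from a facet through i. Every facet over what remains contains i, absorbs j
  -- and is therefore the original facet, whereas branching asks for two. The positive dimension
  -- `suc k` allows branching at the single vertex i.
  regions-distinct : ∀ i j → G i ≐ G j → i ≡ j
  regions-distinct i j (Gi⊆Gj , _) with i Finₚ.≟ j
  ... | yes i≡j = i≡j
  ... | no i≢j
    with τ , _ , _ , F , _ ← branching (singleton-face {G = G} (inhabited i))
           (ℕₚ.≤-trans (ℕₚ.≤-reflexive (Subₚ.∣⁅x⁆∣≡1 i)) (ℕ.s≤s ℕ.z≤n))
    = contradiction′ (branching {τ Sub.- j} (nerve-subface {G = G} (Subₚ.p─q⊆p τ Sub.⁅ j ⁆) (isFace F))
        (ℕ.s≤s⁻¹ (subst (Sub.∣ τ Sub.- j ∣ ℕ.<_) (full F) (Subₚ.x∈p⇒∣p-x∣<∣p∣ (facet-absorbs Gi⊆Gj F i∈τ)))))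
    where
    i∈τ : i Sub.∈ τ
    i∈τ = contains F (Subₚ.x∈⁅x⁆ i)
    same : ∀ {τ′} → Facet G (τ Sub.- j) τ′ → τ′ ≡ τ
    same {τ′} F′ = ⊆∧∣∣≥⇒≡ τ⊆τ′ (ℕₚ.≤-reflexive (trans (full F′) (sym (full F))))
      where
      τ⊆τ′ : τ Sub.⊆ τ′
      τ⊆τ′ {l} l∈τ with l Finₚ.≟ j
      ... | yes refl = facet-absorbs Gi⊆Gj F′ (contains F′ (Subₚ.x∈p∧x≢y⇒x∈p-y i∈τ i≢j))
      ... | no l≢j   = contains F′ (Subₚ.x∈p∧x≢y⇒x∈p-y l∈τ l≢j)
    contradiction′ : (∃ λ τ₁ → ∃ λ τ₂ → τ₁ ≢ τ₂ × Facet G (τ Sub.- j) τ₁ × Facet G (τ Sub.- j) τ₂) → i ≡ j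
    contradiction′ (τ₁ , τ₂ , τ₁≢τ₂ , F₁ , F₂) = contradiction (trans (same F₁) (sym (same F₂))) τ₁≢τ₂

  goodCover : IsGoodCover G
  goodCover = record
    { distinct      = regions-distinct
    ; cells         = λ i → cell i (classify Sub.⁅ i ⁆)
    ; intersections = λ S → Sum.map₂ (λ (o , c) → chart⇒cell o c) (classify S)
    }
    where
    cell : ∀ i → Empty (Intersection G Sub.⁅ i ⁆) ⊎
                 (OpenRegion (Intersection G Sub.⁅ i ⁆) × Chart (Intersection G Sub.⁅ i ⁆)) →
           IsCell (G i)
    cell i (inj₁ ∅)       = contradiction (proj₂ (singleton-face {G = G} (inhabited i))) (∅ (proj₁ (inhabited i)))
    cell i (inj₂ (o , c)) = chart⇒cell
      (λ x x∈ → nbhd-map at-i (o x (singleton-intersection {G = G} x∈)))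
      (iso-trans (iso-region (singleton-intersection {G = G}) at-i) c)
      where
      at-i : Intersection G Sub.⁅ i ⁆ ⊆ G i
      at-i h = h i (Subₚ.x∈⁅x⁆ i)

  nerveComplex : SimplicialComplex
  nerveComplex = record
    { #vertices  = n
    ; face       = nerve G
    ; empty-face = ⊥-face {G = G}
    ; vertex     = λ v → singleton-face {G = G} (inhabited v)
    ; subface    = nerve-subface {G = G}
    }

  representable : TopologicallyRepresentable (suc k) nerveComplex
  representable = n , G , goodCover , ↔-id (Fin n) , λ σ →
    subst (λ τ → σ ∈ nerve G ⇔ τ ∈ nerve G) (sym (Vecₚ.tabulate∘lookup σ)) (mk⇔ id id)

-- The suspension of a rigid cover

suspension : ∀ {d n} → (Fin n → Region d) → Fin (suc (suc n)) → Region (suc d)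
suspension G zero          x = Above (x zero)
suspension G (suc zero)    x = Below (x zero)
suspension G (suc (suc i)) x = x ∘ suc ∈ G i

open-⊠ : ∀ {d} {J : ℝ → Set} {U : Region d} →
         OpenRegion {suc d} (λ x → J (x zero)) → OpenRegion U → OpenRegion (J ⊠ U)
open-⊠ open-J open-U x (j , u) = nbhd-∩ (open-J x j) (nbhd-∘suc (open-U (x ∘ suc) u))

open-above : ∀ {d} → OpenRegion {suc d} (λ x → Above (x zero))
open-above x x>0 = nbhd-map (λ {y} → positive⇒0<ᴿ (y zero))
  (open-positive (cts-coordinate zero) x (0<ᴿ⇒positive (x zero) x>0))

open-below : ∀ {d} → OpenRegion {suc d} (λ x → Below (x zero))
open-below x x<0 = nbhd-map (λ {y} → positive⇒<ᴿ (y zero) 0ᴿ)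
  (open-positive (cts-sub cts-const (cts-coordinate zero)) x (<ᴿ⇒positive (x zero) 0ᴿ x<0))

open-line : ∀ {d} → OpenRegion {suc d} (λ x → Line (x zero))
open-line x _ = nbhd 1ℚ 0<1 λ _ _ → tt

module _ {d n} {G : Fin n → Region d} (rigid : Rigid G) where

  open Rigid rigid

  private
    ΣG = suspension G

    disjoint : ∀ {S} → Empty (Intersection ΣG (inside ∷ inside ∷ S))
    disjoint x h with h zero here | h (suc zero) (there here)
    ... | α , 0<α , N , p | β , 0<β , M , q = <-irrefl refl (<-≤-trans
      (<-≤-trans (0<-+ 0<β (≤-trans (<⇒≤ 0<α) (≤-trans (≤-reflexive (sym (+-identityˡ α))) (p m (ℕₚ.m≤m⊔n N M)))))
        (≤-reflexive (+-comm β (seq (x zero) m))))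
      (q m (ℕₚ.m≤n⊔m N M)))
      where m = N ℕ.⊔ M

    base : ∀ {a b S} → Intersection ΣG (a ∷ b ∷ S) ⊆ (λ x → x ∘ suc ∈ Intersection G S)
    base h i i∈S = h (suc (suc i)) (there (there i∈S))

    extend : ∀ {S x} → x ∘ suc ∈ Intersection G S → x ∈ Intersection ΣG (outside ∷ outside ∷ S)
    extend h (suc (suc i)) (there (there i∈S)) = h i i∈S

    extend-above : ∀ {S x} → Above (x zero) → x ∘ suc ∈ Intersection G S → x ∈ Intersection ΣG (inside ∷ outside ∷ S)
    extend-above j h zero          _                   = j
    extend-above j h (suc (suc i)) (there (there i∈S)) = h i i∈S

    extend-below : ∀ {S x} → Below (x zero) → x ∘ suc ∈ Intersection G S → x ∈ Intersection ΣG (outside ∷ inside ∷ S)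
    extend-below j h (suc zero)    _                   = j
    extend-below j h (suc (suc i)) (there (there i∈S)) = h i i∈S

    Cellular : ∀ {d} → Region d → Set
    Cellular U = Empty U ⊎ (OpenRegion U × Chart U)

    -- An intersection in the suspension splits off the new coordinate, which ranges over the line
    -- or an open half-line. Each of these is a copy of the line, so emptiness, openness and charts
    -- are inherited from `U`.
    cellular : ∀ {J : ℝ → Set} {U : Region d} {V : Region (suc d)} →
      OpenRegion {suc d} (λ x → J (x zero)) → Iso (scalar {J}) (id {A = ℝ^ 1}) →
      V ⊆ (J ⊠ U) → (J ⊠ U) ⊆ V → Cellular U → Cellular V
    cellular open-J line V⊆ ⊆V (inj₁ ∅)       = inj₁ λ x x∈V → ∅ (x ∘ suc) (proj₂ (V⊆ x∈V))
    cellular {J} {U} {V} open-J line V⊆ ⊆V (inj₂ (o , c)) = inj₂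
      ( (λ x x∈V → nbhd-map ⊆V (open-⊠ {J = J} {U} open-J o x (V⊆ x∈V)))
      , iso-trans (iso-region V⊆ ⊆V) (chart-⊠ line c))

    classify-suspension : ∀ S → Cellular (Intersection ΣG S)
    classify-suspension (inside  ∷ inside  ∷ S) = inj₁ disjoint
    classify-suspension (inside  ∷ outside ∷ S) = cellular {Above} open-above above-iso
      (λ h → h zero here , base h) (λ (j , h) → extend-above j h) (classify S)
    classify-suspension (outside ∷ inside  ∷ S) = cellular {Below} open-below (iso-trans below-above above-iso)
      (λ h → h (suc zero) (there here) , base h) (λ (j , h) → extend-below j h) (classify S)
    classify-suspension (outside ∷ outside ∷ S) = cellular {Line} open-line line-iso
      (λ h → tt , base h) (λ (_ , h) → extend h) (classify S)

    infixr 5 _◂_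
    _◂_ : ℝ → ℝ^ d → ℝ^ (suc d)
    (a ◂ x) zero    = a
    (a ◂ x) (suc i) = x i

    1>0 : Above 1ᴿ
    1>0 = positive⇒0<ᴿ 1ᴿ (positive-const 0<1)

    -1<0 : Below (const (- 1ℚ))
    -1<0 = positive⇒<ᴿ (const (- 1ℚ)) 0ᴿ (positive-mono {1ᴿ} (λ _ → ≤-refl) (positive-const 0<1))

    face-above : ∀ {S} → S ∈ nerve G → (inside ∷ outside ∷ S) ∈ nerve ΣG
    face-above (x , h) = 1ᴿ ◂ x , extend-above 1>0 h

    face-below : ∀ {S} → S ∈ nerve G → (outside ∷ inside ∷ S) ∈ nerve ΣG
    face-below (x , h) = const (- 1ℚ) ◂ x , extend-below -1<0 h

    face-base : ∀ {a b S} → (a ∷ b ∷ S) ∈ nerve ΣG → S ∈ nerve G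
    face-base (x , h) = x ∘ suc , base h

    facet-above : ∀ {a σ τ} → Facet G σ τ → Facet ΣG (a ∷ outside ∷ σ) (inside ∷ outside ∷ τ)
    facet-above F = record
      { isFace   = face-above (isFace F)
      ; contains = λ { here → here ; (there (there i∈σ)) → there (there (contains F i∈σ)) }
      ; full     = cong suc (full F)
      }

    facet-below : ∀ {b σ τ} → Facet G σ τ → Facet ΣG (outside ∷ b ∷ σ) (outside ∷ inside ∷ τ)
    facet-below F = record
      { isFace   = face-below (isFace F)
      ; contains = λ { (there here) → there here ; (there (there i∈σ)) → there (there (contains F i∈σ)) }
      ; full     = cong suc (full F)
      }

    facet : ∀ {σ} → σ ∈ nerve G → Sub.∣ σ ∣ ℕ.≤ suc d → ∃ λ τ → Facet G σ τ
    facet {σ} σ∈ ∣σ∣≤ with Sub.∣ σ ∣ ℕₚ.≤? d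
    ... | yes ∣σ∣≤d with τ , _ , _ , F , _ ← branching σ∈ ∣σ∣≤d = τ , F
    ... | no ∣σ∣≰d = σ , record
      { isFace = σ∈ ; contains = id ; full = ℕₚ.≤-antisym ∣σ∣≤ (ℕₚ.≰⇒> ∣σ∣≰d) }

    small-suspension : ∀ {σ} → σ ∈ nerve ΣG → Sub.∣ σ ∣ ℕ.≤ suc (suc d)
    small-suspension {inside  ∷ inside  ∷ S} (x , h) = contradiction h (disjoint x)
    small-suspension {inside  ∷ outside ∷ S} σ∈ = ℕ.s≤s (small (face-base σ∈))
    small-suspension {outside ∷ inside  ∷ S} σ∈ = ℕ.s≤s (small (face-base σ∈))
    small-suspension {outside ∷ outside ∷ S} σ∈ = ℕₚ.m≤n⇒m≤1+n (small (face-base σ∈))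

    -- A face with one apex is a cone, and the two facets below it are coned with the same apex. A
    -- face without apex may have d + 1 vertices, where the old branching can fail; but it lies in
    -- one old facet, whose two cones are different.
    branching-suspension : ∀ {σ} → σ ∈ nerve ΣG → Sub.∣ σ ∣ ℕ.≤ suc d →
      ∃ λ τ₁ → ∃ λ τ₂ → τ₁ ≢ τ₂ × Facet ΣG σ τ₁ × Facet ΣG σ τ₂
    branching-suspension {inside  ∷ inside  ∷ S} (x , h) _ = contradiction h (disjoint x)
    branching-suspension {inside  ∷ outside ∷ S} σ∈ (ℕ.s≤s ∣S∣≤d)
      with τ₁ , τ₂ , τ₁≢τ₂ , F₁ , F₂ ← branching (face-base σ∈) ∣S∣≤d =
      inside ∷ outside ∷ τ₁ , inside ∷ outside ∷ τ₂ ,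
      (λ eq → τ₁≢τ₂ (Vecₚ.∷-injectiveʳ (Vecₚ.∷-injectiveʳ eq))) , facet-above F₁ , facet-above F₂
    branching-suspension {outside ∷ inside  ∷ S} σ∈ (ℕ.s≤s ∣S∣≤d)
      with τ₁ , τ₂ , τ₁≢τ₂ , F₁ , F₂ ← branching (face-base σ∈) ∣S∣≤d =
      outside ∷ inside ∷ τ₁ , outside ∷ inside ∷ τ₂ ,
      (λ eq → τ₁≢τ₂ (Vecₚ.∷-injectiveʳ (Vecₚ.∷-injectiveʳ eq))) , facet-below F₁ , facet-below F₂
    branching-suspension {outside ∷ outside ∷ S} σ∈ ∣S∣≤
      with τ , F ← facet (face-base σ∈) ∣S∣≤ =
      inside ∷ outside ∷ τ , outside ∷ inside ∷ τ , (λ ()) , facet-above F , facet-below F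

  suspension-rigid : Rigid (suspension G)
  suspension-rigid = record
    { classify  = classify-suspension
    ; inhabited = λ { zero          → 1ᴿ ◂ origin , 1>0
                    ; (suc zero)    → const (- 1ℚ) ◂ origin , -1<0
                    ; (suc (suc i)) → 0ᴿ ◂ proj₁ (inhabited i) , proj₂ (inhabited i) }
    ; small     = small-suspension
    ; branching = branching-suspension
    }

-- Arrangements of polygons

open import Data.Integer.Base using (+_)

-- Three vectors in the plane are linearly dependent with their cross products as coefficients, so x
-- and y drop out of the weighted sum of the inequalities. For non-negative integers `+ 1 ≤ᵇ` says
-- that not all weights vanish. The weighted bound may be 0 because the half-planes are open.
contradictory : HalfPlane → HalfPlane → HalfPlane → Bool
contradictory (halfPlane a₁ b₁ c₁) (halfPlane a₂ b₂ c₂) (halfPlane a₃ b₃ c₃) =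
  (0ℤ ℤ.≤ᵇ l₁) ∧ (0ℤ ℤ.≤ᵇ l₂) ∧ (0ℤ ℤ.≤ᵇ l₃) ∧ (+ 1 ℤ.≤ᵇ l₁ ℤ.+ (l₂ ℤ.+ l₃)) ∧
  (l₁ ℤ.* c₁ ℤ.+ (l₂ ℤ.* c₂ ℤ.+ l₃ ℤ.* c₃) ℤ.≤ᵇ 0ℤ)
  where
  l₁ = a₂ ℤ.* b₃ ℤ.- a₃ ℤ.* b₂
  l₂ = a₃ ℤ.* b₁ ℤ.- a₁ ℤ.* b₃
  l₃ = a₁ ℤ.* b₂ ℤ.- a₂ ℤ.* b₁

ι-cross : ∀ a b c d → ι (a ℤ.* b ℤ.- c ℤ.* d) ≡ ι a * ι b - ι c * ι d
ι-cross a b c d = trans (ι-+ (a ℤ.* b) (ℤ.- (c ℤ.* d)))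
  (cong₂ _+_ (ι-* a b) (trans (ι-neg (c ℤ.* d)) (cong (λ t → - t) (ι-* c d))))

ι-combination : ∀ l₁ l₂ l₃ c₁ c₂ c₃ → ι (l₁ ℤ.* c₁ ℤ.+ (l₂ ℤ.* c₂ ℤ.+ l₃ ℤ.* c₃)) ≡
                ι l₁ * ι c₁ + (ι l₂ * ι c₂ + ι l₃ * ι c₃)
ι-combination l₁ l₂ l₃ c₁ c₂ c₃ = trans (ι-+ (l₁ ℤ.* c₁) _)
  (cong₂ _+_ (ι-* l₁ c₁) (trans (ι-+ (l₂ ℤ.* c₂) _) (cong₂ _+_ (ι-* l₂ c₂) (ι-* l₃ c₃))))

split : ∀ {x y} → T (x ∧ y) → T x × T y
split = Equivalence.to T-∧

-- Bounding each s from below by their minimum m gives at least (L₁ + L₂ + L₃) m, so there is no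
-- need to find out which weight is positive.
positive-combination : ∀ {L₁ L₂ L₃ s₁ s₂ s₃} → 0ℚ ≤ L₁ → 0ℚ ≤ L₂ → 0ℚ ≤ L₃ → 0ℚ < L₁ + (L₂ + L₃) →
  0ℚ < s₁ → 0ℚ < s₂ → 0ℚ < s₃ → 0ℚ < L₁ * s₁ + (L₂ * s₂ + L₃ * s₃)
positive-combination {L₁} {L₂} {L₃} {s₁} {s₂} {s₃} p₁ p₂ p₃ 0<L q₁ q₂ q₃ = <-≤-trans (0<-* 0<L 0<m)
  (≤-by-gap
    (0≤-+ (0≤-* p₁ (0≤-gap m≤₁)) (0≤-+ (0≤-* p₂ (0≤-gap m≤₂)) (0≤-* p₃ (0≤-gap m≤₃))))
    (lemma L₁ L₂ L₃ s₁ s₂ s₃ m))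
  where
  m = s₁ ⊓ (s₂ ⊓ s₃)
  0<m : 0ℚ < m
  0<m = 0<-⊓ q₁ (0<-⊓ q₂ q₃)
  m≤₁ : m ≤ s₁
  m≤₁ = p⊓q≤p s₁ (s₂ ⊓ s₃)
  m≤₂ : m ≤ s₂
  m≤₂ = ≤-trans (p⊓q≤q s₁ (s₂ ⊓ s₃)) (p⊓q≤p s₂ s₃)
  m≤₃ : m ≤ s₃
  m≤₃ = ≤-trans (p⊓q≤q s₁ (s₂ ⊓ s₃)) (p⊓q≤q s₂ s₃)
  lemma : ∀ L₁ L₂ L₃ s₁ s₂ s₃ m → (L₁ + (L₂ + L₃)) * m + (L₁ * (s₁ - m) + (L₂ * (s₂ - m) + L₃ * (s₃ - m)))
          ≡ L₁ * s₁ + (L₂ * s₂ + L₃ * s₃)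
  lemma = solve-∀ ℚ-ring

-- The cross products of the normals are the multipliers of Farkas' lemma.
contradictory-sound : ∀ h₁ h₂ h₃ → T (contradictory h₁ h₂ h₃) → ∀ x y →
  0ℚ < slackℚ h₁ x y → 0ℚ < slackℚ h₂ x y → 0ℚ < slackℚ h₃ x y → ⊥
contradictory-sound h₁@(halfPlane a₁ b₁ c₁) h₂@(halfPlane a₂ b₂ c₂) h₃@(halfPlane a₃ b₃ c₃) t x y s₁ s₂ s₃ =
  sound (split {0ℤ ℤ.≤ᵇ l₁} t)
  where
  l₁ = a₂ ℤ.* b₃ ℤ.- a₃ ℤ.* b₂
  l₂ = a₃ ℤ.* b₁ ℤ.- a₁ ℤ.* b₃
  l₃ = a₁ ℤ.* b₂ ℤ.- a₂ ℤ.* b₁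
  nonneg : ∀ l → T (0ℤ ℤ.≤ᵇ l) → 0ℚ ≤ ι l
  nonneg l t = ι-mono-≤ (ℤₚ.≤ᵇ⇒≤ {0ℤ} {l} t)
  identity : ∀ a₁ b₁ c₁ a₂ b₂ c₂ a₃ b₃ c₃ x y →
    (a₂ * b₃ - a₃ * b₂) * (c₁ - (a₁ * x + b₁ * y)) +
    ((a₃ * b₁ - a₁ * b₃) * (c₂ - (a₂ * x + b₂ * y)) + (a₁ * b₂ - a₂ * b₁) * (c₃ - (a₃ * x + b₃ * y)))
    ≡ (a₂ * b₃ - a₃ * b₂) * c₁ + ((a₃ * b₁ - a₁ * b₃) * c₂ + (a₁ * b₂ - a₂ * b₁) * c₃)
  identity = solve-∀ ℚ-ring
  combination : ∀ {L₁ L₂ L₃} → L₁ ≡ ι a₂ * ι b₃ - ι a₃ * ι b₂ → L₂ ≡ ι a₃ * ι b₁ - ι a₁ * ι b₃ →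
    L₃ ≡ ι a₁ * ι b₂ - ι a₂ * ι b₁ →
    L₁ * slackℚ h₁ x y + (L₂ * slackℚ h₂ x y + L₃ * slackℚ h₃ x y) ≡ L₁ * ι c₁ + (L₂ * ι c₂ + L₃ * ι c₃)
  combination refl refl refl = identity (ι a₁) (ι b₁) (ι c₁) (ι a₂) (ι b₂) (ι c₂) (ι a₃) (ι b₃) (ι c₃) x y
  sound : T (0ℤ ℤ.≤ᵇ l₁) × T ((0ℤ ℤ.≤ᵇ l₂) ∧ (0ℤ ℤ.≤ᵇ l₃) ∧ (+ 1 ℤ.≤ᵇ l₁ ℤ.+ (l₂ ℤ.+ l₃)) ∧
    (l₁ ℤ.* c₁ ℤ.+ (l₂ ℤ.* c₂ ℤ.+ l₃ ℤ.* c₃) ℤ.≤ᵇ 0ℤ)) → ⊥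
  sound (t₁ , t) with t₂ , t ← split {0ℤ ℤ.≤ᵇ l₂} t with t₃ , t ← split {0ℤ ℤ.≤ᵇ l₃} t
    with t₄ , t₅ ← split {+ 1 ℤ.≤ᵇ l₁ ℤ.+ (l₂ ℤ.+ l₃)} t =
    <-irrefl refl (<-≤-trans
      (positive-combination (nonneg l₁ t₁) (nonneg l₂ t₂) (nonneg l₃ t₃)
        (<-≤-trans 0<1 (≤-trans (ι-mono-≤ (ℤₚ.≤ᵇ⇒≤ {+ 1} {l₁ ℤ.+ (l₂ ℤ.+ l₃)} t₄))
          (≤-reflexive (trans (ι-+ l₁ _) (cong (λ s → ι l₁ + s) (ι-+ l₂ l₃))))))
        s₁ s₂ s₃)
      (≤-trans (≤-reflexive (trans
          (combination {ι l₁} {ι l₂} {ι l₃} (ι-cross a₂ b₃ a₃ b₂) (ι-cross a₃ b₁ a₁ b₃) (ι-cross a₁ b₂ a₂ b₁))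
          (sym (ι-combination l₁ l₂ l₃ c₁ c₂ c₃))))
        (ι-mono-≤ (ℤₚ.≤ᵇ⇒≤ {l₁ ℤ.* c₁ ℤ.+ (l₂ ℤ.* c₂ ℤ.+ l₃ ℤ.* c₃)} {0ℤ} t₅))))

-- By Helly's theorem in the plane emptiness already shows on three half-planes. All orders are
-- tried, since the orientation determines the signs of the cross products. An antiparallel pair is
-- caught together with a transversal third half-plane of weight 0.
vacuous : Piece → Bool
vacuous P = any (λ h₁ → any (λ h₂ → any (contradictory h₁ h₂) P) P) P

vacuous-sound : ∀ P → T (vacuous P) → ∀ x → ¬ inPiece P x
vacuous-sound P t x x∈P
  with h₁ , h₁∈P , t₁ ← find (Anyₚ.any⁻ (λ h₁ → any (λ h₂ → any (contradictory h₁ h₂) P) P) P t)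
  with h₂ , h₂∈P , t₂ ← find (Anyₚ.any⁻ (λ h₂ → any (contradictory h₁ h₂) P) P t₁)
  with h₃ , h₃∈P , t₃ ← find (Anyₚ.any⁻ (contradictory h₁ h₂) P t₂)
  = refute (ev-witness (ev-zip _,_ (inside-ev h₁ h₁∈P) (ev-zip _,_ (inside-ev h₂ h₂∈P) (inside-ev h₃ h₃∈P))))
  where
  inside-ev : ∀ h → h ∈ₗ P → Ev (λ n → 0ℚ < slackℚ h (seq (x zero) n) (seq (x (suc zero)) n))
  inside-ev h h∈P = positive-ev-< (All.lookup x∈P h∈P)
  refute : (∃ λ n → 0ℚ < slackℚ h₁ (seq (x zero) n) (seq (x (suc zero)) n) ×
            0ℚ < slackℚ h₂ (seq (x zero) n) (seq (x (suc zero)) n) ×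
            0ℚ < slackℚ h₃ (seq (x zero) n) (seq (x (suc zero)) n)) → ⊥
  refute (n , s₁ , s₂ , s₃) =
    contradictory-sound h₁ h₂ h₃ t₃ (seq (x zero) n) (seq (x (suc zero)) n) s₁ s₂ s₃

containsPoint : Point → Piece → Bool
containsPoint p = all (λ h → + 1 ℤ.≤ᵇ slackℤ h p)

-- The search for a contradiction is skipped for pieces with a known point.
discard : List Point → Piece → Bool
discard samples P = not (any (λ p → containsPoint p P) samples) ∧ vacuous P

prune : List Point → Shape → Shape
prune samples []       = []
prune samples (P ∷ ps) = if discard samples P then prune samples ps else P ∷ prune samples ps

prune⁺ : ∀ samples ps x → x ∈ ⟦ ps ⟧ → x ∈ ⟦ prune samples ps ⟧
prune⁺ samples (P ∷ ps) x p with discard samples P in eq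
prune⁺ samples (P ∷ ps) x (here p)  | true  =
  contradiction p (vacuous-sound P
    (proj₂ (split {not (any (λ p → containsPoint p P) samples)} (subst T (sym eq) tt))) x)
prune⁺ samples (P ∷ ps) x (there p) | true  = prune⁺ samples ps x p
prune⁺ samples (P ∷ ps) x (here p)  | false = here p
prune⁺ samples (P ∷ ps) x (there p) | false = there (prune⁺ samples ps x p)

prune⁻ : ∀ samples ps x → x ∈ ⟦ prune samples ps ⟧ → x ∈ ⟦ ps ⟧
prune⁻ samples (P ∷ ps) x p with discard samples P
prune⁻ samples (P ∷ ps) x p         | true  = there (prune⁻ samples ps x p)
prune⁻ samples (P ∷ ps) x (here p)  | false = here p
prune⁻ samples (P ∷ ps) x (there p) | false = there (prune⁻ samples ps x p)

module Arrangement (samples : List Point) where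

  meet : Shape → Shape → Shape
  meet ps qs = prune samples (cartesianProductWith _++_ ps qs)

  meet⁺ : ∀ ps qs x → x ∈ ⟦ ps ⟧ → x ∈ ⟦ qs ⟧ → x ∈ ⟦ meet ps qs ⟧
  meet⁺ ps qs x p q = prune⁺ samples (cartesianProductWith _++_ ps qs) x
    (Anyₚ.cartesianProductWith⁺ _++_ Allₚ.++⁺ p q)

  meet⁻ : ∀ ps qs x → x ∈ ⟦ meet ps qs ⟧ → x ∈ ⟦ ps ⟧ × x ∈ ⟦ qs ⟧
  meet⁻ ps qs x p = Anyₚ.cartesianProductWith⁻ _++_
    {R = λ P → inPiece P x} {P = λ P → inPiece P x} {Q = λ P → inPiece P x} (λ {P} → Allₚ.++⁻ P) ps qs
    (prune⁻ samples (cartesianProductWith _++_ ps qs) x p)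

  cover : ∀ {n} → Vec Shape n → Fin n → Region 2
  cover shapes i = ⟦ Vec.lookup shapes i ⟧

  intersect : ∀ {n} → Vec Shape n → Subset n → Shape → Shape
  intersect []       []            ps = ps
  intersect (s ∷ ss) (outside ∷ S) ps = intersect ss S ps
  intersect (s ∷ ss) (inside  ∷ S) ps = intersect ss S (meet ps s)

  intersect⁺ : ∀ {n} (ss : Vec Shape n) S ps x →
    x ∈ ⟦ ps ⟧ → x ∈ Intersection (cover ss) S → x ∈ ⟦ intersect ss S ps ⟧
  intersect⁺ []       []            ps x p h = p
  intersect⁺ (s ∷ ss) (outside ∷ S) ps x p h = intersect⁺ ss S ps x p (λ i i∈S → h (suc i) (there i∈S))
  intersect⁺ (s ∷ ss) (inside  ∷ S) ps x p h =
    intersect⁺ ss S (meet ps s) x (meet⁺ ps s x p (h zero here)) (λ i i∈S → h (suc i) (there i∈S))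

  intersect⁻ : ∀ {n} (ss : Vec Shape n) S ps x →
    x ∈ ⟦ intersect ss S ps ⟧ → x ∈ ⟦ ps ⟧ × x ∈ Intersection (cover ss) S
  intersect⁻ []       []            ps x p = p , λ _ ()
  intersect⁻ (s ∷ ss) (outside ∷ S) ps x p with q , h ← intersect⁻ ss S ps x p =
    q , λ { (suc i) (there i∈S) → h i i∈S }
  intersect⁻ (s ∷ ss) (inside  ∷ S) ps x p with q , h ← intersect⁻ ss S (meet ps s) x p =
    proj₁ (meet⁻ ps s x q) , λ { zero _ → proj₂ (meet⁻ ps s x q) ; (suc i) (there i∈S) → h i i∈S }

  -- A walk down the binary tree of subsets in which `ps` is the intersection of the regions chosen
  -- so far; all subsets that continue the choice share its computation.
  forAll : ∀ {n} → Vec Shape n → (Subset n → Shape → Bool) → Shape → Bool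
  forAll []       test ps = test [] ps
  forAll (s ∷ ss) test ps =
    forAll ss (λ S → test (outside ∷ S)) ps ∧ forAll ss (λ S → test (inside ∷ S)) (meet ps s)

  forAll-sound : ∀ {n} (ss : Vec Shape n) test ps → T (forAll ss test ps) → ∀ S → T (test S (intersect ss S ps))
  forAll-sound []       test ps t []            = t
  forAll-sound (s ∷ ss) test ps t (outside ∷ S) = forAll-sound ss (λ S → test (outside ∷ S)) ps
    (proj₁ (split {forAll ss (λ S → test (outside ∷ S)) ps} t)) S
  forAll-sound (s ∷ ss) test ps t (inside ∷ S)  = forAll-sound ss (λ S → test (inside ∷ S)) (meet ps s)
    (proj₂ (split {forAll ss (λ S → test (outside ∷ S)) ps} t)) S

  starAt : Point → Shape → Bool
  starAt p = all (containsPoint p)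

  starAt-sound : ∀ p ps → T (starAt p ps) → All (Star.Contains p) ps
  starAt-sound p ps t = All.map (λ {P} u → All.map
    (λ {h} v → ℤₚ.<-≤-trans (ℤ.+<+ (ℕ.s≤s ℕ.z≤n)) (ℤₚ.≤ᵇ⇒≤ {+ 1} {slackℤ h p} v))
    (Allₚ.all⁺ (λ h → + 1 ℤ.≤ᵇ slackℤ h p) P u)) (Allₚ.all⁺ (containsPoint p) ps t)

  module _ {n} (shapes : Vec Shape n) where

    plane : Shape
    plane = [] ∷ []

    common-part : Subset n → Shape
    common-part S = intersect shapes S plane

    intersection⇒part : ∀ S → Intersection (cover shapes) S ⊆ ⟦ common-part S ⟧
    intersection⇒part S {x} = intersect⁺ shapes S plane x (here [])

    part⇒intersection : ∀ S → ⟦ common-part S ⟧ ⊆ Intersection (cover shapes) S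
    part⇒intersection S {x} p = proj₂ (intersect⁻ shapes S plane x p)

    label : Point → Subset n
    label p = Vec.map (any (containsPoint p)) shapes

    -- Candidates for the triangles, read off the samples that lie in exactly three regions.
    -- Repetitions are harmless because `pair?` asks for different subsets.
    facets : List (Subset n)
    facets = List.filterᵇ (λ τ → Sub.∣ τ ∣ ℕ.≡ᵇ 3) (List.map label samples)

    _≟ₛ_ : (σ τ : Subset n) → Dec (σ ≡ τ)
    _≟ₛ_ = Vecₚ.≡-dec Boolₚ._≟_

    Pair : Subset n → Subset n → Subset n → Set
    Pair σ τ₁ τ₂ = τ₁ ≢ τ₂ × σ Sub.⊆ τ₁ × σ Sub.⊆ τ₂

    pair? : ∀ σ τ₁ τ₂ → Dec (Pair σ τ₁ τ₂)
    pair? σ τ₁ τ₂ = ¬? (τ₁ ≟ₛ τ₂) ×-dec (σ Subₚ.⊆? τ₁ ×-dec σ Subₚ.⊆? τ₂)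

    branches : Subset n → Bool
    branches σ = any (λ τ₁ → any (λ τ₂ → isYes (pair? σ τ₁ τ₂)) facets) facets

    -- Star-shapedness, the bound on the size of faces and branching in one Boolean, so that a
    -- single traversal by `forAll` settles all three. The `3` is d + 1 for the plane.
    test : Subset n → Shape → Bool
    test S ps = List.null ps ∨
      (any (λ p → starAt p ps) samples ∧ (Sub.∣ S ∣ ℕ.≤ᵇ 3) ∧ ((3 ℕ.≤ᵇ Sub.∣ S ∣) ∨ branches S))

    facetTest : Subset n → Bool
    facetTest τ = not (List.null (common-part τ)) ∧ (Sub.∣ τ ∣ ℕ.≡ᵇ 3)

    module _ (tests : T (forAll shapes test plane)) (facetTests : T (all facetTest facets))
             (nonempty : T (all (λ i → not (List.null (common-part Sub.⁅ i ⁆))) (List.allFin n))) where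

      tested : ∀ S → T (test S (common-part S))
      tested = forAll-sound shapes test plane tests

      starShaped : ∀ S P ps → common-part S ≡ P ∷ ps → ∃ λ p → All (Star.Contains p) (P ∷ ps)
      starShaped S P ps eq
        with p , _ , t ← find (Anyₚ.any⁻ (λ p → starAt p (P ∷ ps)) samples
               (proj₁ (split {any (λ p → starAt p (P ∷ ps)) samples} (subst (λ qs → T (test S qs)) eq (tested S))))) =
        p , starAt-sound p (P ∷ ps) t

      Chartable : Subset n → Set
      Chartable S = OpenRegion (Intersection (cover shapes) S) × Chart (Intersection (cover shapes) S)

      chartable : ∀ S P ps → common-part S ≡ P ∷ ps → Chartable S
      chartable S P ps eq = build (starShaped S P ps eq)
        where
        ⊆part : Intersection (cover shapes) S ⊆ ⟦ P ∷ ps ⟧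
        ⊆part {x} h = subst (λ qs → x ∈ ⟦ qs ⟧) eq (intersection⇒part S {x} h)
        part⊆ : ⟦ P ∷ ps ⟧ ⊆ Intersection (cover shapes) S
        part⊆ {x} p = part⇒intersection S {x} (subst (λ qs → x ∈ ⟦ qs ⟧) (sym eq) p)
        build : (∃ λ p → All (Star.Contains p) (P ∷ ps)) → Chartable S
        build (p , contains) =
          (λ x x∈ → nbhd-map (λ {y} → part⊆ {y}) (open-shape (P ∷ ps) x (⊆part {x} x∈))) ,
          iso-trans (iso-region (λ {y} → ⊆part {y}) (λ {y} → part⊆ {y})) (Star.star-chart p P ps contains)

      arrangement-classify : ∀ S → Empty (Intersection (cover shapes) S) ⊎ Chartable S
      arrangement-classify S = byParts (common-part S) refl
        where
        byParts : ∀ qs → common-part S ≡ qs → Empty (Intersection (cover shapes) S) ⊎ Chartable S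
        byParts []       eq = inj₁ λ x h → Anyₚ.¬Any[] (subst (λ qs → x ∈ ⟦ qs ⟧) eq (intersection⇒part S {x} h))
        byParts (P ∷ ps) eq = inj₂ (chartable S P ps eq)

      isNerve : ∀ S → T (not (List.null (common-part S))) → S ∈ nerve (cover shapes)
      isNerve S t = byParts (common-part S) refl t
        where
        byParts : ∀ qs → common-part S ≡ qs → T (not (List.null qs)) → S ∈ nerve (cover shapes)
        -- The inverse of the chart sends the origin of the plane to a point of the intersection.
        byParts (P ∷ ps) eq _ = Iso.from (proj₂ (chartable S P ps eq)) origin

      combinatorial : ∀ S → S ∈ nerve (cover shapes) →
        T ((Sub.∣ S ∣ ℕ.≤ᵇ 3) ∧ ((3 ℕ.≤ᵇ Sub.∣ S ∣) ∨ branches S))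
      combinatorial S (x , h) = byParts (common-part S) (intersection⇒part S {x} h) (tested S)
        where
        byParts : ∀ qs → x ∈ ⟦ qs ⟧ → T (test S qs) → T ((Sub.∣ S ∣ ℕ.≤ᵇ 3) ∧ ((3 ℕ.≤ᵇ Sub.∣ S ∣) ∨ branches S))
        byParts (P ∷ ps) _ t = proj₂ (split {any (λ p → starAt p (P ∷ ps)) samples} t)

      isFacet : ∀ {σ τ} → τ ∈ₗ facets → σ Sub.⊆ τ → Facet (cover shapes) σ τ
      isFacet {σ} {τ} τ∈ σ⊆τ = fromTest
        (split {not (List.null (common-part τ))} (All.lookup (Allₚ.all⁺ facetTest facets facetTests) τ∈))
        where
        fromTest : T (not (List.null (common-part τ))) × T (Sub.∣ τ ∣ ℕ.≡ᵇ 3) → Facet (cover shapes) σ τ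
        fromTest (t , u) = record { isFace = isNerve τ t ; contains = σ⊆τ ; full = ℕₚ.≡ᵇ⇒≡ _ 3 u }

      arrangement-branching : ∀ {σ} → σ ∈ nerve (cover shapes) → Sub.∣ σ ∣ ℕ.≤ 2 →
        ∃ λ τ₁ → ∃ λ τ₂ → τ₁ ≢ τ₂ × Facet (cover shapes) σ τ₁ × Facet (cover shapes) σ τ₂
      arrangement-branching {σ} σ∈ ∣σ∣≤2 =
        [ (λ t → contradiction (ℕₚ.≤ᵇ⇒≤ 3 _ t) (ℕₚ.<⇒≱ (ℕ.s≤s ∣σ∣≤2))) , branch ]′
        (Equivalence.to T-∨ (proj₂ (split {Sub.∣ σ ∣ ℕ.≤ᵇ 3} (combinatorial σ σ∈))))
        where
        branch : T (branches σ) → ∃ λ τ₁ → ∃ λ τ₂ → τ₁ ≢ τ₂ × Facet (cover shapes) σ τ₁ × Facet (cover shapes) σ τ₂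
        branch t
          with τ₁ , τ₁∈ , t₁ ← find (Anyₚ.any⁻ (λ τ₁ → any (λ τ₂ → isYes (pair? σ τ₁ τ₂)) facets) facets t)
          with τ₂ , τ₂∈ , t₂ ← find (Anyₚ.any⁻ (λ τ₂ → isYes (pair? σ τ₁ τ₂)) facets t₁)
          with τ₁≢τ₂ , σ⊆τ₁ , σ⊆τ₂ ← toWitness t₂ =
          τ₁ , τ₂ , τ₁≢τ₂ , isFacet τ₁∈ σ⊆τ₁ , isFacet τ₂∈ σ⊆τ₂

      arrangement-rigid : Rigid (cover shapes)
      arrangement-rigid = record
        { classify  = arrangement-classify
        ; inhabited = λ i → let x , h = isNerve Sub.⁅ i ⁆
                                        (All.lookup (Allₚ.all⁺ _ (List.allFin n) nonempty) (∈-allFin i))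
                            in x , h i (Subₚ.x∈⁅x⁆ i)
        ; small     = λ {σ} σ∈ → ℕₚ.≤ᵇ⇒≤ _ 3 (proj₁ (split {Sub.∣ σ ∣ ℕ.≤ᵇ 3} (combinatorial σ σ∈)))
        ; branching = arrangement-branching
        }

-- The planar cover

-- The coefficients of the image under `rotatePoint`: the slack of the rotated half-plane at a
-- rotated point is the old slack.
rotateHalfPlane : HalfPlane → HalfPlane
rotateHalfPlane (halfPlane a b c) = halfPlane (ℤ.- b) (a ℤ.- b) c

rotate : Shape → Shape
rotate = List.map (List.map rotateHalfPlane)

rotatePoint : Point → Point
rotatePoint (x , y) = ℤ.- x ℤ.- y , x

-- In the coordinates x = α, y = β, γ = - x - y the polygons are
--   bow:  α > 2 and (5 γ + α - β < -100 or 5 β + α - γ < -100)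
--   cap:  α > 16 and -5 γ < 120 + α - β and -5 β < 120 + α - γ
--   kite: α < 18 and β < 18 and γ < 2 and -γ < 22
-- and the rotation is α ↦ β ↦ γ ↦ α.
bow cap kite : Shape
bow  = (halfPlane -1ℤ 0ℤ (ℤ.- + 2) ∷ halfPlane (ℤ.- + 2) (ℤ.- + 3) (ℤ.- + 50) ∷ [])
     ∷ (halfPlane -1ℤ 0ℤ (ℤ.- + 2) ∷ halfPlane (+ 1) (+ 3) (ℤ.- + 50) ∷ []) ∷ []
cap  = (halfPlane -1ℤ 0ℤ (ℤ.- + 16) ∷ halfPlane (+ 2) (+ 3) (+ 60) ∷ halfPlane -1ℤ (ℤ.- + 3) (+ 60) ∷ []) ∷ []
kite = (halfPlane (+ 1) 0ℤ (+ 18) ∷ halfPlane 0ℤ (+ 1) (+ 18) ∷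
        halfPlane -1ℤ -1ℤ (+ 2) ∷ halfPlane (+ 1) (+ 1) (+ 22) ∷ []) ∷ []

shapes : Vec Shape 9
shapes = bow  ∷ rotate bow  ∷ rotate (rotate bow) ∷
         cap  ∷ rotate cap  ∷ rotate (rotate cap) ∷
         kite ∷ rotate kite ∷ rotate (rotate kite) ∷ []

orbit : Point → List Point
orbit p = p ∷ rotatePoint p ∷ rotatePoint (rotatePoint p) ∷ []

-- The wings of the bow have their corner at (100, -50); the point (108, -54) beyond it lies in both
-- wings and in the cap, and is the star centre of the bow and of its intersection with that cap.
-- Each of the other seven points lies in exactly three regions. Up to rotation they give
-- bow-bow-cap twice, bow-bow-kite, bow-cap-kite twice, cap-kite-kite and, at the origin, the three
-- kites: 6 · 3 + 1 = 19 triangles.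
samples : List Point
samples = List.concatMap orbit
  ((+ 108 , ℤ.- + 54) ∷ (+ 18 , + 5) ∷ (+ 5 , + 18) ∷ (+ 10 , + 11) ∷
   (+ 3 , + 17) ∷ (+ 17 , + 3) ∷ (+ 17 , + 0) ∷ (+ 0 , + 0) ∷ [])

open Arrangement samples

rigidCover : ∀ d → ∃ λ n → ∃ λ (G : Fin n → Region (2 ℕ.+ d)) → Rigid G
-- Each `tt` is a finite check by evaluation on integers: all 512 subsets of regions, then the
-- candidate facets, then the nine single regions.
rigidCover zero    = 9 , cover shapes , arrangement-rigid shapes tt tt tt
rigidCover (suc d) with n , G , rigid ← rigidCover d =
  2 ℕ.+ n , suspension G , suspension-rigid rigid

theorem1p2 : (d : ℕ) → 2 ℕ.≤ d →
    ∃ λ (K : SimplicialComplex) → TopologicallyRepresentable d K × ¬ (Collapsible d K)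
theorem1p2 (suc zero)    (ℕ.s≤s ())
theorem1p2 (suc (suc d)) _ with n , G , rigid ← rigidCover d =
  nerveComplex rigid , representable rigid , not-collapsible rigid
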